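{- For all integers $n\ge 0$ and $k\ge j\ge 0$, the number of PDO partitions $\lambda$ of weight $2n$ with $\ell_d(\lambda)=k$ and $\ell_d^o(\lambda)=j$ equals the number of ordered pairs $(\mu\,|\,\nu)$ of PDO partitions with $|\mu|+|\nu|=n$, $\ell_d(\mu)+\ell_d(\nu)=k$ (i.e. $k$ designated parts in total), and $\ell_r(\mu,\nu)=j/2$. Restated in terms of generating functions: for all $n\ge 0$, $$[q^{2n}]\,P_1(x,y,q) = [q^n]\,P_2(x,y,q),$$ where $$P_1(x,y,q):=\sum_{\lambda\in\mathcal{PDO}}x^{\ell_d(\lambda)}y^{\ell_d^o(\lambda)}q^{|\lambda|},\qquad P_2(x,y,q):=\sum_{(\mu|\nu)\in\mathcal{PDO}\times\mathcal{PDO}}x^{\ell_d(\mu)+\ell_d(\nu)}y^{2\ell_r(\mu,\nu)}q^{|\mu|+|\nu|}.$$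
   Context: A PDO partition (partition into odd parts with designated summands) of a nonnegative integer $n$ is an integer partition of $n$ all of whose parts are odd, together with a choice, for each part size that occurs, of exactly one of its occurrences (the "designated" one). Occurrences of the same part size are distinguished by position, so a part size occurring $t$ times can be designated in $t$ ways. The weight $|\lambda|$ is the sum of all parts of $\lambda$. $\mathcal{PDO}$ is the set of all PDO partitions of all nonnegative integers, including the empty partition (of weight $0$). For $\lambda\in\mathcal{PDO}$, $\ell_d(\lambda)$ is the number of different part sizes occurring in $\lambda$, and $\ell_d^o(\lambda)$ is the number of different part sizes that occur an odd number of times in $\lambda$. For a pair $(\mu\,|\,\nu)$ of PDO partitions, $\ell_r(\mu,\nu)$ is the number of different part sizes that occur in both $\mu$ and $\nu$. $[q^n]F$ denotes the coefficient of $q^n$ in the formal power series $F$ in $q$ (here with coefficients in $\mathbb{Z}[x,y]$). -}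

module Defs where

open import Data.Bool.Base using (Bool; true; false; if_then_else_)
import Data.Bool.Properties as Bool
open import Data.Integer.Base as ℤ using (ℤ; 0ℤ; 1ℤ)
open import Data.List.Base
  using (List; []; _∷_; length; map; filter; deduplicate; concatMap; cartesianProduct; upTo)
open import Data.List.Membership.Propositional using (_∈_; lose)
open import Data.List.Membership.Propositional.Properties
  using (∈-concatMap⁺; ∈-filter⁺; ∈-filter⁻; ∈-deduplicate⁺; ∈-deduplicate⁻;
         ∈-cartesianProduct⁺; ∈-upTo⁺)
import Data.List.Membership.DecPropositional as DecMembership
import Data.List.Properties as List
open import Data.List.Relation.Unary.All as All using (All; []; _∷_)
open import Data.List.Relation.Unary.Any using (here; there)
open import Data.List.Relation.Unary.Linked using (Linked; linked?)
open import Data.List.Relation.Unary.Unique.Propositional using (Unique)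
import Data.List.Relation.Unary.Unique.DecPropositional.Properties as DecUnique
open import Data.Nat.Base using (ℕ; zero; suc; _+_; _*_; _∸_; _<_; _≥_; s≤s; z≤n)
open import Data.Nat.Divisibility using (_∤_; _∣?_; _∣0)
open import Data.Nat.ListAction using (sum)
open import Data.Nat.Properties using (_≟_; _≥?_; m≤m+n; m+n∸m≡n)
open import Data.Product.Base using (_×_; _,_; proj₁; proj₂)
import Data.Product.Properties as Product
open import Function.Base using (_∘_)
open import Level using (Level)
open import Relation.Binary.Definitions using (DecidableEquality)
open import Relation.Binary.PropositionalEquality using (_≡_; refl; sym)
open import Relation.Nullary.Decidable using (does; map′; _×-dec_; ¬?)
open import Relation.Nullary.Negation using (contradiction)
open import Relation.Unary using (Pred; Decidable)

private variable
  a p q : Level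

record Enumeration {A : Set a} (P : Pred A p) : Set (a Level.⊔ p) where
  field
    elements : List A
    unique   : Unique elements
    sound    : ∀ {x} → x ∈ elements → P x
    complete : ∀ {x} → P x → x ∈ elements

open Enumeration public

-- The cardinality of { x | P x and Q x }.
number : {A : Set a} {P : Pred A p} {Q : Pred A q} → Enumeration P → Decidable Q → ℕ
number e Q? = length (filter Q? (elements e))

enumerate : {A : Set a} {P : Pred A p} → DecidableEquality A → Decidable P →
            (candidates : List A) → (∀ {x} → P x → x ∈ candidates) → Enumeration P
enumerate _≟ᴬ_ P? xs covers = record
  { elements = deduplicate _≟ᴬ_ (filter P? xs)
  ; unique   = DecUnique.deduplicate-! _≟ᴬ_ (filter P? xs)
  ; sound    = λ x∈ → proj₂ (∈-filter⁻ P? {xs = xs} (∈-deduplicate⁻ _≟ᴬ_ (filter P? xs) x∈))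
  ; complete = λ px → ∈-deduplicate⁺ _≟ᴬ_ (∈-filter⁺ P? (covers px) px)
  }

-- Each entry is one occurrence of a part: its size, and whether it is designated.
MarkedParts : Set
MarkedParts = List (ℕ × Bool)

_≟ᵉ_ : DecidableEquality (ℕ × Bool)
_≟ᵉ_ = Product.≡-dec _≟_ Bool._≟_

_≟ᵐ_ : DecidableEquality MarkedParts
_≟ᵐ_ = List.≡-dec _≟ᵉ_

sizes : MarkedParts → List ℕ
sizes = map proj₁

weight : MarkedParts → ℕ
weight = sum ∘ sizes

multiplicity : ℕ → MarkedParts → ℕ
multiplicity s = length ∘ filter (s ≟_) ∘ sizes

designations : ℕ → MarkedParts → ℕ
designations s = length ∘ filter ((s , true) ≟ᵉ_)

-- Partitions are listed in weakly decreasing order; positivity of the parts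
-- follows from their being odd.
record IsPDO (l : MarkedParts) : Set where
  constructor isPDO
  field
    decreasing : Linked _≥_ (sizes l)
    odd        : All (2 ∤_) (sizes l)
    designated : All (λ s → designations s l ≡ 1) (sizes l)

differentSizes : MarkedParts → List ℕ
differentSizes = deduplicate _≟_ ∘ sizes

ℓd : MarkedParts → ℕ
ℓd = length ∘ differentSizes

ℓdᵒ : MarkedParts → ℕ
ℓdᵒ l = length (filter (λ s → ¬? (2 ∣? multiplicity s l)) (differentSizes l))

ℓr : MarkedParts → MarkedParts → ℕ
ℓr m n = length (filter (_∈? sizes n) (differentSizes m))
  where open DecMembership _≟_ using (_∈?_)

PDOOfWeight : ℕ → Pred MarkedParts _
PDOOfWeight n l = IsPDO l × weight l ≡ n

PairOfWeight : ℕ → Pred (MarkedParts × MarkedParts) _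
PairOfWeight n (m , l) = IsPDO m × IsPDO l × weight m + weight l ≡ n

isPDO? : Decidable IsPDO
isPDO? l = map′ (λ (d , o , e) → isPDO d o e) (λ (isPDO d o e) → d , o , e)
  (linked? _≥?_ (sizes l)
    ×-dec All.all? (λ s → ¬? (2 ∣? s)) (sizes l)
    ×-dec All.all? (λ s → designations s l ≟ 1) (sizes l))

incrementHead : MarkedParts → List MarkedParts
incrementHead []            = []
incrementHead ((s , b) ∷ l) = ((suc s , b) ∷ l) ∷ []

-- All lists of positive marked parts with the given sum.
compositions : ℕ → List MarkedParts
compositions zero    = [] ∷ []
compositions (suc n) = concatMap
  (λ l → ((1 , false) ∷ l) ∷ ((1 , true) ∷ l) ∷ incrementHead l) (compositions n)

∈-compositions : ∀ l → All (2 ∤_) (sizes l) → l ∈ compositions (weight l)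
∈-compositions l o = go l (All.map positive o)
  where
  positive : ∀ {s} → 2 ∤ s → 0 < s
  positive {zero}  2∤0 = contradiction (2 ∣0) 2∤0
  positive {suc s} _   = s≤s z≤n

  go : ∀ l → All (0 <_) (sizes l) → l ∈ compositions (weight l)
  go []                        []       = here refl
  go ((suc zero , false) ∷ l)  (_ ∷ ps) = ∈-concatMap⁺ _ (lose (go l ps) (here refl))
  go ((suc zero , true) ∷ l)   (_ ∷ ps) = ∈-concatMap⁺ _ (lose (go l ps) (there (here refl)))
  go ((suc (suc s) , b) ∷ l)   (_ ∷ ps) =
    ∈-concatMap⁺ _ (lose (go ((suc s , b) ∷ l) (s≤s z≤n ∷ ps)) (there (there (here refl))))

pdosOfWeight : ∀ n → Enumeration (PDOOfWeight n)
pdosOfWeight n = enumerate _≟ᵐ_ (λ l → isPDO? l ×-dec (weight l ≟ n)) (compositions n)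
  λ { {l} (isPDO _ o _ , refl) → ∈-compositions l o }

pairsOfWeight : ∀ n → Enumeration (PairOfWeight n)
pairsOfWeight n = enumerate (Product.≡-dec _≟ᵐ_ _≟ᵐ_)
  (λ (m , l) → isPDO? m ×-dec isPDO? l ×-dec (weight m + weight l ≟ n)) candidates covers
  where
  pairs : ℕ → List (MarkedParts × MarkedParts)
  pairs i = cartesianProduct (elements (pdosOfWeight i)) (elements (pdosOfWeight (n ∸ i)))

  candidates : List (MarkedParts × MarkedParts)
  candidates = concatMap pairs (upTo (suc n))

  covers : ∀ {x} → PairOfWeight n x → x ∈ candidates
  covers {m , l} (pm , pl , refl) = ∈-concatMap⁺ pairs (lose
    (∈-upTo⁺ (s≤s (m≤m+n (weight m) (weight l))))
    (∈-cartesianProduct⁺ (complete (pdosOfWeight _) (pm , refl))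
      (complete (pdosOfWeight _) (pl , sym (m+n∸m≡n (weight m) (weight l))))))

-- Finite sums of terms c xⁱ yʲ, written (c , i , j); not normalised, hence
-- compared by _≈_ below rather than by _≡_.
ℤ[x,y] : Set
ℤ[x,y] = List (ℤ × ℕ × ℕ)

coefficient : ℕ → ℕ → ℤ[x,y] → ℤ
coefficient i j []                  = 0ℤ
coefficient i j ((c , i′ , j′) ∷ f) =
  (if does ((i ≟ i′) ×-dec (j ≟ j′)) then c else 0ℤ) ℤ.+ coefficient i j f

infix 4 _≈_
_≈_ : ℤ[x,y] → ℤ[x,y] → Set
f ≈ g = ∀ i j → coefficient i j f ≡ coefficient i j g

x^_y^_ : ℕ → ℕ → ℤ[x,y]
x^ i y^ j = (1ℤ , i , j) ∷ []

PowerSeries : Set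
PowerSeries = ℕ → ℤ[x,y]

infix 5 [q^_]_
[q^_]_ : ℕ → PowerSeries → ℤ[x,y]
[q^ n ] F = F n

-- The formal sum of f(u) q^|u|, where P n u says that u is an object with |u| = n.
-- Addition of polynomials is concatenation of lists of terms.
∑ : {A : Set a} {P : ℕ → Pred A p} → (∀ n → Enumeration (P n)) → (A → ℤ[x,y]) → PowerSeries
∑ e f n = concatMap f (elements (e n))

P₁ : PowerSeries
P₁ = ∑ pdosOfWeight λ l → x^ ℓd l y^ ℓdᵒ l

P₂ : PowerSeries
P₂ = ∑ pairsOfWeight λ (m , l) → x^ (ℓd m + ℓd l) y^ (2 * ℓr m l)

{-# OPTIONS --safe #-}

-- With z = q^m, the factors of P₁ and P₂ belonging to the part size m are
--   (1 + a z + z²)(1 + b z + z²) / (1 - z²)²   and   (1 + c z + z²)(1 + d z + z²) / (1 - z)⁴,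
-- where a + b = x y, a b = 2x - 4 and c + d = a b, c d = a² + b² - 4. Adjoin ζ and ξ with
-- a = ζ + ζ⁻¹ and b = ξ + ξ⁻¹; then c = ζξ + (ζξ)⁻¹ and d = ζξ⁻¹ + (ζξ⁻¹)⁻¹ will do. The product
-- of 1 + a q^m + q^(2m) over all odd m is a theta function, k(q) ∑ᵢ q^(i²) ζ^i with k even in q,
-- so the even part of the numerator of P₁ is k² ∑ q^(i²+j²) ζ^i ξ^j over i ≡ j mod 2. The
-- substitution (i , j) = (u + v , u - v) and q² ↦ q turn this sum into
-- ∑ q^(u²+v²) (ζξ)^u (ζξ⁻¹)^v, which is the one belonging to P₂. The remaining factors do not
-- depend on ζ and ξ, and they agree because P₁ = P₂ = 1 at x = 0, i.e. at ζ = 1, ξ = -1.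
-- All this is done modulo a power of q, where finite products suffice.

module Submission where

open import Algebra.Bundles using (AbelianGroup; CommutativeRing)
import Algebra.Consequences.Setoid as Consequences
import Algebra.Construct.DirectProduct as DirectProduct
import Algebra.Properties.CommutativeSemiring.Exp
import Algebra.Properties.Ring
import Algebra.Properties.Semiring.Exp
import Algebra.Properties.Semiring.Mult.TCOptimised
import Algebra.Solver.Ring
import Algebra.Solver.Ring.AlmostCommutativeRing as ACR
open import Data.Integer.Base as ℤ using (ℤ; +_; -[1+_]; ∣_∣)
import Data.Integer.Divisibility.Signed as ℤ∣
import Data.Integer.Properties as ℤ
import Data.Integer.Tactic.RingSolver as ℤSolver
open import Data.List.Base
  using (List; []; _∷_; _++_; map; filter; cartesianProduct; downFrom)
open import Data.List.Membership.Propositional using (_∈_)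
open import Data.List.Membership.Propositional.Properties
  using (∈-map⁺; ∈-map⁻; ∈-filter⁺; ∈-filter⁻; ∈-cartesianProduct⁺)
open import Data.List.Membership.Propositional.Properties.WithK using (unique∧set⇒bag)
open import Data.List.Relation.Binary.BagAndSetEquality using (∼bag⇒↭)
open import Data.List.Relation.Binary.Permutation.Propositional as ↭ using (_↭_)
open import Data.List.Relation.Unary.All as All using (All; []; _∷_)
open import Data.List.Relation.Unary.AllPairs using ([]; _∷_)
open import Data.List.Relation.Unary.Any using (here; there)
open import Data.List.Relation.Unary.Unique.Propositional using (Unique)
import Data.List.Relation.Unary.Unique.Propositional.Properties as Unique
open import Data.Maybe.Base using (Maybe; just; nothing)
open import Data.Nat.Base as ℕ using (ℕ; zero; suc; _≤_; _<_; z≤n; s≤s)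
open import Data.Nat.Divisibility using (_∣_; _∣?_; divides; _∣0)
open import Data.Nat.Primality using (prime?; euclidsLemma)
import Data.Nat.Properties as ℕ
open import Data.Nat.Tactic.RingSolver using (solve-∀)
open import Data.Product.Base using (_×_; _,_; proj₁; proj₂; ∃-syntax)
open import Data.Sum.Base using (reduce)
open import Data.Vec.Base as Vec using (Vec; []; _∷_)
open import Function.Base using (_∘_)
open import Function.Bundles using (mk⇔)
import Relation.Binary.Reasoning.Setoid
open import Relation.Binary.PropositionalEquality as ≡ using (_≡_; _≢_)
open import Relation.Nullary.Decidable using (Dec; yes; no; _×-dec_; from-yes)
open import Relation.Nullary.Negation using (¬_; contradiction)
open import Relation.Unary using (Pred; Decidable)

-- Summed over its occurrences, one part size gives a palindromic numerator in z; that is why it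
-- splits into factors 1 + a z + z² and Jacobi's triple product applies. None of a, b, ζ, ξ lies in
-- ℤ[x,y], so they are adjoined by monic quadratics: each extension is free with basis 1, θ, and the
-- first coordinate brings an identity between elements of the base ring back to it. The same
-- construction with θ² = p supplies q, and then the first coordinate is the even part. The identity
-- is therefore stated over any commutative ring in which p is nilpotent. Nilpotence replaces every
-- limit: the finite triple product becomes a theta sum because q^(2n+1) vanishes for large n, and 1
-- - p^m is invertible for m > 0. The theta constants are never evaluated: the expansions at (ζ, ξ)
-- and at (1, -1) are multiplied crosswise, so that the only division is by factors 1 - p^m. Finally
-- x, y and p become the variables of truncated power series over ℤ, where a single coefficient
-- counts partitions.

module RingSolver {c ℓ} (R : CommutativeRing c ℓ) where
  open CommutativeRing R
  open Algebra.Properties.Ring ring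
  open Algebra.Properties.Semiring.Mult.TCOptimised semiring renaming (_×_ to _×′_)
  open Relation.Binary.Reasoning.Setoid setoid

  private
    ⟦_⟧ᶻ : ℤ → Carrier
    ⟦ + n ⟧ᶻ      = n ×′ 1#
    ⟦ -[1+ n ] ⟧ᶻ = - (suc n ×′ 1#)

    -‿homo : ∀ i → ⟦ ℤ.- i ⟧ᶻ ≈ - ⟦ i ⟧ᶻ
    -‿homo (+ zero)  = sym -0#≈0#
    -‿homo (+ suc n) = refl
    -‿homo -[1+ n ]  = sym (-‿involutive _)

    ⊖-homo : ∀ m n → ⟦ m ℤ.⊖ n ⟧ᶻ ≈ m ×′ 1# - n ×′ 1#
    ⊖-homo m       zero    = sym (trans (+-congˡ -0#≈0#) (+-identityʳ _))
    ⊖-homo zero    (suc n) = sym (+-identityˡ _)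
    ⊖-homo (suc m) (suc n) = begin
      ⟦ suc m ℤ.⊖ suc n ⟧ᶻ               ≡⟨ ≡.cong ⟦_⟧ᶻ (ℤ.[1+m]⊖[1+n]≡m⊖n m n) ⟩
      ⟦ m ℤ.⊖ n ⟧ᶻ                       ≈⟨ ⊖-homo m n ⟩
      m ×′ 1# - n ×′ 1#                    ≈⟨ +-congʳ (xyx⁻¹≈y 1# (m ×′ 1#)) ⟨
      1# + m ×′ 1# + - 1# - n ×′ 1#        ≈⟨ +-assoc _ _ _ ⟩
      1# + m ×′ 1# + (- 1# - n ×′ 1#)      ≈⟨ +-congˡ (-‿+-comm 1# (n ×′ 1#)) ⟩
      (1# + m ×′ 1#) - (1# + n ×′ 1#)      ≈⟨ +-cong (1+× m 1#) (-‿cong (1+× n 1#)) ⟨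
      suc m ×′ 1# - suc n ×′ 1#            ∎

    +-homo : ∀ i j → ⟦ i ℤ.+ j ⟧ᶻ ≈ ⟦ i ⟧ᶻ + ⟦ j ⟧ᶻ
    +-homo (+ m)    (+ n)    = ×-homo-+ 1# m n
    +-homo (+ m)    -[1+ n ] = ⊖-homo m (suc n)
    +-homo -[1+ m ] (+ n)    = trans (⊖-homo n (suc m)) (+-comm _ _)
    +-homo -[1+ m ] -[1+ n ] = begin
      - (suc (suc (m ℕ.+ n)) ×′ 1#)          ≡⟨ ≡.cong (λ k → - (suc k ×′ 1#)) (≡.sym (ℕ.+-suc m n)) ⟩
      - ((suc m ℕ.+ suc n) ×′ 1#)            ≈⟨ -‿cong (×-homo-+ 1# (suc m) (suc n)) ⟩
      - (suc m ×′ 1# + suc n ×′ 1#)           ≈⟨ -‿+-comm _ _ ⟨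
      - (suc m ×′ 1#) + - (suc n ×′ 1#)       ∎

    *-homo⁺ : ∀ m j → ⟦ + m ℤ.* j ⟧ᶻ ≈ ⟦ + m ⟧ᶻ * ⟦ j ⟧ᶻ
    *-homo⁺ m (+ n)    = trans (reflexive (≡.cong ⟦_⟧ᶻ (≡.sym (ℤ.pos-* m n)))) (×1-homo-* m n)
    *-homo⁺ m -[1+ n ] = begin
      ⟦ + m ℤ.* ℤ.- (+ suc n) ⟧ᶻ     ≡⟨ ≡.cong ⟦_⟧ᶻ (ℤ.neg-distribʳ-* (+ m) (+ suc n)) ⟨
      ⟦ ℤ.- (+ m ℤ.* + suc n) ⟧ᶻ     ≈⟨ -‿homo (+ m ℤ.* + suc n) ⟩
      - ⟦ + m ℤ.* + suc n ⟧ᶻ         ≈⟨ -‿cong (*-homo⁺ m (+ suc n)) ⟩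
      - (m ×′ 1# * (suc n ×′ 1#))      ≈⟨ -‿distribʳ-* _ _ ⟩
      m ×′ 1# * - (suc n ×′ 1#)        ∎

    *-homo : ∀ i j → ⟦ i ℤ.* j ⟧ᶻ ≈ ⟦ i ⟧ᶻ * ⟦ j ⟧ᶻ
    *-homo (+ m)    j = *-homo⁺ m j
    *-homo -[1+ m ] j = begin
      ⟦ ℤ.- (+ suc m) ℤ.* j ⟧ᶻ       ≡⟨ ≡.cong ⟦_⟧ᶻ (ℤ.neg-distribˡ-* (+ suc m) j) ⟨
      ⟦ ℤ.- (+ suc m ℤ.* j) ⟧ᶻ       ≈⟨ -‿homo (+ suc m ℤ.* j) ⟩
      - ⟦ + suc m ℤ.* j ⟧ᶻ           ≈⟨ -‿cong (*-homo⁺ (suc m) j) ⟩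
      - (suc m ×′ 1# * ⟦ j ⟧ᶻ)        ≈⟨ -‿distribˡ-* _ _ ⟩
      - (suc m ×′ 1#) * ⟦ j ⟧ᶻ        ∎

    -- The coefficients are integers rather than ring elements because their equality is decidable:
    -- the solver can then see numerical terms cancel in an arbitrary commutative ring.
    homomorphism : ℤ.+-*-rawRing ACR.-Raw-AlmostCommutative⟶ ACR.fromCommutativeRing R
    homomorphism = record
      { ⟦_⟧ = ⟦_⟧ᶻ ; +-homo = +-homo ; *-homo = *-homo ; -‿homo = -‿homo
      ; 0-homo = refl ; 1-homo = refl }

    equal? : ∀ i j → Maybe (⟦ i ⟧ᶻ ≈ ⟦ j ⟧ᶻ)
    equal? i j with i ℤ.≟ j
    ... | yes ≡.refl = just refl
    ... | no  _      = nothing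

  open Algebra.Solver.Ring ℤ.+-*-rawRing (ACR.fromCommutativeRing R) homomorphism equal? public
    using (Polynomial; solve; _:+_; _:*_; _:-_; :-_; _:=_; con)

  :0 :1 : ∀ {n} → Polynomial n
  :0 = con (+ 0)
  :1 = con (+ 1)

-- Finite sums and products

module Sums {c ℓ} (R : CommutativeRing c ℓ) where
  open CommutativeRing R
  open RingSolver R
  open Relation.Binary.Reasoning.Setoid setoid

  ∑[_] : ∀ {i} {I : Set i} → List I → (I → Carrier) → Carrier
  ∑[ [] ]     f = 0#
  ∑[ i ∷ is ] f = f i + ∑[ is ] f

  ∏ : (ℕ → Carrier) → ℕ → Carrier
  ∏ f zero    = 1#
  ∏ f (suc n) = f n * ∏ f n

  ∏-cong : ∀ {f g} n → (∀ i → f i ≈ g i) → ∏ f n ≈ ∏ g n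
  ∏-cong zero    f≈g = refl
  ∏-cong (suc n) f≈g = *-cong (f≈g n) (∏-cong n f≈g)

  ∏-* : ∀ f g n → ∏ (λ i → f i * g i) n ≈ ∏ f n * ∏ g n
  ∏-* f g zero    = sym (*-identityˡ 1#)
  ∏-* f g (suc n) = trans (*-congˡ (∏-* f g n))
    (solve 4 (λ x y u v → x :* y :* (u :* v) := x :* u :* (y :* v)) refl _ _ _ _)

  ∏-1 : ∀ n → ∏ (λ _ → 1#) n ≈ 1#
  ∏-1 zero    = refl
  ∏-1 (suc n) = trans (*-identityˡ _) (∏-1 n)

  module _ {i} {I : Set i} where

    ∑-cong∈ : ∀ is {f g : I → Carrier} → (∀ {i} → i ∈ is → f i ≈ g i) → ∑[ is ] f ≈ ∑[ is ] g
    ∑-cong∈ []       f≈g = refl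
    ∑-cong∈ (i ∷ is) f≈g = +-cong (f≈g (here ≡.refl)) (∑-cong∈ is (f≈g ∘ there))

    ∑-cong : ∀ is {f g : I → Carrier} → (∀ i → f i ≈ g i) → ∑[ is ] f ≈ ∑[ is ] g
    ∑-cong is f≈g = ∑-cong∈ is (λ {i} _ → f≈g i)

    ∑-++ : ∀ is js (f : I → Carrier) → ∑[ is ++ js ] f ≈ ∑[ is ] f + ∑[ js ] f
    ∑-++ []       js f = sym (+-identityˡ _)
    ∑-++ (i ∷ is) js f = trans (+-congˡ (∑-++ is js f)) (sym (+-assoc _ _ _))

    ∑-+ : ∀ is (f g : I → Carrier) → ∑[ is ] (λ i → f i + g i) ≈ ∑[ is ] f + ∑[ is ] g
    ∑-+ []       f g = sym (+-identityˡ 0#)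
    ∑-+ (i ∷ is) f g = trans (+-congˡ (∑-+ is f g))
      (solve 4 (λ x y u v → x :+ y :+ (u :+ v) := x :+ u :+ (y :+ v)) refl _ _ _ _)

    *-∑ : ∀ a is (f : I → Carrier) → a * ∑[ is ] f ≈ ∑[ is ] (λ i → a * f i)
    *-∑ a []       f = zeroʳ a
    *-∑ a (i ∷ is) f = trans (distribˡ _ _ _) (+-congˡ (*-∑ a is f))

    ∑-* : ∀ a is (f : I → Carrier) → ∑[ is ] f * a ≈ ∑[ is ] (λ i → f i * a)
    ∑-* a is f = trans (*-comm _ _) (trans (*-∑ a is f) (∑-cong is λ _ → *-comm _ _))

    ∑-↭ : ∀ {is js} (f : I → Carrier) → is ↭ js → ∑[ is ] f ≈ ∑[ js ] f
    ∑-↭ f ↭.refl        = refl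
    ∑-↭ f (↭.prep i p)  = +-congˡ (∑-↭ f p)
    ∑-↭ f (↭.swap i j p) = trans (+-congˡ (+-congˡ (∑-↭ f p)))
      (solve 3 (λ x y z → x :+ (y :+ z) := y :+ (x :+ z)) refl _ _ _)
    ∑-↭ f (↭.trans p q) = trans (∑-↭ f p) (∑-↭ f q)

    ∑-filter : ∀ {p} {P : Pred I p} (P? : Decidable P) is (f : I → Carrier) →
               (∀ i → ¬ P i → f i ≈ 0#) → ∑[ is ] f ≈ ∑[ filter P? is ] f
    ∑-filter P? []       f f≈0 = refl
    ∑-filter P? (i ∷ is) f f≈0 with P? i
    ... | yes _  = +-congˡ (∑-filter P? is f f≈0)
    ... | no ¬Pi = trans (+-cong (f≈0 i ¬Pi) (∑-filter P? is f f≈0)) (+-identityˡ _)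

  module _ {i j} {I : Set i} {J : Set j} where

    ∑-map : ∀ (h : J → I) js (f : I → Carrier) → ∑[ map h js ] f ≈ ∑[ js ] (f ∘ h)
    ∑-map h []       f = refl
    ∑-map h (j ∷ js) f = +-congˡ (∑-map h js f)

  module _ {i j} {I : Set i} {J : Set j} where

    ∑-cartesianProduct : ∀ is js (f : I × J → Carrier) →
      ∑[ cartesianProduct is js ] f ≈ ∑[ is ] (λ i → ∑[ js ] (λ j → f (i , j)))
    ∑-cartesianProduct []       js f = refl
    ∑-cartesianProduct (i ∷ is) js f = trans (∑-++ (map (i ,_) js) _ f)
      (+-cong (∑-map (i ,_) js f) (∑-cartesianProduct is js f))

    ∑*∑ : ∀ is js (f : I → Carrier) (g : J → Carrier) →
          ∑[ is ] f * ∑[ js ] g ≈ ∑[ cartesianProduct is js ] (λ (i , j) → f i * g j)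
    ∑*∑ is js f g = begin
      ∑[ is ] f * ∑[ js ] g
        ≈⟨ ∑-* (∑[ js ] g) is f ⟩
      ∑[ is ] (λ i → f i * ∑[ js ] g)
        ≈⟨ ∑-cong is (λ i → *-∑ (f i) js g) ⟩
      ∑[ is ] (λ i → ∑[ js ] (λ j → f i * g j))
        ≈⟨ ∑-cartesianProduct is js _ ⟨
      ∑[ cartesianProduct is js ] (λ (i , j) → f i * g j) ∎


-- Quadratic extensions and truncated power series

-- R[θ] with θ² = r + s θ, where (a , b) stands for a + b θ.
module QuadraticExtension {c ℓ} (R : CommutativeRing c ℓ)
                          (r s : CommutativeRing.Carrier R) where
  open CommutativeRing R
  open RingSolver R

  private
    ⊕-group : AbelianGroup c ℓ
    ⊕-group = DirectProduct.abelianGroup +-abelianGroup +-abelianGroup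

    module ⊕ = AbelianGroup ⊕-group

    infixl 7 _⊛_
    _⊛_ : Carrier × Carrier → Carrier × Carrier → Carrier × Carrier
    (a , b) ⊛ (a′ , b′) = a * a′ + r * (b * b′) , a * b′ + b * a′ + s * (b * b′)

    ⊛-cong : ∀ {u u′ v v′} → u ⊕.≈ u′ → v ⊕.≈ v′ → u ⊛ v ⊕.≈ u′ ⊛ v′
    ⊛-cong (a≈ , b≈) (a′≈ , b′≈) =
        +-cong (*-cong a≈ a′≈) (*-congˡ (*-cong b≈ b′≈))
      , +-cong (+-cong (*-cong a≈ b′≈) (*-cong b≈ a′≈)) (*-congˡ (*-cong b≈ b′≈))

    ⊛-assoc : ∀ u v w → (u ⊛ v) ⊛ w ⊕.≈ u ⊛ (v ⊛ w)
    ⊛-assoc (a , b) (a′ , b′) (a″ , b″) =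
        solve 8 (λ r s a b a′ b′ a″ b″ →
          (a :* a′ :+ r :* (b :* b′)) :* a″
            :+ r :* ((a :* b′ :+ b :* a′ :+ s :* (b :* b′)) :* b″) :=
          a :* (a′ :* a″ :+ r :* (b′ :* b″))
            :+ r :* (b :* (a′ :* b″ :+ b′ :* a″ :+ s :* (b′ :* b″))))
          refl r s a b a′ b′ a″ b″
      , solve 8 (λ r s a b a′ b′ a″ b″ →
          (a :* a′ :+ r :* (b :* b′)) :* b″
            :+ (a :* b′ :+ b :* a′ :+ s :* (b :* b′)) :* a″
            :+ s :* ((a :* b′ :+ b :* a′ :+ s :* (b :* b′)) :* b″) :=
          a :* (a′ :* b″ :+ b′ :* a″ :+ s :* (b′ :* b″))
            :+ b :* (a′ :* a″ :+ r :* (b′ :* b″))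
            :+ s :* (b :* (a′ :* b″ :+ b′ :* a″ :+ s :* (b′ :* b″))))
          refl r s a b a′ b′ a″ b″

    ⊛-comm : ∀ u v → u ⊛ v ⊕.≈ v ⊛ u
    ⊛-comm (a , b) (a′ , b′) =
        +-cong (*-comm a a′) (*-congˡ (*-comm b b′))
      , +-cong (trans (+-comm _ _) (+-cong (*-comm b a′) (*-comm a b′)))
               (*-congˡ (*-comm b b′))

    ⊛-identityˡ : ∀ u → (1# , 0#) ⊛ u ⊕.≈ u
    ⊛-identityˡ (a , b) =
        solve 3 (λ r a b → :1 :* a :+ r :* (:0 :* b) := a) refl r a b
      , solve 3 (λ s a b → :1 :* b :+ :0 :* a :+ s :* (:0 :* b) := b) refl s a b

    ⊛-distribˡ : ∀ u v w → u ⊛ (v ⊕.∙ w) ⊕.≈ (u ⊛ v) ⊕.∙ (u ⊛ w)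
    ⊛-distribˡ (a , b) (a′ , b′) (a″ , b″) =
        solve 7 (λ r a b a′ b′ a″ b″ →
          a :* (a′ :+ a″) :+ r :* (b :* (b′ :+ b″)) :=
          a :* a′ :+ r :* (b :* b′) :+ (a :* a″ :+ r :* (b :* b″)))
          refl r a b a′ b′ a″ b″
      , solve 7 (λ s a b a′ b′ a″ b″ →
          a :* (b′ :+ b″) :+ b :* (a′ :+ a″) :+ s :* (b :* (b′ :+ b″)) :=
          a :* b′ :+ b :* a′ :+ s :* (b :* b′) :+ (a :* b″ :+ b :* a″ :+ s :* (b :* b″)))
          refl s a b a′ b′ a″ b″

    open Consequences ⊕.setoid using (comm∧idˡ⇒id; comm∧distrˡ⇒distr)

  extension : CommutativeRing c ℓ
  extension = record
    { isCommutativeRing = record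
      { isRing = record
        { +-isAbelianGroup = ⊕.isAbelianGroup
        ; *-cong = ⊛-cong
        ; *-assoc = ⊛-assoc
        ; *-identity = comm∧idˡ⇒id ⊛-comm ⊛-identityˡ
        ; distrib = comm∧distrˡ⇒distr ⊕.∙-cong ⊛-comm ⊛-distribˡ
        }
      ; *-comm = ⊛-comm
      }
    }

  private
    module E  = CommutativeRing extension
    module ∑ᴱ = Sums extension
    open Sums R

  embed : Carrier → E.Carrier
  embed a = a , 0#

  θ : E.Carrier
  θ = 0# , 1#

  embed-cong : ∀ {a b} → a ≈ b → embed a E.≈ embed b
  embed-cong a≈b = a≈b , refl

  embed-+ : ∀ a b → embed (a + b) E.≈ embed a E.+ embed b
  embed-+ a b = refl , sym (+-identityˡ 0#)

  embed-* : ∀ a b → embed (a * b) E.≈ embed a E.* embed b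
  embed-* a b = solve 3 (λ r a b → a :* b := a :* b :+ r :* (:0 :* :0)) refl r a b
              , solve 3 (λ s a b → :0 := a :* :0 :+ :0 :* b :+ s :* (:0 :* :0)) refl s a b

  -- The θ-coordinate of `u` meets only the zero coordinate of `embed a`. When θ² = p, this lets
  -- factors from `R` pass out of an even part.
  proj₁-embed-* : ∀ a u → proj₁ (embed a E.* u) ≈ a * proj₁ u
  proj₁-embed-* a (b , b′) = solve 4 (λ r a b b′ → a :* b :+ r :* (:0 :* b′) := a :* b) refl r a b b′

  open Algebra.Properties.Semiring.Exp semiring using (_^_)
  open Algebra.Properties.Semiring.Exp E.semiring using () renaming (_^_ to _^ᴱ_)

  embed-^ : ∀ a n → embed (a ^ n) E.≈ embed a ^ᴱ n
  embed-^ a zero    = E.refl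
  embed-^ a (suc n) = E.trans (embed-* a (a ^ n)) (E.*-congˡ (embed-^ a n))

  proj₁-∑ : ∀ {i} {I : Set i} (is : List I) f → proj₁ (∑ᴱ.∑[ is ] f) ≈ ∑[ is ] (λ i → proj₁ (f i))
  proj₁-∑ []       f = refl
  proj₁-∑ (i ∷ is) f = +-congˡ (proj₁-∑ is f)

-- R[X]/(X^(d+1)): equality only compares the coefficients up to degree d.
module TruncatedPowerSeries {c ℓ} (R : CommutativeRing c ℓ) (d : ℕ) where
  open CommutativeRing R
  open RingSolver R
  open Relation.Binary.Reasoning.Setoid setoid

  private
    Series : Set c
    Series = ℕ → Carrier

    infix 4 _≋_
    _≋_ : Series → Series → Set ℓ
    f ≋ g = ∀ {n} → n ≤ d → f n ≈ g n

    infixl 7 _⋆_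
    _⋆_ : Series → Series → Series
    (f ⋆ g) zero    = f 0 * g 0
    (f ⋆ g) (suc n) = f 0 * g (suc n) + (f ∘ suc ⋆ g) n

    one : Series
    one zero    = 1#
    one (suc _) = 0#

    -- A coefficient of a product uses only coefficients of the same or lower degree, which is why
    -- equality up to degree `d` is respected by multiplication.
    ⋆-cong : ∀ {f f′ g g′} n → (∀ {i} → i ≤ n → f i ≈ f′ i) → (∀ {i} → i ≤ n → g i ≈ g′ i) →
             (f ⋆ g) n ≈ (f′ ⋆ g′) n
    ⋆-cong zero    f≈ g≈ = *-cong (f≈ z≤n) (g≈ z≤n)
    ⋆-cong (suc n) f≈ g≈ =
      +-cong (*-cong (f≈ z≤n) (g≈ ℕ.≤-refl)) (⋆-cong n (f≈ ∘ s≤s) (g≈ ∘ ℕ.m≤n⇒m≤1+n))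

    -- The definition of `_⋆_` peels off the lowest coefficient of the first factor. Peeling off
    -- that of the second factor as well turns commutativity into a plain induction.
    ⋆-suc : ∀ f g n → (f ⋆ g) (suc n) ≈ f (suc n) * g 0 + (f ⋆ g ∘ suc) n
    ⋆-suc f g zero    = +-comm _ _
    ⋆-suc f g (suc n) = begin
      f 0 * g (2 ℕ.+ n) + (f ∘ suc ⋆ g) (suc n)
        ≈⟨ +-congˡ (⋆-suc (f ∘ suc) g n) ⟩
      f 0 * g (2 ℕ.+ n) + (f (2 ℕ.+ n) * g 0 + (f ∘ suc ⋆ g ∘ suc) n)
        ≈⟨ solve 3 (λ x y z → x :+ (y :+ z) := y :+ (x :+ z)) refl _ _ _ ⟩
      f (2 ℕ.+ n) * g 0 + (f 0 * g (2 ℕ.+ n) + (f ∘ suc ⋆ g ∘ suc) n) ∎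

    ⋆-comm : ∀ f g n → (f ⋆ g) n ≈ (g ⋆ f) n
    ⋆-comm f g zero    = *-comm _ _
    ⋆-comm f g (suc n) = trans (+-cong (*-comm _ _) (⋆-comm (f ∘ suc) g n)) (sym (⋆-suc g f n))

    ⋆-scaleˡ : ∀ a f g n → ((λ i → a * f i) ⋆ g) n ≈ a * (f ⋆ g) n
    ⋆-scaleˡ a f g zero    = *-assoc _ _ _
    ⋆-scaleˡ a f g (suc n) =
      trans (+-cong (*-assoc _ _ _) (⋆-scaleˡ a (f ∘ suc) g n)) (sym (distribˡ _ _ _))

    ⋆-distribʳ : ∀ h f g n → ((λ i → f i + g i) ⋆ h) n ≈ (f ⋆ h) n + (g ⋆ h) n
    ⋆-distribʳ h f g zero    = distribʳ _ _ _
    ⋆-distribʳ h f g (suc n) = trans (+-congˡ (⋆-distribʳ h (f ∘ suc) (g ∘ suc) n))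
      (solve 5 (λ x y z u v → (x :+ y) :* z :+ (u :+ v) := x :* z :+ u :+ (y :* z :+ v))
        refl _ _ _ _ _)

    ⋆-assoc : ∀ f g h n → ((f ⋆ g) ⋆ h) n ≈ (f ⋆ (g ⋆ h)) n
    ⋆-assoc f g h zero    = *-assoc _ _ _
    ⋆-assoc f g h (suc n) = begin
      f 0 * g 0 * h (suc n) + ((λ i → f 0 * g (suc i) + (f ∘ suc ⋆ g) i) ⋆ h) n
        ≈⟨ +-congˡ (⋆-distribʳ h (λ i → f 0 * g (suc i)) (f ∘ suc ⋆ g) n) ⟩
      f 0 * g 0 * h (suc n) + (((λ i → f 0 * g (suc i)) ⋆ h) n + ((f ∘ suc ⋆ g) ⋆ h) n)
        ≈⟨ +-congˡ (+-cong (⋆-scaleˡ (f 0) (g ∘ suc) h n) (⋆-assoc (f ∘ suc) g h n)) ⟩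
      f 0 * g 0 * h (suc n) + (f 0 * (g ∘ suc ⋆ h) n + (f ∘ suc ⋆ (g ⋆ h)) n)
        ≈⟨ solve 5 (λ x y z u v → x :* y :* z :+ (x :* u :+ v) := x :* (y :* z :+ u) :+ v)
             refl _ _ _ _ _ ⟩
      f 0 * (g 0 * h (suc n) + (g ∘ suc ⋆ h) n) + (f ∘ suc ⋆ (g ⋆ h)) n ∎

    ⋆-zeroˡ : ∀ f n → ((λ _ → 0#) ⋆ f) n ≈ 0#
    ⋆-zeroˡ f zero    = zeroˡ _
    ⋆-zeroˡ f (suc n) = trans (+-cong (zeroˡ _) (⋆-zeroˡ f n)) (+-identityˡ _)

    ⋆-identityˡ : ∀ f n → (one ⋆ f) n ≈ f n
    ⋆-identityˡ f zero    = *-identityˡ _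
    ⋆-identityˡ f (suc n) = trans (+-cong (*-identityˡ _) (⋆-zeroˡ f n)) (+-identityʳ _)

    ⊕-group : AbelianGroup c ℓ
    ⊕-group = record
      { Carrier = Series
      ; _≈_ = _≋_
      ; _∙_ = λ f g n → f n + g n
      ; ε = λ _ → 0#
      ; _⁻¹ = λ f n → - f n
      ; isAbelianGroup = record
        { isGroup = record
          { isMonoid = record
            { isSemigroup = record
              { isMagma = record
                { isEquivalence = record
                  { refl = λ _ → refl
                  ; sym = λ f≈ i → sym (f≈ i)
                  ; trans = λ f≈ g≈ i → trans (f≈ i) (g≈ i)
                  }
                ; ∙-cong = λ f≈ g≈ i → +-cong (f≈ i) (g≈ i)
                }
              ; assoc = λ _ _ _ _ → +-assoc _ _ _
              }
            ; identity = (λ _ _ → +-identityˡ _) , (λ _ _ → +-identityʳ _)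
            }
          ; inverse = (λ _ _ → -‿inverseˡ _) , (λ _ _ → -‿inverseʳ _)
          ; ⁻¹-cong = λ f≈ i → -‿cong (f≈ i)
          }
        ; comm = λ _ _ _ → +-comm _ _
        }
      }

    open Consequences (AbelianGroup.setoid ⊕-group) using (comm∧idˡ⇒id; comm∧distrʳ⇒distr)

  truncated : CommutativeRing c ℓ
  truncated = record
    { 1# = one
    ; isCommutativeRing = record
      { isRing = record
        { +-isAbelianGroup = AbelianGroup.isAbelianGroup ⊕-group
        ; *-cong = λ {f} {f′} {g} {g′} f≈ g≈ {n} n≤d → ⋆-cong {f} {f′} {g} {g′} n
            (λ i≤n → f≈ (ℕ.≤-trans i≤n n≤d)) (λ i≤n → g≈ (ℕ.≤-trans i≤n n≤d))
        ; *-assoc = λ f g h {n} _ → ⋆-assoc f g h n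
        ; *-identity = comm∧idˡ⇒id {_⋆_} comm {one} (λ f {n} _ → ⋆-identityˡ f n)
        ; distrib = comm∧distrʳ⇒distr {_⋆_} {AbelianGroup._∙_ ⊕-group}
            (λ f≈ g≈ i → +-cong (f≈ i) (g≈ i)) comm (λ h f g {n} _ → ⋆-distribʳ h f g n)
        }
      ; *-comm = comm
      }
    }
    where
    comm : ∀ f g → f ⋆ g ≋ g ⋆ f
    comm f g {n} _ = ⋆-comm f g n

  private
    module T = CommutativeRing truncated

  open Algebra.Properties.Semiring.Exp T.semiring
  open Algebra.Properties.Semiring.Exp semiring using () renaming (_^_ to _^ᴿ_)

  constant : Carrier → Series
  constant a zero    = a
  constant a (suc _) = 0#

  X : Series
  X zero    = 0#
  X (suc n) = one n

  constant-* : ∀ a f n → (constant a ⋆ f) n ≈ a * f n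
  constant-* a f zero    = refl
  constant-* a f (suc n) = trans (+-congˡ (⋆-zeroˡ f n)) (+-identityʳ _)

  constant-cong : ∀ {a b} → a ≈ b → constant a ≋ constant b
  constant-cong a≈b {zero}  _ = a≈b
  constant-cong a≈b {suc n} _ = refl

  constant-homo-* : ∀ a b → constant (a * b) ≋ constant a ⋆ constant b
  constant-homo-* a b {zero}  _ = refl
  constant-homo-* a b {suc n} _ = sym (trans (constant-* a (constant b) (suc n)) (zeroʳ a))

  constant-^ : ∀ a n → constant (a ^ᴿ n) ≋ constant a ^ n
  constant-^ a zero    {zero}  _ = refl
  constant-^ a zero    {suc _} _ = refl
  constant-^ a (suc n) = T.trans (constant-homo-* a (a ^ᴿ n)) (T.*-congˡ {constant a} (constant-^ a n))

  X*-zero : ∀ {f} → (∀ n → f n ≈ 0#) → ∀ n → (X ⋆ f) n ≈ 0#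
  X*-zero f≈0 zero    = zeroˡ _
  X*-zero f≈0 (suc n) = trans (+-cong (zeroˡ _) (trans (⋆-identityˡ _ n) (f≈0 n))) (+-identityˡ _)

  X^n[n] : ∀ n → (X ^ n) n ≈ 1#
  X^n[n] zero    = refl
  X^n[n] (suc n) = trans (+-cong (zeroˡ _) (⋆-identityˡ (X ^ n) n)) (trans (+-identityˡ _) (X^n[n] n))

  X^n[m] : ∀ {m n} → m ≢ n → (X ^ n) m ≈ 0#
  X^n[m] {zero}  {zero}  m≢n = contradiction ≡.refl m≢n
  X^n[m] {suc m} {zero}  m≢n = refl
  X^n[m] {zero}  {suc n} m≢n = zeroˡ _
  X^n[m] {suc m} {suc n} m≢n = trans (+-cong (zeroˡ _) (⋆-identityˡ (X ^ n) m))
    (trans (+-identityˡ _) (X^n[m] (m≢n ∘ ≡.cong suc)))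

  -- The coefficient 1 of `X ^ suc d` sits in degree d + 1, just beyond the degrees that `_≋_`
  -- compares.
  X-nilpotent : X ^ suc d ≋ λ _ → 0#
  X-nilpotent {n} n≤d = X^n[m] {n} {suc d} λ { ≡.refl → ℕ.1+n≰n n≤d }

-- Integer powers of a unit

interval : ℕ → List ℤ
interval zero    = + 0 ∷ []
interval (suc n) = + suc n ∷ -[1+ n ] ∷ interval n

module _ {c ℓ} (R : CommutativeRing c ℓ) where
  open CommutativeRing R
  open Algebra.Properties.CommutativeSemiring.Exp commutativeSemiring

  -- The inverse is passed along, since a commutative ring has no inverse operation. Exchanging the
  -- first two arguments negates the exponent.
  zpow : Carrier → Carrier → ℤ → Carrier
  zpow z z⁻¹ (+ n)    = z ^ n
  zpow z z⁻¹ -[1+ n ] = z⁻¹ ^ suc n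

module IntegerPowers {c ℓ} (R : CommutativeRing c ℓ) where
  open CommutativeRing R
  open RingSolver R
  open Algebra.Properties.CommutativeSemiring.Exp commutativeSemiring

  zpow-neg : ∀ z z⁻¹ i → zpow R z⁻¹ z i ≈ zpow R z z⁻¹ (ℤ.- i)
  zpow-neg z z⁻¹ (+ zero)  = refl
  zpow-neg z z⁻¹ (+ suc n) = refl
  zpow-neg z z⁻¹ -[1+ n ]  = refl

  zpow-distrib-* : ∀ z z⁻¹ w w⁻¹ i → zpow R (z * w) (z⁻¹ * w⁻¹) i ≈ zpow R z z⁻¹ i * zpow R w w⁻¹ i
  zpow-distrib-* z z⁻¹ w w⁻¹ (+ n)    = ^-distrib-* z w n
  zpow-distrib-* z z⁻¹ w w⁻¹ -[1+ n ] = ^-distrib-* z⁻¹ w⁻¹ (suc n)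

  module _ {z z⁻¹ : Carrier} (zz⁻¹≈1 : z * z⁻¹ ≈ 1#) where

    private
      zpow-suc : ∀ i → zpow R z z⁻¹ (ℤ.suc i) ≈ z * zpow R z z⁻¹ i
      zpow-suc (+ n)         = refl
      zpow-suc -[1+ zero ]   = trans (sym zz⁻¹≈1) (*-congˡ (sym (*-identityʳ z⁻¹)))
      zpow-suc -[1+ suc n ]  = trans (sym (*-identityˡ _))
        (trans (*-congʳ (sym zz⁻¹≈1)) (*-assoc _ _ _))

      zpow-pred : ∀ i → zpow R z z⁻¹ (ℤ.pred i) ≈ z⁻¹ * zpow R z z⁻¹ i
      zpow-pred (+ zero)   = refl
      zpow-pred (+ suc n)  = trans (sym (*-identityˡ _))
        (trans (*-congʳ (trans (sym zz⁻¹≈1) (*-comm _ _))) (*-assoc _ _ _))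
      zpow-pred -[1+ n ]   = refl

    zpow-+ : ∀ i j → zpow R z z⁻¹ (i ℤ.+ j) ≈ zpow R z z⁻¹ i * zpow R z z⁻¹ j
    zpow-+ (+ zero)      j = trans (reflexive (≡.cong (zpow R z z⁻¹) (ℤ.+-identityˡ j))) (sym (*-identityˡ _))
    zpow-+ (+ suc n)     j = begin
      zpow R z z⁻¹ (+ 1 ℤ.+ + n ℤ.+ j)              ≡⟨ ≡.cong (zpow R z z⁻¹) (ℤ.+-assoc (+ 1) (+ n) j) ⟩
      zpow R z z⁻¹ (ℤ.suc (+ n ℤ.+ j))              ≈⟨ zpow-suc (+ n ℤ.+ j) ⟩
      z * zpow R z z⁻¹ (+ n ℤ.+ j)                  ≈⟨ *-congˡ (zpow-+ (+ n) j) ⟩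
      z * (zpow R z z⁻¹ (+ n) * zpow R z z⁻¹ j)     ≈⟨ *-assoc _ _ _ ⟨
      zpow R z z⁻¹ (+ suc n) * zpow R z z⁻¹ j       ∎
      where open Relation.Binary.Reasoning.Setoid setoid
    zpow-+ -[1+ zero ]   j = trans (zpow-pred j) (*-congʳ (sym (*-identityʳ z⁻¹)))
    zpow-+ -[1+ suc n ]  j = begin
      zpow R z z⁻¹ (-[1+ 0 ] ℤ.+ -[1+ n ] ℤ.+ j)    ≡⟨ ≡.cong (zpow R z z⁻¹) (ℤ.+-assoc -[1+ 0 ] -[1+ n ] j) ⟩
      zpow R z z⁻¹ (ℤ.pred (-[1+ n ] ℤ.+ j))        ≈⟨ zpow-pred (-[1+ n ] ℤ.+ j) ⟩
      z⁻¹ * zpow R z z⁻¹ (-[1+ n ] ℤ.+ j)           ≈⟨ *-congˡ (zpow-+ -[1+ n ] j) ⟩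
      z⁻¹ * (zpow R z z⁻¹ -[1+ n ] * zpow R z z⁻¹ j) ≈⟨ *-assoc _ _ _ ⟨
      zpow R z z⁻¹ -[1+ suc n ] * zpow R z z⁻¹ j    ∎
      where open Relation.Binary.Reasoning.Setoid setoid

-- The finite form of Jacobi's triple product

oddNumber : ℕ → ℕ
oddNumber n = suc (2 ℕ.* n)

module Theta {c ℓ} (R : CommutativeRing c ℓ) (q : CommutativeRing.Carrier R) where
  open CommutativeRing R
  open RingSolver R
  open Sums R
  open Algebra.Properties.CommutativeSemiring.Exp commutativeSemiring
  open Relation.Binary.Reasoning.Setoid setoid

  difference-zero : ∀ {x y} k → x ≈ y → k * (x - y) ≈ 0#
  difference-zero k x≈y =
    trans (*-congˡ (trans (+-congʳ x≈y) (-‿inverseʳ _))) (zeroʳ k)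

  z : ℕ → Carrier
  z n = q ^ oddNumber n

  z-suc : ∀ n → z (suc n) ≈ q * q * z n
  z-suc n = trans (^-congʳ q (≡.cong suc (ℕ.*-suc 2 n))) 
    (solve 2 (λ q w → q :* (q :* (q :* w)) := q :* q :* (q :* w)) refl q (q ^ (2 ℕ.* n)))

  product : Carrier → ℕ → Carrier
  product a = ∏ (λ n → 1# + a * z n + z n * z n)

  -- The symmetry between ζ and ζ⁻¹ extends the sequence evenly to negative indices, so both
  -- neighbours of index 0 have the value `f 1`.
  neighbours : (ℕ → Carrier) → ℕ → Carrier
  neighbours f zero    = f 1 + f 1
  neighbours f (suc j) = f j + f (suc (suc j))

  -- The coefficient of ζ^j, and of ζ^(-j), in product (ζ + ζ⁻¹) n.
  coeff : ℕ → ℕ → Carrier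
  coeff zero    zero    = 1#
  coeff zero    (suc j) = 0#
  coeff (suc n) j       = (1# + z n * z n) * coeff n j + z n * neighbours (coeff n) j

  coeff-zero : ∀ {n j} → n < j → coeff n j ≈ 0#
  coeff-zero {zero}  {suc j} _         = refl
  coeff-zero {suc n} {suc j} (s≤s n<j) = begin
    (1# + z n * z n) * coeff n (suc j) + z n * (coeff n j + coeff n (suc (suc j)))
      ≈⟨ +-cong (*-congˡ (coeff-zero (ℕ.m≤n⇒m≤1+n n<j)))
           (*-congˡ (+-cong (coeff-zero n<j)
             (coeff-zero (ℕ.m≤n⇒m≤1+n (ℕ.m≤n⇒m≤1+n n<j))))) ⟩
    (1# + z n * z n) * 0# + z n * (0# + 0#)
      ≈⟨ solve 1 (λ z → (:1 :+ z :* z) :* :0 :+ z :* (:0 :+ :0) := :0) refl (z n) ⟩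
    0# ∎

  -- coeff n j is q^(j²) times the q²-binomial coefficient (2n choose n+j); the ratio of
  -- neighbours is cleared of denominators so that no division by q occurs.
  coeff-ratio : ∀ n j → (1# - z n * z j) * coeff n (suc j) ≈ (z j - z n) * coeff n j
  coeff-ratio zero zero =
    solve 1 (λ q → (:1 :- q :* q) :* :0 := (q :- q) :* :1) refl (z 0)
  coeff-ratio zero (suc j) =
    solve 2 (λ z z′ → (:1 :- z :* z′) :* :0 := (z′ :- z) :* :0) refl (z 0) (z (suc j))
  coeff-ratio (suc n) zero = begin
    (1# - z (suc n) * z 0) * ((1# + zₙ * zₙ) * e₁ + zₙ * (e₀ + e₂))
      ≈⟨ *-congʳ (+-congˡ (-‿cong (*-cong (z-suc n) z₀≈q))) ⟩
    (1# - q * q * zₙ * q) * ((1# + zₙ * zₙ) * e₁ + zₙ * (e₀ + e₂))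
      -- The multipliers are those of the general case below at j = -1. There w = q⁻¹, and by
      -- evenness the defect of index -1 is -q⁻¹ times that of index 0, so 1 + q²z² and q²z merge
      -- into 1 - qz + q²z².
      ≈⟨ solve 5 (λ q z e₀ e₁ e₂ →
           (:1 :- q :* q :* z :* q) :* ((:1 :+ z :* z) :* e₁ :+ z :* (e₀ :+ e₂)) :=
           (q :- q :* q :* z) :* ((:1 :+ z :* z) :* e₀ :+ z :* (e₁ :+ e₁))
             :+ ((:1 :- z :* q :+ z :* q :* (z :* q)) :*
                   ((:1 :- z :* q) :* e₁ :- (q :- z) :* e₀)
             :+ z :* ((:1 :- z :* (q :* q :* q)) :* e₂ :- (q :* q :* q :- z) :* e₁)))
           refl q zₙ e₀ e₁ e₂ ⟩
    _ + (_ + _)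
      ≈⟨ +-congˡ (+-cong (difference-zero _ r₀) (difference-zero _ r₁)) ⟩
    _ + (0# + 0#)
      ≈⟨ trans (+-congˡ (+-identityˡ _)) (+-identityʳ _) ⟩
    (q - q * q * zₙ) * ((1# + zₙ * zₙ) * e₀ + zₙ * (e₁ + e₁))
      ≈⟨ *-congʳ (+-cong z₀≈q (-‿cong (z-suc n))) ⟨
    (z 0 - z (suc n)) * ((1# + zₙ * zₙ) * e₀ + zₙ * (e₁ + e₁)) ∎
    where
    zₙ = z n
    e₀ = coeff n 0
    e₁ = coeff n 1
    e₂ = coeff n 2
    z₀≈q : z 0 ≈ q
    z₀≈q = *-identityʳ q
    z₁≈q³ : z 1 ≈ q * q * q
    z₁≈q³ = trans (z-suc 0) (*-congˡ z₀≈q)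
    r₀ : (1# - zₙ * q) * e₁ ≈ (q - zₙ) * e₀
    r₀ = trans (*-congʳ (+-congˡ (-‿cong (*-congˡ (sym z₀≈q)))))
           (trans (coeff-ratio n 0) (*-congʳ (+-congʳ z₀≈q)))
    r₁ : (1# - zₙ * (q * q * q)) * e₂ ≈ (q * q * q - zₙ) * e₁
    r₁ = trans (*-congʳ (+-congˡ (-‿cong (*-congˡ (sym z₁≈q³)))))
           (trans (coeff-ratio n 1) (*-congʳ (+-congʳ z₁≈q³)))
  coeff-ratio (suc n) (suc j) = begin
    (1# - z (suc n) * z (suc j)) * ((1# + zₙ * zₙ) * e₂ + zₙ * (e₁ + e₃))
      ≈⟨ *-congʳ (+-congˡ (-‿cong (*-cong (z-suc n) (z-suc j)))) ⟩
    (1# - q * q * zₙ * (q * q * zⱼ)) * ((1# + zₙ * zₙ) * e₂ + zₙ * (e₁ + e₃))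
      -- The recursion mixes three adjacent indices, so the defect of the ratio at `suc n` is a
      -- combination of its defects at `n` for the indices j + 1, j + 2 and j, with multipliers 1 +
      -- q²z², z and q²z.
      ≈⟨ solve 7 (λ q z w e₀ e₁ e₂ e₃ →
           (:1 :- q :* q :* z :* (q :* q :* w)) :* ((:1 :+ z :* z) :* e₂ :+ z :* (e₁ :+ e₃)) :=
           (q :* q :* w :- q :* q :* z) :* ((:1 :+ z :* z) :* e₁ :+ z :* (e₀ :+ e₂))
             :+ ((:1 :+ q :* q :* (z :* z)) :*
                   ((:1 :- z :* (q :* q :* w)) :* e₂ :- (q :* q :* w :- z) :* e₁)
             :+ (z :* ((:1 :- z :* (q :* q :* (q :* q :* w))) :* e₃
                        :- (q :* q :* (q :* q :* w) :- z) :* e₂)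
             :+ q :* q :* z :* ((:1 :- z :* w) :* e₁ :- (w :- z) :* e₀))))
           refl q zₙ zⱼ e₀ e₁ e₂ e₃ ⟩
    _ + (_ + (_ + _))
      ≈⟨ +-congˡ (+-cong (difference-zero _ r₁)
           (+-cong (difference-zero _ r₂) (difference-zero _ (coeff-ratio n j)))) ⟩
    _ + (0# + (0# + 0#))
      ≈⟨ trans (+-congˡ (trans (+-identityˡ _) (+-identityˡ _))) (+-identityʳ _) ⟩
    (q * q * zⱼ - q * q * zₙ) * ((1# + zₙ * zₙ) * e₁ + zₙ * (e₀ + e₂))
      ≈⟨ *-congʳ (+-cong (z-suc j) (-‿cong (z-suc n))) ⟨
    (z (suc j) - z (suc n)) * ((1# + zₙ * zₙ) * e₁ + zₙ * (e₀ + e₂)) ∎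
    where
    zₙ = z n
    zⱼ = z j
    e₀ = coeff n j
    e₁ = coeff n (1 ℕ.+ j)
    e₂ = coeff n (2 ℕ.+ j)
    e₃ = coeff n (3 ℕ.+ j)
    r₁ : (1# - zₙ * (q * q * zⱼ)) * e₂ ≈ (q * q * zⱼ - zₙ) * e₁
    r₁ = trans (*-congʳ (+-congˡ (-‿cong (*-congˡ (sym (z-suc j))))))
           (trans (coeff-ratio n (suc j)) (*-congʳ (+-congʳ (z-suc j))))
    z₂ : z (2 ℕ.+ j) ≈ q * q * (q * q * zⱼ)
    z₂ = trans (z-suc (suc j)) (*-congˡ (z-suc j))
    r₂ : (1# - zₙ * (q * q * (q * q * zⱼ))) * e₃ ≈ (q * q * (q * q * zⱼ) - zₙ) * e₂
    r₂ = trans (*-congʳ (+-congˡ (-‿cong (*-congˡ (sym z₂)))))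
           (trans (coeff-ratio n (2 ℕ.+ j)) (*-congʳ (+-congʳ z₂)))

  -- Once `z n` vanishes, the ratio of neighbours reduces to `coeff n (suc j) ≈ z j * coeff n j`,
  -- and the exponents 1, 3, 5, ... of the `z j` add up to squares.
  coeff-square : ∀ {n} → z n ≈ 0# → ∀ j → coeff n j ≈ coeff n 0 * q ^ (j ℕ.* j)
  coeff-square         zₙ≈0 zero    = sym (*-identityʳ _)
  coeff-square {n} zₙ≈0 (suc j) = begin
    coeff n (suc j)
      ≈⟨ solve 2 (λ w e → e := (:1 :- :0 :* w) :* e) refl (z j) (coeff n (suc j)) ⟩
    (1# - 0# * z j) * coeff n (suc j)
      ≈⟨ *-congʳ (+-congˡ (-‿cong (*-congʳ (sym zₙ≈0)))) ⟩
    (1# - z n * z j) * coeff n (suc j)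
      ≈⟨ coeff-ratio n j ⟩
    (z j - z n) * coeff n j
      ≈⟨ *-cong (+-congˡ (-‿cong zₙ≈0)) (coeff-square {n} zₙ≈0 j) ⟩
    (z j - 0#) * (coeff n 0 * q ^ (j ℕ.* j))
      ≈⟨ solve 3 (λ w e x → (w :- :0) :* (e :* x) := e :* (w :* x)) refl _ _ _ ⟩
    coeff n 0 * (z j * q ^ (j ℕ.* j))
      ≈⟨ *-congˡ (trans (sym (^-homo-* q (oddNumber j) (j ℕ.* j))) (^-congʳ q (square j))) ⟩
    coeff n 0 * q ^ (suc j ℕ.* suc j) ∎
    where
    square : ∀ j → suc (2 ℕ.* j) ℕ.+ j ℕ.* j ≡ suc j ℕ.* suc j
    square = solve-∀

  module _ (ζ ζ⁻¹ : Carrier) (ζζ⁻¹≈1 : ζ * ζ⁻¹ ≈ 1#) where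

    private
      a : Carrier
      a = ζ + ζ⁻¹

      lucas : ℕ → Carrier
      lucas j = ζ ^ j + ζ⁻¹ ^ j

      lucas-suc : ∀ j → a * lucas (suc j) ≈ lucas j + lucas (suc (suc j))
      lucas-suc j = begin
        a * lucas (suc j)
          ≈⟨ solve 4 (λ s t u v →
               (s :+ t) :* (s :* u :+ t :* v) := s :* t :* (u :+ v) :+ (s :* (s :* u) :+ t :* (t :* v)))
               refl ζ ζ⁻¹ (ζ ^ j) (ζ⁻¹ ^ j) ⟩
        ζ * ζ⁻¹ * lucas j + lucas (suc (suc j))
          ≈⟨ +-congʳ (trans (*-congʳ ζζ⁻¹≈1) (*-identityˡ _)) ⟩
        lucas j + lucas (suc (suc j)) ∎

      -- The Laurent polynomial in ζ with coefficient `f j` at both ζ^j and ζ^(-j), for j up to `k`.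
      -- The bound is kept apart from the number of factors, so that adding a factor does not change
      -- the range.
      symmetricSum : ℕ → (ℕ → Carrier) → Carrier
      symmetricSum zero    f = f 0
      symmetricSum (suc k) f = f (suc k) * lucas (suc k) + symmetricSum k f

      symmetricSum-linear : ∀ k x y f g →
        symmetricSum k (λ j → x * f j + y * g j) ≈ x * symmetricSum k f + y * symmetricSum k g
      symmetricSum-linear zero    x y f g = refl
      symmetricSum-linear (suc k) x y f g = trans (+-congˡ (symmetricSum-linear k x y f g))
        (solve 7 (λ x y f g l s t →
          (x :* f :+ y :* g) :* l :+ (x :* s :+ y :* t) := x :* (f :* l :+ s) :+ y :* (g :* l :+ t))
          refl x y _ _ _ _ _)

      -- Multiplication by ζ + ζ⁻¹ shifts the coefficients both ways. The extra terms account for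
      -- the bound: on the left what enters from index k + 1, on the right what leaves towards it.
      -- They also fit at k = 0, because `lucas 0` is 2.
      symmetricSum-neighbours : ∀ k f → a * symmetricSum k f + f (suc k) * lucas k ≈
        symmetricSum k (neighbours f) + f k * lucas (suc k)
      symmetricSum-neighbours zero f = solve 4 (λ s t x y →
        (s :+ t) :* x :+ y :* (:1 :+ :1) := y :+ y :+ x :* (s :* :1 :+ t :* :1)) refl ζ ζ⁻¹ (f 0) (f 1)
      symmetricSum-neighbours (suc k) f = begin
        a * (f₁ * l₁ + s) + f₂ * l₁
          ≈⟨ solve 7 (λ a f₁ f₂ l₀ l₁ s t →
              a :* (f₁ :* l₁ :+ s) :+ f₂ :* l₁ :=
              f₁ :* (a :* l₁) :+ (a :* s :+ f₁ :* l₀) :+ (f₂ :* l₁ :- f₁ :* l₀)) refl a f₁ f₂ l₀ l₁ s t ⟩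
        f₁ * (a * l₁) + (a * s + f₁ * l₀) + (f₂ * l₁ - f₁ * l₀)
          ≈⟨ +-congʳ (+-cong (*-congˡ (lucas-suc k)) (symmetricSum-neighbours k f)) ⟩
        f₁ * (l₀ + l₂) + (t + f₀ * l₁) + (f₂ * l₁ - f₁ * l₀)
          ≈⟨ solve 7 (λ f₀ f₁ f₂ l₀ l₁ l₂ t →
              f₁ :* (l₀ :+ l₂) :+ (t :+ f₀ :* l₁) :+ (f₂ :* l₁ :- f₁ :* l₀) :=
              (f₀ :+ f₂) :* l₁ :+ t :+ f₁ :* l₂) refl f₀ f₁ f₂ l₀ l₁ l₂ t ⟩
        (f₀ + f₂) * l₁ + t + f₁ * l₂ ∎
        where
        f₀ = f k
        f₁ = f (1 ℕ.+ k)
        f₂ = f (2 ℕ.+ k)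
        l₀ = lucas k
        l₁ = lucas (1 ℕ.+ k)
        l₂ = lucas (2 ℕ.+ k)
        s  = symmetricSum k f
        t  = symmetricSum k (neighbours f)

      symmetricSum-unit : ∀ k → symmetricSum k (coeff 0) ≈ 1#
      symmetricSum-unit zero    = refl
      symmetricSum-unit (suc k) = trans (+-cong (zeroˡ _) (symmetricSum-unit k)) (+-identityˡ _)

      product≈symmetricSum : ∀ {n k} → n ≤ k → product a n ≈ symmetricSum k (coeff n)
      product≈symmetricSum {zero}  {k} _   = sym (symmetricSum-unit k)
      product≈symmetricSum {suc n} {k} n<k = begin
        (1# + a * zₙ + zₙ * zₙ) * product a n
          ≈⟨ *-congˡ (product≈symmetricSum (ℕ.<⇒≤ n<k)) ⟩
        (1# + a * zₙ + zₙ * zₙ) * s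
          ≈⟨ solve 3 (λ a z s → (:1 :+ a :* z :+ z :* z) :* s :=
               (:1 :+ z :* z) :* s :+ z :* (a :* s)) refl a zₙ s ⟩
        (1# + zₙ * zₙ) * s + zₙ * (a * s)
          ≈⟨ +-congˡ (*-congˡ boundary) ⟩
        (1# + zₙ * zₙ) * s + zₙ * symmetricSum k (neighbours (coeff n))
          ≈⟨ symmetricSum-linear k _ _ _ _ ⟨
        symmetricSum k (coeff (suc n)) ∎
        where
        zₙ = z n
        s = symmetricSum k (coeff n)
        plus-zero : ∀ {x y} l → y ≈ 0# → x + y * l ≈ x
        plus-zero l y≈0 = trans (+-congˡ (trans (*-congʳ y≈0) (zeroˡ l))) (+-identityʳ _)
        -- Both boundary terms vanish, as `coeff n` is zero at indices above n and n < k.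
        boundary : a * s ≈ symmetricSum k (neighbours (coeff n))
        boundary = trans (sym (plus-zero _ (coeff-zero (ℕ.m≤n⇒m≤1+n n<k))))
          (trans (symmetricSum-neighbours k (coeff n)) (plus-zero _ (coeff-zero n<k)))

      symmetricSum≈∑ : ∀ k f → symmetricSum k f ≈ ∑[ interval k ] (λ i → f ∣ i ∣ * zpow R ζ ζ⁻¹ i)
      symmetricSum≈∑ zero    f = solve 1 (λ x → x := x :* :1 :+ :0) refl (f 0)
      symmetricSum≈∑ (suc k) f = trans (+-cong (distribˡ _ _ _) (symmetricSum≈∑ k f)) (+-assoc _ _ _)

    -- The expansion with coefficients `coeff n` holds for every q; the vanishing of `z n` is what
    -- turns them into powers with square exponents and leaves one constant `coeff n 0` in front.
    product≈theta : ∀ {n} → z n ≈ 0# →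
      product (ζ + ζ⁻¹) n ≈
      coeff n 0 * ∑[ interval n ] (λ i → q ^ (∣ i ∣ ℕ.* ∣ i ∣) * zpow R ζ ζ⁻¹ i)
    product≈theta {n} zₙ≈0 = begin
      product a n
        ≈⟨ product≈symmetricSum (ℕ.≤-refl {n}) ⟩
      symmetricSum n (coeff n)
        ≈⟨ symmetricSum≈∑ n (coeff n) ⟩
      ∑[ interval n ] (λ i → coeff n ∣ i ∣ * zpow R ζ ζ⁻¹ i)
        ≈⟨ ∑-cong (interval n) (λ i →
             trans (*-congʳ (coeff-square {n} zₙ≈0 ∣ i ∣)) (*-assoc _ _ _)) ⟩
      ∑[ interval n ] (λ i → coeff n 0 * (q ^ (∣ i ∣ ℕ.* ∣ i ∣) * zpow R ζ ζ⁻¹ i))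
        ≈⟨ *-∑ (coeff n 0) (interval n) _ ⟨
      coeff n 0 * ∑[ interval n ] (λ i → q ^ (∣ i ∣ ℕ.* ∣ i ∣) * zpow R ζ ζ⁻¹ i) ∎

-- The lattice substitution (i , j) = (u + v , u - v)

unique∧sameMembers⇒↭ : ∀ {a} {A : Set a} {xs ys : List A} → Unique xs → Unique ys →
  (∀ {x} → x ∈ xs → x ∈ ys) → (∀ {x} → x ∈ ys → x ∈ xs) → xs ↭ ys
unique∧sameMembers⇒↭ xs! ys! xs⊆ys ys⊆xs = ∼bag⇒↭ (unique∧set⇒bag xs! ys! (mk⇔ xs⊆ys ys⊆xs))

∈-interval⁺ : ∀ {n} i → ∣ i ∣ ≤ n → i ∈ interval n
∈-interval⁺ {zero}  (+ zero) _ = here ≡.refl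
∈-interval⁺ {suc n} i ∣i∣≤1+n with ∣ i ∣ ℕ.≟ suc n
∈-interval⁺ {suc n} (+ suc n)  _ | yes ≡.refl = here ≡.refl
∈-interval⁺ {suc n} -[1+ n ]   _ | yes ≡.refl = there (here ≡.refl)
... | no ∣i∣≢1+n = there (there (∈-interval⁺ i (ℕ.s≤s⁻¹ (ℕ.≤∧≢⇒< ∣i∣≤1+n ∣i∣≢1+n))))

∈-interval⁻ : ∀ {n i} → i ∈ interval n → ∣ i ∣ ≤ n
∈-interval⁻ {zero}  (here ≡.refl)         = z≤n
∈-interval⁻ {suc n} (here ≡.refl)         = ℕ.≤-refl
∈-interval⁻ {suc n} (there (here ≡.refl)) = ℕ.≤-refl
∈-interval⁻ {suc n} (there (there i∈))    = ℕ.m≤n⇒m≤1+n (∈-interval⁻ i∈)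

interval-unique : ∀ n → Unique (interval n)
interval-unique zero    = [] ∷ []
interval-unique (suc n) =
  ((λ ()) ∷ All.tabulate (new (+ suc n) ≡.refl)) ∷ All.tabulate (new -[1+ n ] ≡.refl) ∷ interval-unique n
  where
  new : ∀ i → ∣ i ∣ ≡ suc n → ∀ {j} → j ∈ interval n → i ≢ j
  new i ∣i∣≡1+n j∈ ≡.refl = ℕ.1+n≰n (ℕ.≤-trans (ℕ.≤-reflexive (≡.sym ∣i∣≡1+n)) (∈-interval⁻ j∈))

square : ℕ → List (ℤ × ℤ)
square n = cartesianProduct (interval n) (interval n)

norm : ℤ × ℤ → ℕ
norm (i , j) = ∣ i ∣ ℕ.* ∣ i ∣ ℕ.+ ∣ j ∣ ℕ.* ∣ j ∣

-- A similarity of ℤ² that doubles the norm; its image is the sublattice i ≡ j mod 2.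
rotate : ℤ × ℤ → ℤ × ℤ
rotate (u , v) = u ℤ.+ v , u ℤ.- v

private
  ∣i∣²≡i² : ∀ i → + (∣ i ∣ ℕ.* ∣ i ∣) ≡ i ℤ.* i
  ∣i∣²≡i² (+ n)    = ≡.sym (ℤ.+◃n≡+n _)
  ∣i∣²≡i² -[1+ n ] = ≡.refl

  norm-ℤ : ∀ i j → + norm (i , j) ≡ i ℤ.* i ℤ.+ j ℤ.* j
  norm-ℤ i j = ≡.cong₂ ℤ._+_ (∣i∣²≡i² i) (∣i∣²≡i² j)

  m≤m*m : ∀ m → m ≤ m ℕ.* m
  m≤m*m zero    = z≤n
  m≤m*m (suc m) = ℕ.m≤m*n (suc m) (suc m)

norm-rotate : ∀ x → norm (rotate x) ≡ 2 ℕ.* norm x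
norm-rotate (u , v) = ℤ.+-injective (begin
  + norm (rotate (u , v))
    ≡⟨ norm-ℤ (u ℤ.+ v) (u ℤ.- v) ⟩
  (u ℤ.+ v) ℤ.* (u ℤ.+ v) ℤ.+ (u ℤ.- v) ℤ.* (u ℤ.- v)
    ≡⟨ identity u v ⟩
  + 2 ℤ.* (u ℤ.* u ℤ.+ v ℤ.* v)
    ≡⟨ ≡.cong (+ 2 ℤ.*_) (norm-ℤ u v) ⟨
  + 2 ℤ.* + norm (u , v)
    ≡⟨ ℤ.pos-* 2 (norm (u , v)) ⟨
  + (2 ℕ.* norm (u , v)) ∎)
  where
  open ≡.≡-Reasoning
  identity : ∀ u v → (u ℤ.+ v) ℤ.* (u ℤ.+ v) ℤ.+ (u ℤ.- v) ℤ.* (u ℤ.- v) ≡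
                     + 2 ℤ.* (u ℤ.* u ℤ.+ v ℤ.* v)
  identity = ℤSolver.solve-∀

rotate-injective : ∀ {x y} → rotate x ≡ rotate y → x ≡ y
rotate-injective {u , v} {u′ , v′} eq = ≡.cong₂ _,_
  (ℤ.*-cancelˡ-≡ (+ 2) u u′ (≡.trans (≡.sym (sum u v)) (≡.trans (≡.cong (λ (i , j) → i ℤ.+ j) eq) (sum u′ v′))))
  (ℤ.*-cancelˡ-≡ (+ 2) v v′ (≡.trans (≡.sym (diff u v)) (≡.trans (≡.cong (λ (i , j) → i ℤ.- j) eq) (diff u′ v′))))
  where
  sum : ∀ u v → (u ℤ.+ v) ℤ.+ (u ℤ.- v) ≡ + 2 ℤ.* u
  sum = ℤSolver.solve-∀
  diff : ∀ u v → (u ℤ.+ v) ℤ.- (u ℤ.- v) ≡ + 2 ℤ.* v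
  diff = ℤSolver.solve-∀

-- The numbers i² + j² and (i - j)² differ by 2ij, so the latter is even, and i - j is even because
-- 2 is prime. Half of i - j is v, and u is j + v.
rotate-surjective : ∀ x → 2 ∣ norm x → ∃[ y ] x ≡ rotate y
rotate-surjective (i , j) 2∣norm = (j ℤ.+ v , v) , ≡.cong₂ _,_
  (≡.trans (identity₁ i j) (≡.trans (≡.cong (ℤ._+ j) i-j≡v*2) (identity₂ j v)))
  (identity₃ j v)
  where
  2∣[i-j]² : + 2 ℤ∣.∣ (i ℤ.- j) ℤ.* (i ℤ.- j)
  2∣[i-j]² = ≡.subst (+ 2 ℤ∣.∣_) (≡.trans (≡.cong (ℤ._- + 2 ℤ.* (i ℤ.* j)) (norm-ℤ i j)) (identity i j))
    (ℤ∣.∣m∣n⇒∣m-n (ℤ∣.∣ᵤ⇒∣ {+ 2} {+ norm (i , j)} 2∣norm) (ℤ∣.∣m⇒∣m*n (i ℤ.* j) ℤ∣.∣-refl))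
    where
    identity : ∀ i j → i ℤ.* i ℤ.+ j ℤ.* j ℤ.- + 2 ℤ.* (i ℤ.* j) ≡ (i ℤ.- j) ℤ.* (i ℤ.- j)
    identity = ℤSolver.solve-∀
  2∣i-j : 2 ∣ ∣ i ℤ.- j ∣
  2∣i-j = reduce (euclidsLemma ∣ i ℤ.- j ∣ ∣ i ℤ.- j ∣ (from-yes (prime? 2))
    (≡.subst (2 ∣_) (ℤ.abs-* (i ℤ.- j) (i ℤ.- j)) (ℤ∣.∣⇒∣ᵤ 2∣[i-j]²)))
  open ℤ∣._∣_ (ℤ∣.∣ᵤ⇒∣ {+ 2} {i ℤ.- j} 2∣i-j) renaming (quotient to v; equality to i-j≡v*2)
  identity₁ : ∀ i j → i ≡ (i ℤ.- j) ℤ.+ j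
  identity₁ = ℤSolver.solve-∀
  identity₂ : ∀ j v → v ℤ.* + 2 ℤ.+ j ≡ (j ℤ.+ v) ℤ.+ v
  identity₂ = ℤSolver.solve-∀
  identity₃ : ∀ j v → j ≡ (j ℤ.+ v) ℤ.- v
  identity₃ = ℤSolver.solve-∀

-- As m ≤ m² for natural m, the square contains the disc of norm at most n. This crude inclusion is
-- the source of the condition 2d ≤ n in `∑-rotate`.
∈-square⁺ : ∀ {n} x → norm x ≤ n → x ∈ square n
∈-square⁺ (i , j) norm≤n = ∈-cartesianProduct⁺
  (∈-interval⁺ i (ℕ.≤-trans (m≤m*m ∣ i ∣) (ℕ.≤-trans (ℕ.m≤m+n _ _) norm≤n)))
  (∈-interval⁺ j (ℕ.≤-trans (m≤m*m ∣ j ∣) (ℕ.≤-trans (ℕ.m≤n+m _ _) norm≤n)))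

module _ {c ℓ} (R : CommutativeRing c ℓ) where
  open CommutativeRing R
  open Sums R
  open Relation.Binary.Reasoning.Setoid setoid

  -- Only the pairs (i , j) with i ≡ j mod 2 contribute to the left-hand side.
  ∑-rotate : ∀ d {n} f g → 2 ℕ.* d ≤ n →
    (∀ x → ¬ 2 ∣ norm x → f x ≈ 0#) → (∀ x → d < norm x → g x ≈ 0#) →
    (∀ x → f (rotate x) ≈ g x) → ∑[ square n ] f ≈ ∑[ square n ] g
  ∑-rotate d {n} f g 2d≤n f-odd g-big f∘rotate≈g = begin
    ∑[ square n ] f                        ≈⟨ ∑-filter P? (square n) f f≈0 ⟩
    ∑[ filter P? (square n) ] f            ≈⟨ ∑-↭ f reindexed ⟩
    ∑[ map rotate (filter Q? (square n)) ] f ≈⟨ ∑-map rotate (filter Q? (square n)) f ⟩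
    ∑[ filter Q? (square n) ] (f ∘ rotate) ≈⟨ ∑-cong (filter Q? (square n)) f∘rotate≈g ⟩
    ∑[ filter Q? (square n) ] g            ≈⟨ ∑-filter Q? (square n) g (λ x ¬Q → g-big x (ℕ.≰⇒> ¬Q)) ⟨
    ∑[ square n ] g                        ∎
    where
    P : Pred (ℤ × ℤ) _
    P x = 2 ∣ norm x × norm x ≤ 2 ℕ.* d
    P? : Decidable P
    P? x = 2 ∣? norm x ×-dec norm x ℕ.≤? 2 ℕ.* d
    Q? : Decidable (λ x → norm x ≤ d)
    Q? x = norm x ℕ.≤? d

    f≈0 : ∀ x → ¬ P x → f x ≈ 0#
    f≈0 x ¬P with 2 ∣? norm x
    ... | no 2∤norm  = f-odd x 2∤norm
    -- An even norm beyond 2d: the preimage `y` has norm beyond d, where `g` vanishes.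
    ... | yes 2∣norm = let y , x≡ = rotate-surjective x 2∣norm in
      trans (reflexive (≡.cong f x≡)) (trans (f∘rotate≈g y) (g-big y (ℕ.≰⇒> λ norm≤d →
        ¬P (2∣norm , ≡.subst (_≤ 2 ℕ.* d) (≡.sym (≡.trans (≡.cong norm x≡) (norm-rotate y)))
          (ℕ.*-monoʳ-≤ 2 norm≤d)))))

    square-unique : Unique (square n)
    square-unique = Unique.cartesianProduct⁺ (interval-unique n) (interval-unique n)

    norm≤d⇒norm-rotate≤2d : ∀ x → norm x ≤ d → norm (rotate x) ≤ 2 ℕ.* d
    norm≤d⇒norm-rotate≤2d x norm≤d = ℕ.≤-trans (ℕ.≤-reflexive (norm-rotate x)) (ℕ.*-monoʳ-≤ 2 norm≤d)

    norm-rotate≤2d⇒norm≤d : ∀ x → norm (rotate x) ≤ 2 ℕ.* d → norm x ≤ d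
    norm-rotate≤2d⇒norm≤d x norm≤2d =
      ℕ.*-cancelˡ-≤ {norm x} {d} 2 (ℕ.≤-trans (ℕ.≤-reflexive (≡.sym (norm-rotate x))) norm≤2d)

    to : ∀ {x} → x ∈ filter P? (square n) → x ∈ map rotate (filter Q? (square n))
    to {x} x∈ with ∈-filter⁻ P? {xs = square n} x∈
    ... | _ , 2∣norm , norm≤2d = image (rotate-surjective x 2∣norm)
      where
      image : ∃[ y ] x ≡ rotate y → x ∈ map rotate (filter Q? (square n))
      image (y , x≡) = ≡.subst (_∈ map rotate (filter Q? (square n))) (≡.sym x≡)
        (∈-map⁺ rotate (∈-filter⁺ Q? (∈-square⁺ y (ℕ.≤-trans norm≤d d≤n)) norm≤d))
        where
        norm≤d : norm y ≤ d
        norm≤d = norm-rotate≤2d⇒norm≤d y (≡.subst (λ x → norm x ≤ 2 ℕ.* d) x≡ norm≤2d)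
        d≤n : d ≤ n
        d≤n = ℕ.≤-trans (ℕ.m≤n*m d 2) 2d≤n

    from : ∀ {x} → x ∈ map rotate (filter Q? (square n)) → x ∈ filter P? (square n)
    from x∈ =
      let y , y∈ , x≡ = ∈-map⁻ rotate {xs = filter Q? (square n)} x∈
          norm≤2d = norm≤d⇒norm-rotate≤2d y (proj₂ (∈-filter⁻ Q? {xs = square n} y∈))
      in ≡.subst (_∈ _) (≡.sym x≡) (∈-filter⁺ P? (∈-square⁺ (rotate y) (ℕ.≤-trans norm≤2d 2d≤n))
           (divides (norm y) (≡.trans (norm-rotate y) (ℕ.*-comm 2 (norm y))) , norm≤2d))

    reindexed : filter P? (square n) ↭ map rotate (filter Q? (square n))
    reindexed = unique∧sameMembers⇒↭ (Unique.filter⁺ P? square-unique)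
      (Unique.map⁺ rotate-injective (Unique.filter⁺ Q? square-unique)) to from

-- Even and odd parts in q

odd⇒oddNumber : ∀ n → ¬ 2 ∣ n → ∃[ k ] n ≡ oddNumber k
odd⇒oddNumber zero          2∤n = contradiction (2 ∣0) 2∤n
odd⇒oddNumber (suc zero)    2∤n = 0 , ≡.refl
odd⇒oddNumber (suc (suc n)) 2∤n with odd⇒oddNumber n (λ { (divides k ≡.refl) → 2∤n (divides (suc k) ≡.refl) })
... | k , ≡.refl = suc k , ≡.cong suc (≡.sym (ℕ.*-suc 2 k))

-- The ring T[q] with q² = p: the first projection takes the even part in q and
-- then replaces q² by p.
module SquareRoot {c ℓ} (T : CommutativeRing c ℓ) (p : CommutativeRing.Carrier T) where
  open CommutativeRing T
  open RingSolver T
  open QuadraticExtension T p 0# public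
  open Algebra.Properties.CommutativeSemiring.Exp commutativeSemiring
  module B = CommutativeRing extension
  module ^ᴮ = Algebra.Properties.CommutativeSemiring.Exp B.commutativeSemiring
  open ^ᴮ using () renaming (_^_ to _^ᴮ_) public

  q : B.Carrier
  q = θ

  q^even : ∀ k → q ^ᴮ (2 ℕ.* k) B.≈ embed (p ^ k)
  q^even k = B.trans (B.sym (^ᴮ.^-assocʳ q 2 k)) (B.trans (^ᴮ.^-congˡ k q²≈p) (B.sym (embed-^ p k)))
    where
    q²≈p : q ^ᴮ 2 B.≈ embed p
    q²≈p = solve 1 (λ p → :0 :* (:0 :* :1 :+ p :* (:1 :* :0)) :+ p :* (:1 :* (:0 :* :0 :+ :1 :* :1 :+ :0 :* (:1 :* :0)))
             := p) refl p
         , solve 1 (λ p → :0 :* (:0 :* :0 :+ :1 :* :1 :+ :0 :* (:1 :* :0)) :+ :1 :* (:0 :* :1 :+ p :* (:1 :* :0))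
              :+ :0 :* (:1 :* (:0 :* :0 :+ :1 :* :1 :+ :0 :* (:1 :* :0))) := :0) refl p

  q^odd : ∀ k → q ^ᴮ oddNumber k B.≈ (0# , p ^ k)
  q^odd k = B.trans (B.*-congˡ (q^even k))
    ( solve 2 (λ p x → :0 :* x :+ p :* (:1 :* :0) := :0) refl p (p ^ k)
    , solve 1 (λ x → :0 :* :0 :+ :1 :* x :+ :0 :* (:1 :* :0) := x) refl (p ^ k))

  even-part-q^odd : ∀ n → ¬ 2 ∣ n → proj₁ (q ^ᴮ n) ≈ 0#
  even-part-q^odd n 2∤n with odd⇒oddNumber n 2∤n
  ... | k , ≡.refl = proj₁ (q^odd k)

  private
    -- Only powers of q with the parity of the index occur. By the recursion in steps of two, the
    -- indices j and j + 2 give the same type, so the two neighbours of an index need no conversion.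
    HasParity : ℕ → B.Carrier → Set ℓ
    HasParity zero          u = proj₂ u ≈ 0#
    HasParity (suc zero)    u = proj₁ u ≈ 0#
    HasParity (suc (suc j)) u = HasParity j u

    hasParity-cong : ∀ j {u v} → u B.≈ v → HasParity j u → HasParity j v
    hasParity-cong zero          u≈v = trans (sym (proj₂ u≈v))
    hasParity-cong (suc zero)    u≈v = trans (sym (proj₁ u≈v))
    hasParity-cong (suc (suc j)) u≈v = hasParity-cong j u≈v

    hasParity-+ : ∀ j {u v} → HasParity j u → HasParity j v → HasParity j (u B.+ v)
    hasParity-+ zero          u≈0 v≈0 = trans (+-cong u≈0 v≈0) (+-identityˡ 0#)
    hasParity-+ (suc zero)    u≈0 v≈0 = trans (+-cong u≈0 v≈0) (+-identityˡ 0#)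
    hasParity-+ (suc (suc j)) = hasParity-+ j

    hasParity-embed* : ∀ j a {u} → HasParity j u → HasParity j (embed a B.* u)
    hasParity-embed* zero          a {u} u≈0 = trans (+-congʳ (+-congʳ (*-congˡ u≈0)))
      (solve 3 (λ a u v → a :* :0 :+ :0 :* u :+ :0 :* (:0 :* v) := :0) refl a _ _)
    hasParity-embed* (suc zero)    a u≈0 = trans (proj₁-embed-* a _) (trans (*-congˡ u≈0) (zeroʳ a))
    hasParity-embed* (suc (suc j)) = hasParity-embed* j

    hasParity-q* : ∀ j {u} → HasParity j u → HasParity (suc j) (q B.* u)
    hasParity-q* zero          {u} u≈0 = trans (+-congˡ (*-congˡ (*-congˡ u≈0)))
      (solve 2 (λ p u → :0 :* u :+ p :* (:1 :* :0) := :0) refl p _)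
    hasParity-q* (suc zero)    {u} u≈0 = trans (+-congʳ (+-congˡ (*-congˡ u≈0)))
      (solve 1 (λ v → :0 :* v :+ :1 :* :0 :+ :0 :* (:1 :* v) := :0) refl _)
    hasParity-q* (suc (suc j)) = hasParity-q* j

  module Θ = Theta extension q

  z*z : ∀ n → Θ.z n B.* Θ.z n B.≈ embed (p ^ oddNumber n)
  z*z n = B.trans (B.sym (^ᴮ.^-homo-* q (oddNumber n) (oddNumber n)))
    (B.trans (^ᴮ.^-congʳ q (double n)) (q^even (oddNumber n)))
    where
    double : ∀ n → suc (2 ℕ.* n) ℕ.+ suc (2 ℕ.* n) ≡ 2 ℕ.* suc (2 ℕ.* n)
    double = solve-∀

  private
    hasParity-z* : ∀ j n {u} → HasParity j u → HasParity (suc j) (Θ.z n B.* u)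
    hasParity-z* j n {u} pu = hasParity-cong (suc j)
      (B.trans (B.sym (B.*-assoc q (embed (p ^ n)) u)) (B.*-congʳ (B.*-congˡ (B.sym (q^even n)))))
      (hasParity-q* j (hasParity-embed* j (p ^ n) pu))

    -- In the recursion for `coeff`, the odd power `z n` of q accompanies each move to a
    -- neighbouring index and the even `1 + z n * z n` each stay. What matters later is index 0: the
    -- theta constant is even, so it lies in `T`.
    coeff-parity : ∀ n j → HasParity j (Θ.coeff n j)
    coeff-parity zero    zero          = refl
    coeff-parity zero    (suc j)       = 0-parity (suc j)
      where
      0-parity : ∀ j → HasParity j B.0#
      0-parity zero          = refl
      0-parity (suc zero)    = refl
      0-parity (suc (suc j)) = 0-parity j
    coeff-parity (suc n) j = hasParity-+ j
      {(B.1# B.+ Θ.z n B.* Θ.z n) B.* Θ.coeff n j} {Θ.z n B.* Θ.neighbours (Θ.coeff n) j}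
      (hasParity-cong j {embed (1# + p ^ oddNumber n) B.* Θ.coeff n j}
        (B.*-congʳ (B.trans (embed-+ 1# _) (B.+-congˡ (B.sym (z*z n)))))
        (hasParity-embed* j (1# + p ^ oddNumber n) {Θ.coeff n j} (coeff-parity n j)))
      (neighbours-parity j)
      where
      neighbours-parity : ∀ j → HasParity j (Θ.z n B.* Θ.neighbours (Θ.coeff n) j)
      -- This proves parity 2, which unfolds to parity 0.
      neighbours-parity zero    = hasParity-z* 1 n {Θ.neighbours (Θ.coeff n) 0}
        (hasParity-+ 1 {Θ.coeff n 1} {Θ.coeff n 1} (coeff-parity n 1) (coeff-parity n 1))
      neighbours-parity (suc j) = hasParity-z* j n {Θ.neighbours (Θ.coeff n) (suc j)}
        (hasParity-+ j {Θ.coeff n j} {Θ.coeff n (2 ℕ.+ j)} (coeff-parity n j) (coeff-parity n (2 ℕ.+ j)))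

  coeff₀-even : ∀ n → Θ.coeff n 0 B.≈ embed (proj₁ (Θ.coeff n 0))
  coeff₀-even n = refl , coeff-parity n 0

-- Comparison of the two infinite products modulo a power of q

module _ {c ℓ} (R : CommutativeRing c ℓ) where
  open CommutativeRing R
  open Algebra.Properties.CommutativeSemiring.Exp commutativeSemiring

  PowerVanishes : Carrier → ℕ → Set ℓ
  PowerVanishes x n = x ^ n ≈ 0#

module Nilpotent {c ℓ} (R : CommutativeRing c ℓ) where
  open CommutativeRing R
  open RingSolver R
  open Algebra.Properties.CommutativeSemiring.Exp commutativeSemiring

  ^-zero-≤ : ∀ {x m n} → x ^ m ≈ 0# → m ≤ n → x ^ n ≈ 0#
  ^-zero-≤ {x} {m} {n} xᵐ≈0 m≤n = trans (^-congʳ x (≡.sym (ℕ.m+[n∸m]≡n m≤n)))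
    (trans (^-homo-* x m (n ℕ.∸ m)) (trans (*-congʳ xᵐ≈0) (zeroˡ _)))

  geometric : Carrier → ℕ → Carrier
  geometric x zero    = 0#
  geometric x (suc n) = 1# + x * geometric x n

  geometric-sum : ∀ x n → (1# - x) * geometric x n ≈ 1# - x ^ n
  geometric-sum x zero    = solve 1 (λ x → (:1 :- x) :* :0 := :1 :- :1) refl x
  geometric-sum x (suc n) = trans
    (solve 2 (λ x g → (:1 :- x) :* (:1 :+ x :* g) := (:1 :- x) :+ x :* ((:1 :- x) :* g)) refl x _)
    (trans (+-congˡ (*-congˡ (geometric-sum x n)))
      (solve 2 (λ x y → (:1 :- x) :+ x :* (:1 :- y) := :1 :- x :* y) refl x _))

  geometric-inverse : ∀ {x} n → x ^ n ≈ 0# → (1# - x) * geometric x n ≈ 1#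
  geometric-inverse {x} n xⁿ≈0 = trans (geometric-sum x n) (trans (+-congˡ (-‿cong xⁿ≈0))
    (solve 0 (:1 :- :0 := :1) refl))

module EvenPart {c ℓ} (T : CommutativeRing c ℓ) (p : CommutativeRing.Carrier T) (d : ℕ)
                (pᵈ⁺¹≈0 : PowerVanishes T p (suc d)) where
  open CommutativeRing T
  open Algebra.Properties.CommutativeSemiring.Exp commutativeSemiring
  open RingSolver T
  open Nilpotent T
  open IntegerPowers T
  open SquareRoot T p
  open Sums T
  module ∑ᴮ = Sums extension
  module Θ′ = Theta T p

  -- Two demands meet here: N > d makes `p ^ N`, and with it `Θ.z N`, vanish; and `∑-rotate` asks
  -- for 2d ≤ N.
  N : ℕ
  N = suc (2 ℕ.* d)

  w : ℕ → Carrier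
  w = Θ′.z

  private
    d<N : suc d ≤ N
    d<N = s≤s (ℕ.m≤m+n d _)

    w-nilpotent : ∀ n → w n ^ suc d ≈ 0#
    w-nilpotent n = trans (^-assocʳ p (oddNumber n) (suc d))
      (^-zero-≤ pᵈ⁺¹≈0 (ℕ.m≤n*m (suc d) (oddNumber n)))

    w[N]≈0 : w N ≈ 0#
    w[N]≈0 = ^-zero-≤ {p} pᵈ⁺¹≈0 (ℕ.≤-trans d<N (ℕ.m≤n⇒m≤1+n (ℕ.m≤m+n N _)))

    z[N]≈0 : Θ.z N B.≈ B.0#
    z[N]≈0 = B.trans (q^odd N) (refl , ^-zero-≤ {p} pᵈ⁺¹≈0 d<N)

    -- The denominator of the left-hand product; the right-hand one has `D * D`. It is a unit
    -- because every `w n` is nilpotent.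
    D : Carrier
    D = ∏ (λ n → (1# - w n) * (1# - w n)) N

    D⁻¹ : Carrier
    D⁻¹ = ∏ (λ n → geometric (w n) (suc d) * geometric (w n) (suc d)) N

    DD⁻¹≈1 : D * D⁻¹ ≈ 1#
    DD⁻¹≈1 = trans (sym (∏-* _ _ N)) (trans (∏-cong N λ n → trans
      (solve 2 (λ x y → x :* x :* (y :* y) := x :* y :* (x :* y)) refl _ _)
      (trans (*-cong (inverse n) (inverse n)) (*-identityˡ 1#))) (∏-1 N))
      where
      inverse : ∀ n → (1# - w n) * geometric (w n) (suc d) ≈ 1#
      inverse n = geometric-inverse (suc d) (w-nilpotent n)

    D-cancel : ∀ {x y} → D * x ≈ D * y → x ≈ y
    D-cancel {x} {y} eq = trans (unit x) (trans (*-congˡ eq) (sym (unit y)))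
      where
      unit : ∀ x → x ≈ D⁻¹ * (D * x)
      unit x = trans (sym (*-identityˡ x)) (trans (*-congʳ (trans (sym DD⁻¹≈1) (*-comm _ _))) (*-assoc _ _ _))

    embed-∏ : ∀ f n → embed (∏ f n) B.≈ ∑ᴮ.∏ (λ i → embed (f i)) n
    embed-∏ f zero    = B.refl
    embed-∏ f (suc n) = B.trans (embed-* _ _) (B.*-congˡ (embed-∏ f n))

    embed-zpow : ∀ x y i → zpow extension (embed x) (embed y) i B.≈ embed (zpow T x y i)
    embed-zpow x y (+ n)    = B.sym (embed-^ x n)
    embed-zpow x y -[1+ n ] = B.sym (embed-^ y (suc n))

  module _ (ζ ζ⁻¹ ξ ξ⁻¹ : Carrier) where

    -- The factors are characterised rather than defined, with denominators cleared: besides the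
    -- sums over blocks, the constant 1 must qualify when ζ = 1 and ξ = -1.
    LeftFactors : (ℕ → B.Carrier) → Set ℓ
    LeftFactors f = ∀ n → f n B.* embed ((1# - w n) * (1# - w n)) B.≈
      (B.1# B.+ (embed ζ B.+ embed ζ⁻¹) B.* Θ.z n B.+ Θ.z n B.* Θ.z n) B.*
      (B.1# B.+ (embed ξ B.+ embed ξ⁻¹) B.* Θ.z n B.+ Θ.z n B.* Θ.z n)

    RightFactors : (ℕ → Carrier) → Set ℓ
    RightFactors g = ∀ n → g n * ((1# - w n) * (1# - w n) * ((1# - w n) * (1# - w n))) ≈
      (1# + (ζ * ξ + ζ⁻¹ * ξ⁻¹) * w n + w n * w n) *
      (1# + (ζ * ξ⁻¹ + ζ⁻¹ * ξ) * w n + w n * w n)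

    module Expansion (ζζ⁻¹≈1 : ζ * ζ⁻¹ ≈ 1#) (ξξ⁻¹≈1 : ξ * ξ⁻¹ ≈ 1#) where

      private
        χ ψ : ℤ → Carrier
        χ = zpow T ζ ζ⁻¹
        ψ = zpow T ξ ξ⁻¹

      -- The double theta sum common to both sides, in the rotated coordinates.
      S : Carrier
      S = ∑[ square N ] (λ x@(u , v) → p ^ norm x * (χ (u ℤ.+ v) * ψ (u ℤ.- v)))

      private
        f₀ : ℤ × ℤ → Carrier
        f₀ x@(i , j) = χ i * ψ j * proj₁ (q ^ᴮ norm x)

        rotated : ∑[ square N ] f₀ ≈ S
        rotated = ∑-rotate T d f₀ _ (ℕ.n≤1+n _)
          (λ x 2∤norm → trans (*-congˡ (even-part-q^odd (norm x) 2∤norm)) (zeroʳ _))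
          (λ x d<norm → trans (*-congʳ (^-zero-≤ pᵈ⁺¹≈0 d<norm)) (zeroˡ _))
          (λ x → trans (*-congˡ (proj₁ (B.trans (^ᴮ.^-congʳ q (norm-rotate x)) (q^even (norm x))))) (*-comm _ _))

        embed-inverse : ∀ {x y} → x * y ≈ 1# → embed x B.* embed y B.≈ B.1#
        embed-inverse xy≈1 = B.trans (B.sym (embed-* _ _)) (embed-cong xy≈1)

        term : ∀ (x : ℤ × ℤ) → let (i , j) = x in
          (q ^ᴮ (∣ i ∣ ℕ.* ∣ i ∣) B.* zpow extension (embed ζ) (embed ζ⁻¹) i) B.*
          (q ^ᴮ (∣ j ∣ ℕ.* ∣ j ∣) B.* zpow extension (embed ξ) (embed ξ⁻¹) j) B.≈
          embed (χ i * ψ j) B.* q ^ᴮ norm x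
        term (i , j) = begin
          (q ^ᴮ (∣ i ∣ ℕ.* ∣ i ∣) B.* zpow extension (embed ζ) (embed ζ⁻¹) i) B.*
          (q ^ᴮ (∣ j ∣ ℕ.* ∣ j ∣) B.* zpow extension (embed ξ) (embed ξ⁻¹) j)
            ≈⟨ B.*-cong (B.*-congˡ (embed-zpow ζ ζ⁻¹ i)) (B.*-congˡ (embed-zpow ξ ξ⁻¹ j)) ⟩
          (q ^ᴮ (∣ i ∣ ℕ.* ∣ i ∣) B.* embed (χ i)) B.* (q ^ᴮ (∣ j ∣ ℕ.* ∣ j ∣) B.* embed (ψ j))
            ≈⟨ RB.solve 4 (λ x y u v → (x RB.:* y) RB.:* (u RB.:* v) RB.:= (y RB.:* v) RB.:* (x RB.:* u)) B.refl _ _ _ _ ⟩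
          (embed (χ i) B.* embed (ψ j)) B.* (q ^ᴮ (∣ i ∣ ℕ.* ∣ i ∣) B.* q ^ᴮ (∣ j ∣ ℕ.* ∣ j ∣))
            ≈⟨ B.*-cong (B.sym (embed-* _ _)) (B.sym (^ᴮ.^-homo-* q (∣ i ∣ ℕ.* ∣ i ∣) (∣ j ∣ ℕ.* ∣ j ∣))) ⟩
          embed (χ i * ψ j) B.* q ^ᴮ norm (i , j) ∎
          where
          open Relation.Binary.Reasoning.Setoid B.setoid
          module RB = RingSolver extension

      -- Both triple products expand in B with the same constant. `D` and that constant are even, so
      -- taking the even part only affects the powers of q in the double sum, which `rotated` then
      -- turns into `S`.
      left-expansion : ∃[ k ] ∀ f → LeftFactors f → D * proj₁ (∑ᴮ.∏ f N) ≈ k * S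
      left-expansion = k * k , λ f factors → trans (sym (proj₁-embed-* D _))
        (trans (proj₁ (expand f factors)) (trans (proj₁-embed-* (k * k) _) (*-congˡ (trans (proj₁-∑ (square N) _)
          (trans (∑-cong (square N) λ x → proj₁-embed-* _ _) rotated)))))
        where
        k = proj₁ (Θ.coeff N 0)
        open Relation.Binary.Reasoning.Setoid B.setoid
        module RB = RingSolver extension
        expand : ∀ f → LeftFactors f → embed D B.* ∑ᴮ.∏ f N B.≈
          embed (k * k) B.* ∑ᴮ.∑[ square N ] (λ x → embed (χ (proj₁ x) * ψ (proj₂ x)) B.* q ^ᴮ norm x)
        expand f factors = begin
          embed D B.* ∑ᴮ.∏ f N
            ≈⟨ B.*-comm _ _ ⟩
          ∑ᴮ.∏ f N B.* embed D
            ≈⟨ B.*-congˡ (embed-∏ _ N) ⟩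
          ∑ᴮ.∏ f N B.* ∑ᴮ.∏ (λ n → embed ((1# - w n) * (1# - w n))) N
            ≈⟨ ∑ᴮ.∏-* _ _ N ⟨
          ∑ᴮ.∏ (λ n → f n B.* embed ((1# - w n) * (1# - w n))) N
            ≈⟨ ∑ᴮ.∏-cong N factors ⟩
          _
            ≈⟨ ∑ᴮ.∏-* _ _ N ⟩
          Θ.product (embed ζ B.+ embed ζ⁻¹) N B.* Θ.product (embed ξ B.+ embed ξ⁻¹) N
            ≈⟨ B.*-cong (Θ.product≈theta _ _ (embed-inverse ζζ⁻¹≈1) {N} z[N]≈0)
                        (Θ.product≈theta _ _ (embed-inverse ξξ⁻¹≈1) {N} z[N]≈0) ⟩
          (Θ.coeff N 0 B.* _) B.* (Θ.coeff N 0 B.* _)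
            ≈⟨ RB.solve 3 (λ x y u → (x RB.:* y) RB.:* (x RB.:* u) RB.:= (x RB.:* x) RB.:* (y RB.:* u)) B.refl _ _ _ ⟩
          (Θ.coeff N 0 B.* Θ.coeff N 0) B.* _
            ≈⟨ B.*-cong (B.trans (B.*-cong (coeff₀-even N) (coeff₀-even N)) (B.sym (embed-* k k)))
                 (B.trans (∑ᴮ.∑*∑ (interval N) (interval N) _ _) (∑ᴮ.∑-cong (square N) term)) ⟩
          embed (k * k) B.* ∑ᴮ.∑[ square N ] (λ x → embed (χ (proj₁ x) * ψ (proj₂ x)) B.* q ^ᴮ norm x) ∎

      -- This side stays in `T`. The theta sums in ζξ and ζξ⁻¹, indexed by u and v, are multiplied;
      -- collecting the powers of ζ and of ξ produces the exponents u + v and u - v.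
      right-expansion : ∃[ k ] ∀ g → RightFactors g → D * D * ∏ g N ≈ k * S
      right-expansion = k * k , λ g factors → begin
        D * D * ∏ g N
          ≈⟨ *-comm _ _ ⟩
        ∏ g N * (D * D)
          ≈⟨ *-congˡ (∏-* _ _ N) ⟨
        ∏ g N * ∏ (λ n → (1# - w n) * (1# - w n) * ((1# - w n) * (1# - w n))) N
          ≈⟨ ∏-* _ _ N ⟨
        ∏ (λ n → g n * ((1# - w n) * (1# - w n) * ((1# - w n) * (1# - w n)))) N
          ≈⟨ ∏-cong N factors ⟩
        _
          ≈⟨ ∏-* _ _ N ⟩
        Θ′.product (ζ * ξ + ζ⁻¹ * ξ⁻¹) N * Θ′.product (ζ * ξ⁻¹ + ζ⁻¹ * ξ) N
          ≈⟨ *-cong (Θ′.product≈theta _ _ (inverse ζζ⁻¹≈1 ξξ⁻¹≈1) {N} w[N]≈0)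
                    (Θ′.product≈theta _ _ (inverse ζζ⁻¹≈1 (trans (*-comm _ _) ξξ⁻¹≈1)) {N} w[N]≈0) ⟩
        (k * _) * (k * _)
          ≈⟨ solve 3 (λ x y u → (x :* y) :* (x :* u) := (x :* x) :* (y :* u)) refl _ _ _ ⟩
        k * k * _
          ≈⟨ *-congˡ (trans (∑*∑ (interval N) (interval N) _ _) (∑-cong (square N) term′)) ⟩
        k * k * S ∎
        where
        k = Θ′.coeff N 0
        open Relation.Binary.Reasoning.Setoid setoid
        inverse : ∀ {x y x⁻¹ y⁻¹} → x * x⁻¹ ≈ 1# → y * y⁻¹ ≈ 1# → x * y * (x⁻¹ * y⁻¹) ≈ 1#
        inverse xx⁻¹≈1 yy⁻¹≈1 = trans (solve 4 (λ x y u v → x :* y :* (u :* v) := x :* u :* (y :* v)) refl _ _ _ _)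
          (trans (*-cong xx⁻¹≈1 yy⁻¹≈1) (*-identityˡ 1#))
        term′ : ∀ (x : ℤ × ℤ) → let (u , v) = x in
          (p ^ (∣ u ∣ ℕ.* ∣ u ∣) * zpow T (ζ * ξ) (ζ⁻¹ * ξ⁻¹) u) *
          (p ^ (∣ v ∣ ℕ.* ∣ v ∣) * zpow T (ζ * ξ⁻¹) (ζ⁻¹ * ξ) v) ≈
          p ^ norm x * (χ (u ℤ.+ v) * ψ (u ℤ.- v))
        term′ (u , v) = begin
          _
            ≈⟨ *-cong (*-congˡ (zpow-distrib-* ζ ζ⁻¹ ξ ξ⁻¹ u))
                      (*-congˡ (trans (zpow-distrib-* ζ ζ⁻¹ ξ⁻¹ ξ v) (*-congˡ (zpow-neg ξ ξ⁻¹ v)))) ⟩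
          (p ^ (∣ u ∣ ℕ.* ∣ u ∣) * (χ u * ψ u)) * (p ^ (∣ v ∣ ℕ.* ∣ v ∣) * (χ v * ψ (ℤ.- v)))
            ≈⟨ solve 6 (λ a b x y x′ y′ → (a :* (x :* y)) :* (b :* (x′ :* y′)) := a :* b :* ((x :* x′) :* (y :* y′)))
                 refl _ _ _ _ _ _ ⟩
          p ^ (∣ u ∣ ℕ.* ∣ u ∣) * p ^ (∣ v ∣ ℕ.* ∣ v ∣) * (χ u * χ v * (ψ u * ψ (ℤ.- v)))
            ≈⟨ *-cong (^-homo-* p (∣ u ∣ ℕ.* ∣ u ∣) (∣ v ∣ ℕ.* ∣ v ∣))
                 (*-cong (zpow-+ ζζ⁻¹≈1 u v) (zpow-+ ξξ⁻¹≈1 u (ℤ.- v))) ⟨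
          p ^ norm (u , v) * (χ (u ℤ.+ v) * ψ (u ℤ.- v)) ∎

  private
    -- The factor k of an expansion does not depend on ζ and ξ, and at ζ = 1, ξ = -1 all
    -- the factors f n and g n are 1, so that k is determined without being computed.
    module Trivial = Expansion 1# 1# (- 1#) (- 1#) (*-identityˡ 1#)
      (solve 0 ((:- :1) :* (:- :1) := :1) refl)

    -- Here a = 2 and b = -2, so the numerator is (1 + z)²(1 - z)² = (1 - z²)², the denominator
    -- itself.
    left-trivial : LeftFactors 1# 1# (- 1#) (- 1#) (λ _ → B.1#)
    left-trivial n = begin
      B.1# B.* embed ((1# - w n) * (1# - w n))
        ≈⟨ B.*-identityˡ _ ⟩
      embed ((1# - w n) * (1# - w n))
        ≈⟨ embed-* _ _ ⟩
      embed (1# - w n) B.* embed (1# - w n)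
        ≈⟨ B.*-cong 1-w≈ 1-w≈ ⟩
      (B.1# B.- Θ.z n B.* Θ.z n) B.* (B.1# B.- Θ.z n B.* Θ.z n)
        ≈⟨ RB.solve 1 (λ z → (RB.:1 RB.:- z RB.:* z) RB.:* (RB.:1 RB.:- z RB.:* z) RB.:=
             (RB.:1 RB.:+ (RB.:1 RB.:+ RB.:1) RB.:* z RB.:+ z RB.:* z) RB.:*
             (RB.:1 RB.:+ (RB.:- RB.:1 RB.:+ RB.:- RB.:1) RB.:* z RB.:+ z RB.:* z)) B.refl (Θ.z n) ⟩
      (B.1# B.+ (B.1# B.+ B.1#) B.* Θ.z n B.+ Θ.z n B.* Θ.z n) B.*
      (B.1# B.+ (B.- B.1# B.+ B.- B.1#) B.* Θ.z n B.+ Θ.z n B.* Θ.z n)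
        ≈⟨ B.*-congˡ (B.+-congʳ (B.+-congˡ (B.*-congʳ (B.+-cong -1≈ -1≈)))) ⟩
      _ ∎
      where
      open Relation.Binary.Reasoning.Setoid B.setoid
      module RB = RingSolver extension
      -0≈0 : - 0# ≈ 0#
      -0≈0 = solve 0 (:- :0 := :0) refl
      -1≈ : B.- B.1# B.≈ embed (- 1#)
      -1≈ = refl , -0≈0
      1-w≈ : embed (1# - w n) B.≈ B.1# B.- Θ.z n B.* Θ.z n
      1-w≈ = B.trans (refl , trans (sym -0≈0) (sym (+-identityˡ _))) (B.+-congˡ (B.-‿cong (B.sym (z*z n))))

    -- Both products ζξ and ζξ⁻¹ are -1, so c = d = -2 and the numerator is (1 - w)⁴.
    right-trivial : RightFactors 1# 1# (- 1#) (- 1#) (λ _ → 1#)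
    right-trivial n = solve 1 (λ w →
      :1 :* ((:1 :- w) :* (:1 :- w) :* ((:1 :- w) :* (:1 :- w))) :=
      (:1 :+ (:1 :* :- :1 :+ :1 :* :- :1) :* w :+ w :* w) :*
      (:1 :+ (:1 :* :- :1 :+ :1 :* :- :1) :* w :+ w :* w)) refl (w n)

  -- The expansions are D L = k S and D² R = k′ S, and the trivial ones D = k S₀ and D² = k′ S₀.
  -- Multiplied crosswise they give D³ L = D³ R, where only the unit `D` is cancelled.
  even-part≈ : ∀ ζ ζ⁻¹ ξ ξ⁻¹ → ζ * ζ⁻¹ ≈ 1# → ξ * ξ⁻¹ ≈ 1# →
    ∀ f g → LeftFactors ζ ζ⁻¹ ξ ξ⁻¹ f → RightFactors ζ ζ⁻¹ ξ ξ⁻¹ g →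
    proj₁ (∑ᴮ.∏ f N) ≈ ∏ g N
  even-part≈ ζ ζ⁻¹ ξ ξ⁻¹ ζζ⁻¹≈1 ξξ⁻¹≈1 f g left right = D-cancel (D-cancel (D-cancel (begin
    D * (D * (D * L))
      ≈⟨ *-congˡ (*-congˡ L-eq) ⟩
    D * (D * (k * S))
      ≈⟨ trans (sym (*-assoc _ _ _)) (trans (*-congʳ (sym (trans (*-congˡ (∏-1 N)) (*-identityʳ _)))) (*-congʳ (k′-eq _ right-trivial))) ⟩
    k′ * S₀ * (k * S)
      ≈⟨ solve 4 (λ k′ s₀ k s → k′ :* s₀ :* (k :* s) := k :* s₀ :* (k′ :* s)) refl _ _ _ _ ⟩
    k * S₀ * (k′ * S)
      ≈⟨ *-cong (trans (sym (k-eq _ left-trivial)) (trans (*-congˡ (proj₁ (∑ᴮ.∏-1 N))) (*-identityʳ _))) (sym R-eq) ⟩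
    D * (D * D * R)
      ≈⟨ *-congˡ (*-assoc _ _ _) ⟩
    D * (D * (D * R)) ∎)))
    where
    open Relation.Binary.Reasoning.Setoid setoid
    open Expansion ζ ζ⁻¹ ξ ξ⁻¹ ζζ⁻¹≈1 ξξ⁻¹≈1
    S₀ = Trivial.S
    L  = proj₁ (∑ᴮ.∏ f N)
    R  = ∏ g N
    -- For all ζ and ξ this component reduces to the square of `proj₁ (Θ.coeff N 0)`; hence it is
    -- also the constant in `L-eq`. The same goes for `k′` and `R-eq`.
    k  = proj₁ Trivial.left-expansion
    k-eq = proj₂ Trivial.left-expansion
    k′ = proj₁ Trivial.right-expansion
    k′-eq = proj₂ Trivial.right-expansion
    L-eq = proj₂ left-expansion f left
    R-eq = proj₂ right-expansion g right

-- Generating functions of the occurrences of one part size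

-- The occurrences of one part size: none, or d undesignated ones, the designated
-- one and e undesignated ones.
Block : Set
Block = Maybe (ℕ × ℕ)

-- The bounds on the two counts are independent, so that a sum over blocks factors into geometric
-- sums.
blocks : ℕ → List Block
blocks t = nothing ∷ map just (cartesianProduct (downFrom t) (downFrom t))

vectors : ∀ {a} {A : Set a} → List A → ∀ n → List (Vec A n)
vectors as zero    = [] ∷ []
vectors as (suc n) = map (λ (a , v) → a ∷ v) (cartesianProduct as (vectors as n))

-- The entry of v at distance n from its end contributes s n.
total : ∀ {a} {A : Set a} → (ℕ → A → ℕ) → ∀ {n} → Vec A n → ℕ
total s []              = 0
total s {suc n} (a ∷ v) = s n a ℕ.+ total s v

occurs : Block → ℕ
occurs nothing  = 0
occurs (just _) = 1

occurrences : Block → ℕ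
occurrences nothing        = 0
occurrences (just (d , e)) = suc (d ℕ.+ e)

parity : ℕ → ℕ
parity zero          = 0
parity (suc zero)    = 1
parity (suc (suc n)) = parity n

blockWeight : ℕ → Block → ℕ
blockWeight n b = oddNumber n ℕ.* occurrences b

module GeneratingFunctions {c ℓ} (R : CommutativeRing c ℓ) (x y : CommutativeRing.Carrier R) where
  open CommutativeRing R
  open RingSolver R
  open Sums R
  open Algebra.Properties.CommutativeSemiring.Exp commutativeSemiring
  open Relation.Binary.Reasoning.Setoid setoid

  monomial : Carrier → ℕ → ℕ → ℕ → Carrier
  monomial q k j n = x ^ k * y ^ j * q ^ n

  monomial-+ : ∀ q k j n k′ j′ n′ →
    monomial q (k ℕ.+ k′) (j ℕ.+ j′) (n ℕ.+ n′) ≈ monomial q k j n * monomial q k′ j′ n′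
  monomial-+ q k j n k′ j′ n′ =
    trans (*-cong (*-cong (^-homo-* x k k′) (^-homo-* y j j′)) (^-homo-* q n n′))
      (solve 6 (λ a b c d e f → (a :* b) :* (c :* d) :* (e :* f) := (a :* c :* e) :* (b :* d :* f))
        refl _ _ _ _ _ _)

  -- All three statistics add up over the entries, so the monomial of a vector is a product of
  -- monomials, and the sum splits into one factor per part size.
  ∑-vectors : ∀ {a} {A : Set a} (as : List A) q (k j w : ℕ → A → ℕ) n →
    ∑[ vectors as n ] (λ v → monomial q (total k v) (total j v) (total w v)) ≈
    ∏ (λ i → ∑[ as ] (λ a → monomial q (k i a) (j i a) (w i a))) n
  ∑-vectors as q k j w zero    = solve 0 (:1 :* :1 :* :1 :+ :0 := :1) refl
  ∑-vectors as q k j w (suc n) = begin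
    _ ≈⟨ ∑-map (λ (a , v) → a ∷ v) (cartesianProduct as (vectors as n)) _ ⟩
    _ ≈⟨ ∑-cong (cartesianProduct as (vectors as n)) (λ (a , v) → monomial-+ q (k n a) (j n a) (w n a) _ _ _) ⟩
    _ ≈⟨ ∑*∑ as (vectors as n) _ _ ⟨
    _ ≈⟨ *-congˡ (∑-vectors as q k j w n) ⟩
    _ ∎

  ∑-blocks : ∀ t f → ∑[ blocks t ] f ≈ f nothing + ∑[ cartesianProduct (downFrom t) (downFrom t) ] (f ∘ just)
  ∑-blocks t f = +-congˡ (∑-map just (cartesianProduct (downFrom t) (downFrom t)) f)

  module LeftFactor (z : Carrier) where
    private
      -- `ε n` is z^n for even n and 0 otherwise; `ω n` is the same for odd n. The mutual recursion
      -- gives them addition formulas of the shape known from cosh and sinh.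
      ε ω : ℕ → Carrier
      ε zero    = 1#
      ε (suc n) = z * ω n
      ω zero    = 0#
      ω (suc n) = z * ε n

      ε-multiple : ∀ n → ∃[ a ] ε n ≈ z ^ n * a
      ω-multiple : ∀ n → ∃[ a ] ω n ≈ z ^ n * a
      ε-multiple zero    = 1# , sym (*-identityˡ 1#)
      ε-multiple (suc n) = let a , eq = ω-multiple n in a , trans (*-congˡ eq) (sym (*-assoc _ _ _))
      ω-multiple zero    = 0# , sym (*-identityˡ 0#)
      ω-multiple (suc n) = let a , eq = ε-multiple n in a , trans (*-congˡ eq) (sym (*-assoc _ _ _))

      ε-+ : ∀ m n → ε (m ℕ.+ n) ≈ ε m * ε n + ω m * ω n
      ω-+ : ∀ m n → ω (m ℕ.+ n) ≈ ε m * ω n + ω m * ε n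
      ε-+ zero    n = solve 2 (λ e o → e := :1 :* e :+ :0 :* o) refl (ε n) (ω n)
      ε-+ (suc m) n = trans (*-congˡ (ω-+ m n))
        (solve 5 (λ z a b c d → z :* (a :* b :+ c :* d) := z :* c :* d :+ z :* a :* b) refl _ _ _ _ _)
      ω-+ zero    n = solve 2 (λ e o → o := :1 :* o :+ :0 :* e) refl (ε n) (ω n)
      ω-+ (suc m) n = trans (*-congˡ (ε-+ m n))
        (solve 5 (λ z a b c d → z :* (a :* b :+ c :* d) := z :* c :* d :+ z :* a :* b) refl _ _ _ _ _)

      -- With n undesignated occurrences the multiplicity is n + 1, so it is the even n that receive
      -- y.
      parity-split : ∀ n → y ^ parity (suc n) * z ^ n ≈ y * ε n + ω n
      parity-split zero          = solve 1 (λ y → y :* :1 :* :1 := y :* :1 :+ :0) refl y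
      parity-split (suc zero)    = solve 2 (λ y z → :1 :* (z :* :1) := y :* (z :* :0) :+ z :* :1) refl y z
      parity-split (suc (suc n)) = trans
        (solve 3 (λ y z u → y :* (z :* (z :* u)) := z :* z :* (y :* u)) refl _ z _)
        (trans (*-congˡ (parity-split n))
          (solve 4 (λ y z e o → z :* z :* (y :* e :+ o) := y :* (z :* (z :* e)) :+ z :* (z :* o)) refl y z _ _))

      E O : ℕ → Carrier
      E t = ∑[ downFrom t ] ε
      O t = ∑[ downFrom t ] ω

      E-suc : ∀ t → E (suc t) ≈ 1# + z * O t
      E-suc zero    = solve 1 (λ z → :1 :+ :0 := :1 :+ z :* :0) refl z
      E-suc (suc t) = trans (+-congˡ (E-suc t))
        (solve 3 (λ z o s → z :* o :+ (:1 :+ z :* s) := :1 :+ z :* (o :+ s)) refl z _ _)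

      O-suc : ∀ t → O (suc t) ≈ z * E t
      O-suc zero    = solve 1 (λ z → :0 :+ :0 := z :* :0) refl z
      O-suc (suc t) = trans (+-congˡ (O-suc t)) (sym (distribˡ z _ _))

    leftFactor : ℕ → Carrier
    leftFactor t = ∑[ blocks t ] (λ b → monomial z (occurs b) (parity (occurrences b)) (occurrences b))

    -- As z^t vanishes, a further term changes neither sum, so E = 1 + zO and O = zE, whence (1 -
    -- z²)E = 1. The blocks that occur contribute xz(y(E² + O²) + 2EO) = xzE²(y(1 + z²) + 2z).
    leftFactor≈ : ∀ t → z ^ t ≈ 0# →
      leftFactor t * ((1# - z * z) * (1# - z * z)) ≈
      (1# - z * z) * (1# - z * z) + x * z * (y * (1# + z * z) + (z + z))
    leftFactor≈ t zᵗ≈0 = begin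
      leftFactor t * ((1# - z * z) * (1# - z * z))
        ≈⟨ *-congʳ (trans (∑-blocks t _) (+-congˡ (trans (∑-cong pairs term) (sym (*-∑ _ pairs _))))) ⟩
      (1# * 1# * 1# + x * z * ∑[ pairs ] h) * ((1# - z * z) * (1# - z * z))
        ≈⟨ *-congʳ (+-congˡ (*-congˡ ∑h≈)) ⟩
      (1# * 1# * 1# + x * z * (y * (e * e + o * o) + (e * o + o * e))) * ((1# - z * z) * (1# - z * z))
        ≈⟨ *-congʳ (+-congˡ (*-congˡ (+-cong (*-congˡ (+-congˡ (*-cong o≈ze o≈ze)))
             (+-cong (*-congˡ o≈ze) (*-congʳ o≈ze))))) ⟩
      (1# * 1# * 1# + x * z * (y * (e * e + z * e * (z * e)) + (e * (z * e) + z * e * e))) * ((1# - z * z) * (1# - z * z))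
        ≈⟨ solve 4 (λ x y z e →
             (:1 :* :1 :* :1 :+ x :* z :* (y :* (e :* e :+ z :* e :* (z :* e)) :+ (e :* (z :* e) :+ z :* e :* e)))
               :* ((:1 :- z :* z) :* (:1 :- z :* z)) :=
             (:1 :- z :* z) :* (:1 :- z :* z) :+ x :* z :* (y :* (:1 :+ z :* z) :+ (z :+ z))
               :* ((:1 :- z :* z) :* e :* ((:1 :- z :* z) :* e))) refl x y z e ⟩
      (1# - z * z) * (1# - z * z) + x * z * (y * (1# + z * z) + (z + z)) * ((1# - z * z) * e * ((1# - z * z) * e))
        ≈⟨ +-congˡ (trans (*-congˡ (trans (*-cong e-inverse e-inverse) (*-identityˡ 1#))) (*-identityʳ _)) ⟩
      (1# - z * z) * (1# - z * z) + x * z * (y * (1# + z * z) + (z + z)) ∎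
      where
      e = E t
      o = O t
      pairs = cartesianProduct (downFrom t) (downFrom t)
      h : ℕ × ℕ → Carrier
      h (d , e) = y * ε (d ℕ.+ e) + ω (d ℕ.+ e)
      term : ∀ (b : ℕ × ℕ) → let n = proj₁ b ℕ.+ proj₂ b in
        monomial z 1 (parity (suc n)) (suc n) ≈ x * z * h b
      term (d , e) = trans
        (solve 4 (λ x y z u → x :* :1 :* y :* (z :* u) := x :* z :* (y :* u)) refl x _ z _)
        (*-congˡ (parity-split (d ℕ.+ e)))
      ∑h≈ : ∑[ pairs ] h ≈ y * (e * e + o * o) + (e * o + o * e)
      ∑h≈ = trans (∑-+ pairs _ _) (+-cong
        (trans (sym (*-∑ y pairs _)) (*-congˡ (trans (∑-cong pairs λ (d , e) → ε-+ d e)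
          (trans (∑-+ pairs _ _) (sym (+-cong (∑*∑ (downFrom t) (downFrom t) ε ε) (∑*∑ (downFrom t) (downFrom t) ω ω)))))))
        (trans (∑-cong pairs λ (d , e) → ω-+ d e)
          (trans (∑-+ pairs _ _) (sym (+-cong (∑*∑ (downFrom t) (downFrom t) ε ω) (∑*∑ (downFrom t) (downFrom t) ω ε))))))
      vanish : ∀ {u s} → ∃[ a ] u ≈ z ^ t * a → s ≈ u + s
      vanish (a , u≈) = sym (trans (+-congʳ (trans u≈ (trans (*-congʳ zᵗ≈0) (zeroˡ a)))) (+-identityˡ _))
      e≈1+zo : e ≈ 1# + z * o
      e≈1+zo = trans (vanish (ε-multiple t)) (E-suc t)
      o≈ze : o ≈ z * e
      o≈ze = trans (vanish (ω-multiple t)) (O-suc t)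
      e-inverse : (1# - z * z) * e ≈ 1#
      e-inverse = begin
        (1# - z * z) * e            ≈⟨ solve 2 (λ z e → (:1 :- z :* z) :* e := e :- z :* (z :* e)) refl z e ⟩
        e - z * (z * e)             ≈⟨ +-cong e≈1+zo (-‿cong (*-congˡ (sym o≈ze))) ⟩
        (1# + z * o) - z * o        ≈⟨ solve 1 (λ u → :1 :+ u :- u := :1) refl _ ⟩
        1# ∎

  module RightFactor (w : Carrier) where
    rightFactor : ℕ → Carrier
    rightFactor t = ∑[ cartesianProduct (blocks t) (blocks t) ] (λ (b , b′) →
      monomial w (occurs b ℕ.+ occurs b′) (2 ℕ.* (occurs b ℕ.* occurs b′)) (occurrences b ℕ.+ occurrences b′))

    private
      V : ℕ → Carrier
      V t = ∑[ downFrom t ] (w ^_)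

      V-sum : ∀ t → (1# - w) * V t ≈ 1# - w ^ t
      V-sum zero    = solve 1 (λ w → (:1 :- w) :* :0 := :1 :- :1) refl w
      V-sum (suc t) = trans (distribˡ _ _ _) (trans (+-congˡ (V-sum t))
        (solve 2 (λ w u → (:1 :- w) :* u :+ (:1 :- u) := :1 :- w :* u) refl w _))

      V-inverse : ∀ t → w ^ t ≈ 0# → (1# - w) * V t ≈ 1#
      V-inverse t wᵗ≈0 = trans (V-sum t) (trans (+-congˡ (-‿cong wᵗ≈0)) (solve 0 (:1 :- :0 := :1) refl))

    -- With s = wV², where V is the geometric sum, a pair of blocks gives 1 + 2xs + (xys)² according
    -- to whether none, one or both occur; and (1 - w)V = 1.
    rightFactor≈ : ∀ t → w ^ t ≈ 0# →
      rightFactor t * ((1# - w) * (1# - w) * ((1# - w) * (1# - w))) ≈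
      (1# - w) * (1# - w) * ((1# - w) * (1# - w)) + (x + x) * w * ((1# - w) * (1# - w)) + x * y * w * (x * y * w)
    rightFactor≈ t wᵗ≈0 = begin
      rightFactor t * ((1# - w) * (1# - w) * ((1# - w) * (1# - w)))
        ≈⟨ *-congʳ expand ⟩
      (1# + x * s + (x * s + x * y * s * (x * y * s))) * ((1# - w) * (1# - w) * ((1# - w) * (1# - w)))
        ≈⟨ *-congʳ (+-cong (+-congˡ (*-congˡ s≈wvv)) (+-cong (*-congˡ s≈wvv) (*-cong (*-congˡ s≈wvv) (*-congˡ s≈wvv)))) ⟩
      _
        ≈⟨ solve 4 (λ x y w v →
             (:1 :+ x :* (w :* (v :* v)) :+ (x :* (w :* (v :* v)) :+ x :* y :* (w :* (v :* v)) :* (x :* y :* (w :* (v :* v)))))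
               :* ((:1 :- w) :* (:1 :- w) :* ((:1 :- w) :* (:1 :- w))) :=
             (:1 :- w) :* (:1 :- w) :* ((:1 :- w) :* (:1 :- w))
             :+ (x :+ x) :* w :* ((:1 :- w) :* (:1 :- w)) :* ((:1 :- w) :* v :* ((:1 :- w) :* v))
             :+ x :* y :* w :* (x :* y :* w) :*
                ((:1 :- w) :* v :* ((:1 :- w) :* v) :* ((:1 :- w) :* v :* ((:1 :- w) :* v)))) refl x y w v ⟩
      _
        ≈⟨ +-cong (+-congˡ (times-1 vv)) (times-1 (trans (*-cong vv vv) (*-identityˡ 1#))) ⟩
      _ ∎
      where
      v = V t
      pairs = cartesianProduct (downFrom t) (downFrom t)
      power : ℕ × ℕ → Carrier
      power (d , e) = w ^ suc (d ℕ.+ e)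
      s = ∑[ pairs ] power
      times-1 : ∀ {u a} → u ≈ 1# → a * u ≈ a
      times-1 u≈1 = trans (*-congˡ u≈1) (*-identityʳ _)
      vv : (1# - w) * v * ((1# - w) * v) ≈ 1#
      vv = trans (*-cong (V-inverse t wᵗ≈0) (V-inverse t wᵗ≈0)) (*-identityˡ 1#)
      s≈wvv : s ≈ w * (v * v)
      s≈wvv = trans (∑-cong pairs λ (d , e) → *-congˡ (^-homo-* w d e))
        (trans (sym (*-∑ w pairs _)) (*-congˡ (sym (∑*∑ (downFrom t) (downFrom t) (w ^_) (w ^_)))))
      m : Block → Block → Carrier
      m b b′ = monomial w (occurs b ℕ.+ occurs b′) (2 ℕ.* (occurs b ℕ.* occurs b′)) (occurrences b ℕ.+ occurrences b′)
      row-nothing : ∑[ blocks t ] (m nothing) ≈ 1# + x * s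
      row-nothing = trans (∑-blocks t _) (+-cong (solve 0 (:1 :* :1 :* :1 := :1) refl)
        (trans (∑-cong pairs λ _ → solve 2 (λ x u → x :* :1 :* :1 :* u := x :* u) refl x _)
          (sym (*-∑ x pairs power))))
      row-just : ∀ b → ∑[ blocks t ] (m (just b)) ≈ x * power b + x * y * power b * (x * y * s)
      row-just b@(d , e) = trans (∑-blocks t _) (+-cong
        (trans (*-congˡ (^-congʳ w (ℕ.+-identityʳ (suc (d ℕ.+ e))))) (solve 2 (λ x u → x :* :1 :* :1 :* u := x :* u) refl x _))
        (trans (∑-cong pairs λ b′ → trans
            (*-congˡ (^-homo-* w (suc (d ℕ.+ e)) (suc (proj₁ b′ ℕ.+ proj₂ b′))))
            (solve 4 (λ x y u v → x :* (x :* :1) :* (y :* (y :* :1)) :* (u :* v) :=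
                x :* y :* u :* (x :* y) :* v) refl x y _ _))
          (trans (sym (*-∑ _ pairs power)) (*-assoc _ _ _))))
      expand : rightFactor t ≈ 1# + x * s + (x * s + x * y * s * (x * y * s))
      expand = trans (∑-cartesianProduct (blocks t) (blocks t) _) (trans (∑-blocks t _) (+-cong row-nothing
        (trans (∑-cong pairs row-just) (trans (∑-+ pairs _ _) (+-cong (sym (*-∑ x pairs power))
          (trans (sym (∑-* _ pairs _)) (*-congʳ (sym (*-∑ _ pairs power)))))))))

-- Agrees with `N` in `EvenPart`. The sizes that it admits go beyond 2d, hence cover all partitions
-- in question.
numberOfFactors : ℕ → ℕ
numberOfFactors d = suc (2 ℕ.* d)

-- Powers of a part z with this exponent vanish, so larger blocks do not contribute.
blockBound : ℕ → ℕ
blockBound d = 2 ℕ.* suc d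

codes : ∀ d → List (Vec Block (numberOfFactors d))
codes d = vectors (blocks (blockBound d)) (numberOfFactors d)

pairCodes : ∀ d → List (Vec (Block × Block) (numberOfFactors d))
pairCodes d = vectors (cartesianProduct (blocks (blockBound d)) (blocks (blockBound d))) (numberOfFactors d)

pairOccurs pairOverlap : Block × Block → ℕ
pairOccurs (b , b′) = occurs b ℕ.+ occurs b′
pairOverlap (b , b′) = 2 ℕ.* (occurs b ℕ.* occurs b′)

pairWeight : ℕ → Block × Block → ℕ
pairWeight n (b , b′) = oddNumber n ℕ.* (occurrences b ℕ.+ occurrences b′)

module _ {c ℓ} (T : CommutativeRing c ℓ) where
  open CommutativeRing T
  open Algebra.Properties.CommutativeSemiring.Exp commutativeSemiring
  open Sums T

  -- The even part of q^n for q² = p. Expressed in `T` alone, it lets the identity be stated without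
  -- q and carried between rings.
  halfPower : Carrier → ℕ → Carrier
  halfPower p zero          = 1#
  halfPower p (suc zero)    = 0#
  halfPower p (suc (suc n)) = p * halfPower p n

  leftSum rightSum : ℕ → (x y p : Carrier) → Carrier
  leftSum d x y p = ∑[ codes d ] λ v →
    x ^ total (λ _ → occurs) v * y ^ total (λ _ → parity ∘ occurrences) v * halfPower p (total blockWeight v)
  rightSum d x y p = ∑[ pairCodes d ] λ v →
    x ^ total (λ _ → pairOccurs) v * y ^ total (λ _ → pairOverlap) v * p ^ total pairWeight v

module _ {c ℓ} (T : CommutativeRing c ℓ) (d : ℕ) (x y p : CommutativeRing.Carrier T)
         (pᵈ⁺¹≈0 : PowerVanishes T p (suc d)) where
  open CommutativeRing T
  open Algebra.Properties.CommutativeSemiring.Exp commutativeSemiring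

  open RingSolver T
  open Nilpotent T
  open Sums T
  open EvenPart T p d pᵈ⁺¹≈0
  open SquareRoot T p

  private
    module RB = RingSolver extension
    module GB = GeneratingFunctions extension (embed x) (embed y)
    module G  = GeneratingFunctions T x y

    t : ℕ
    t = blockBound d

    proj₁-q^ : ∀ n → proj₁ (q ^ᴮ n) ≈ halfPower T p n
    proj₁-q^ zero          = refl
    proj₁-q^ (suc zero)    = solve 1 (λ p → :0 :* :1 :+ p :* (:1 :* :0) := :0) refl p
    proj₁-q^ (suc (suc n)) = trans
      (solve 3 (λ p a b → :0 :* (:0 :* a :+ p :* (:1 :* b)) :+ p :* (:1 :* (:0 :* b :+ :1 :* a :+ :0 :* (:1 :* b)))
        := p :* a) refl p _ _)
      (*-congˡ (proj₁-q^ n))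

    leftFactors : ℕ → B.Carrier
    leftFactors i = ∑ᴮ.∑[ blocks t ] λ b → GB.monomial q (occurs b) (parity (occurrences b)) (blockWeight i b)

    rightFactors : ℕ → Carrier
    rightFactors i = ∑[ cartesianProduct (blocks t) (blocks t) ] λ b →
      G.monomial p (pairOccurs b) (pairOverlap b) (pairWeight i b)

    leftSum≈∏ : proj₁ (∑ᴮ.∏ leftFactors N) ≈ leftSum T d x y p
    leftSum≈∏ = trans (proj₁ (B.sym (GB.∑-vectors (blocks t) q _ _ _ N))) (trans (proj₁-∑ (codes d) _)
      (∑-cong (codes d) λ v → trans
        (proj₁ (B.*-congʳ {q ^ᴮ total blockWeight v} (B.trans
          (B.*-cong (B.sym (embed-^ x (total (λ _ → occurs) v))) (B.sym (embed-^ y (total (λ _ → parity ∘ occurrences) v))))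
          (B.sym (embed-* _ _)))))
        (trans (proj₁-embed-* _ _) (*-congˡ (proj₁-q^ (total blockWeight v))))))

    rightSum≈∏ : ∏ rightFactors N ≈ rightSum T d x y p
    rightSum≈∏ = sym (G.∑-vectors (cartesianProduct (blocks t) (blocks t)) p _ _ _ N)

    z-nilpotent : ∀ n → Θ.z n ^ᴮ t B.≈ B.0#
    z-nilpotent n = B.trans (^ᴮ.^-assocʳ q (oddNumber n) t)
      (Nilpotent.^-zero-≤ extension (B.trans (q^even (suc d)) (embed-cong pᵈ⁺¹≈0)) (ℕ.m≤n*m t (oddNumber n)))

    w-nilpotent : ∀ n → w n ^ t ≈ 0#
    w-nilpotent n = trans (^-assocʳ p (oddNumber n) t) (^-zero-≤ pᵈ⁺¹≈0
      (ℕ.≤-trans (ℕ.m≤n*m (suc d) 2) (ℕ.m≤n*m t (oddNumber n))))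

  module _ (ζ ζ⁻¹ ξ ξ⁻¹ : Carrier) (ζζ⁻¹≈1 : ζ * ζ⁻¹ ≈ 1#) (ξξ⁻¹≈1 : ξ * ξ⁻¹ ≈ 1#)
    (sum≈ : (ζ + ζ⁻¹) + (ξ + ξ⁻¹) ≈ x * y)
    (product≈ : (ζ + ζ⁻¹) * (ξ + ξ⁻¹) + (1# + 1# + (1# + 1#)) ≈ x + x) where

    private
      left : LeftFactors ζ ζ⁻¹ ξ ξ⁻¹ leftFactors
      left n = begin
        leftFactors n B.* embed ((1# - w n) * (1# - w n))
          ≈⟨ B.*-cong (∑ᴮ.∑-cong (blocks t) λ b → B.*-congˡ (B.sym (^ᴮ.^-assocʳ q (oddNumber n) (occurrences b))))
               (B.trans (embed-* _ _) (B.*-cong 1-w≈ 1-w≈)) ⟩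
        GB.LeftFactor.leftFactor z t B.* ((B.1# B.- z B.* z) B.* (B.1# B.- z B.* z))
          ≈⟨ GB.LeftFactor.leftFactor≈ z t (z-nilpotent n) ⟩
        (B.1# B.- z B.* z) B.* (B.1# B.- z B.* z) B.+ X B.* z B.* (Y B.* (B.1# B.+ z B.* z) B.+ (z B.+ z))
          ≈⟨ RB.solve 3 (λ x y z →
               (RB.:1 RB.:- z RB.:* z) RB.:* (RB.:1 RB.:- z RB.:* z)
                 RB.:+ x RB.:* z RB.:* (y RB.:* (RB.:1 RB.:+ z RB.:* z) RB.:+ (z RB.:+ z)) RB.:=
               (RB.:1 RB.:- z RB.:* z) RB.:* (RB.:1 RB.:- z RB.:* z)
                 RB.:+ (x RB.:* y) RB.:* (z RB.:* (RB.:1 RB.:+ z RB.:* z)) RB.:+ (x RB.:+ x) RB.:* (z RB.:* z))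
               B.refl X Y z ⟩
        (B.1# B.- z B.* z) B.* (B.1# B.- z B.* z)
          B.+ (X B.* Y) B.* (z B.* (B.1# B.+ z B.* z)) B.+ (X B.+ X) B.* (z B.* z)
          ≈⟨ B.+-cong (B.+-congˡ (B.*-congʳ (B.sym sumᴮ))) (B.*-congʳ (B.sym productᴮ)) ⟩
        (B.1# B.- z B.* z) B.* (B.1# B.- z B.* z)
          B.+ (α B.+ β) B.* (z B.* (B.1# B.+ z B.* z))
          B.+ (α B.* β B.+ (B.1# B.+ B.1# B.+ (B.1# B.+ B.1#))) B.* (z B.* z)
          -- The constant 4 in `product≈` arises here, as (1 + z²)² = (1 - z²)² + 4z².
          ≈⟨ RB.solve 3 (λ a b z →
               (RB.:1 RB.:- z RB.:* z) RB.:* (RB.:1 RB.:- z RB.:* z)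
                 RB.:+ (a RB.:+ b) RB.:* (z RB.:* (RB.:1 RB.:+ z RB.:* z))
                 RB.:+ (a RB.:* b RB.:+ (RB.:1 RB.:+ RB.:1 RB.:+ (RB.:1 RB.:+ RB.:1))) RB.:* (z RB.:* z) RB.:=
               (RB.:1 RB.:+ a RB.:* z RB.:+ z RB.:* z) RB.:* (RB.:1 RB.:+ b RB.:* z RB.:+ z RB.:* z))
               B.refl α β z ⟩
        (B.1# B.+ α B.* z B.+ z B.* z) B.* (B.1# B.+ β B.* z B.+ z B.* z) ∎
        where
        open Relation.Binary.Reasoning.Setoid B.setoid
        z = Θ.z n
        X = embed x
        Y = embed y
        α = embed ζ B.+ embed ζ⁻¹
        β = embed ξ B.+ embed ξ⁻¹
        α≈ : α B.≈ embed (ζ + ζ⁻¹)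
        α≈ = B.sym (embed-+ ζ ζ⁻¹)
        β≈ : β B.≈ embed (ξ + ξ⁻¹)
        β≈ = B.sym (embed-+ ξ ξ⁻¹)
        sumᴮ : α B.+ β B.≈ X B.* Y
        sumᴮ = B.trans (B.+-cong α≈ β≈) (B.trans (B.sym (embed-+ _ _)) (B.trans (embed-cong sum≈) (embed-* x y)))
        4≈ : B.1# B.+ B.1# B.+ (B.1# B.+ B.1#) B.≈ embed (1# + 1# + (1# + 1#))
        4≈ = B.sym (B.trans (embed-+ _ _) (B.+-cong (embed-+ _ _) (embed-+ _ _)))
        productᴮ : α B.* β B.+ (B.1# B.+ B.1# B.+ (B.1# B.+ B.1#)) B.≈ X B.+ X
        productᴮ = B.trans (B.+-cong (B.trans (B.*-cong α≈ β≈) (B.sym (embed-* _ _))) 4≈)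
          (B.trans (B.sym (embed-+ _ _)) (B.trans (embed-cong product≈) (embed-+ x x)))
        1-w≈ : embed (1# - w n) B.≈ B.1# B.- z B.* z
        1-w≈ = B.trans (refl , solve 0 (:0 := :0 :+ :- :0) refl) (B.+-congˡ (B.-‿cong (B.sym (z*z n))))

      right : RightFactors ζ ζ⁻¹ ξ ξ⁻¹ rightFactors
      right n = begin
        rightFactors n * ((1# - ω) * (1# - ω) * ((1# - ω) * (1# - ω)))
          ≈⟨ *-congʳ (∑-cong (cartesianProduct (blocks t) (blocks t)) λ (b , b′) →
               *-congˡ (sym (^-assocʳ p (oddNumber n) (occurrences b ℕ.+ occurrences b′)))) ⟩
        G.RightFactor.rightFactor ω t * ((1# - ω) * (1# - ω) * ((1# - ω) * (1# - ω)))
          ≈⟨ G.RightFactor.rightFactor≈ ω t (w-nilpotent n) ⟩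
        (1# - ω) * (1# - ω) * ((1# - ω) * (1# - ω)) + (x + x) * ω * ((1# - ω) * (1# - ω)) + x * y * ω * (x * y * ω)
          ≈⟨ +-cong (+-congˡ (*-congʳ (*-congʳ (sym product≈)))) (*-cong (*-congʳ (sym sum≈)) (*-congʳ (sym sum≈))) ⟩
        _
          -- With c = st + s′t′ and d = st′ + s′t, the relation c + d = ab is a plain factorisation.
          -- Only the coefficient of w² uses ss′ = 1 and tt′ = 1; the last two summands are its
          -- multiples of ss′ - 1 and tt′ - 1.
          ≈⟨ solve 5 (λ s s′ t t′ w →
               (:1 :- w) :* (:1 :- w) :* ((:1 :- w) :* (:1 :- w))
                 :+ ((s :+ s′) :* (t :+ t′) :+ (:1 :+ :1 :+ (:1 :+ :1))) :* w :* ((:1 :- w) :* (:1 :- w))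
                 :+ ((s :+ s′) :+ (t :+ t′)) :* w :* (((s :+ s′) :+ (t :+ t′)) :* w) :=
               (:1 :+ (s :* t :+ s′ :* t′) :* w :+ w :* w) :* (:1 :+ (s :* t′ :+ s′ :* t) :* w :+ w :* w)
                 :+ (w :* w :* ((:1 :+ :1) :- t :* t :- t′ :* t′) :* (s :* s′ :- :1)
                 :+ w :* w :* ((:1 :+ :1) :- s :* s :- s′ :* s′) :* (t :* t′ :- :1)))
               refl ζ ζ⁻¹ ξ ξ⁻¹ ω ⟩
        _ + (_ + _)
          ≈⟨ +-congˡ (+-cong (Θ′.difference-zero _ ζζ⁻¹≈1) (Θ′.difference-zero _ ξξ⁻¹≈1)) ⟩
        _ + (0# + 0#)
          ≈⟨ trans (+-congˡ (+-identityˡ 0#)) (+-identityʳ _) ⟩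
        (1# + (ζ * ξ + ζ⁻¹ * ξ⁻¹) * ω + ω * ω) * (1# + (ζ * ξ⁻¹ + ζ⁻¹ * ξ) * ω + ω * ω) ∎
        where
        open Relation.Binary.Reasoning.Setoid setoid
        ω = w n

    leftSum≈rightSum-with-units : leftSum T d x y p ≈ rightSum T d x y p
    leftSum≈rightSum-with-units = trans (sym leftSum≈∏) (trans
      (even-part≈ ζ ζ⁻¹ ξ ξ⁻¹ ζζ⁻¹≈1 ξξ⁻¹≈1 leftFactors rightFactors left right) rightSum≈∏)

-- Descent from the rings that contain a, b, ζ and ξ

module Descent {c ℓ} (T : CommutativeRing c ℓ) (r s : CommutativeRing.Carrier T) where
  open CommutativeRing T
  open QuadraticExtension T r s
  open Sums T
  open Algebra.Properties.CommutativeSemiring.Exp commutativeSemiring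
  private
    module E  = CommutativeRing extension
    module ∑ᴱ = Sums extension
    module ^ᴱ = Algebra.Properties.CommutativeSemiring.Exp E.commutativeSemiring

    embed-halfPower : ∀ p n → embed (halfPower T p n) E.≈ halfPower extension (embed p) n
    embed-halfPower p zero          = E.refl
    embed-halfPower p (suc zero)    = E.refl
    embed-halfPower p (suc (suc n)) = E.trans (embed-* _ _) (E.*-congˡ (embed-halfPower p n))

    embed-product : ∀ a k b j {u v} → embed u E.≈ v →
      embed (a ^ k * b ^ j * u) E.≈ embed a ^ᴱ.^ k E.* embed b ^ᴱ.^ j E.* v
    embed-product a k b j u≈v = E.trans (embed-* _ _)
      (E.*-cong (E.trans (embed-* _ _) (E.*-cong (embed-^ a k) (embed-^ b j))) u≈v)

  -- Both sums are polynomials in embedded elements, hence are embedded themselves, and the first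
  -- coordinate recovers their values in `T`.
  descend : ∀ d x y p →
    leftSum extension d (embed x) (embed y) (embed p) E.≈ rightSum extension d (embed x) (embed y) (embed p) →
    leftSum T d x y p ≈ rightSum T d x y p
  descend d x y p eq = trans (sym (trans (proj₁-∑ (codes d) _)
      (∑-cong (codes d) λ v → proj₁ (E.sym (embed-product x (total (λ _ → occurs) v) y (total (λ _ → parity ∘ occurrences) v)
        (embed-halfPower p (total blockWeight v)))))))
    (trans (proj₁ eq) (trans (proj₁-∑ (pairCodes d) _)
      (∑-cong (pairCodes d) λ v → proj₁ (E.sym (embed-product x (total (λ _ → pairOccurs) v) y (total (λ _ → pairOverlap) v)
        (embed-^ p (total pairWeight v)))))))

-- Adjoins a unit θ with θ + θ⁻¹ = a.
module ReciprocalRoots {c ℓ} (T : CommutativeRing c ℓ) (a : CommutativeRing.Carrier T) where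
  open CommutativeRing T
  open RingSolver T
  open QuadraticExtension T (- 1#) a public
  module E = CommutativeRing extension

  θ⁻¹ : E.Carrier
  θ⁻¹ = embed a E.- θ

  θ*θ⁻¹ : θ E.* θ⁻¹ E.≈ E.1#
  θ*θ⁻¹ = solve 1 (λ a → :0 :* (a :+ :- :0) :+ :- :1 :* (:1 :* (:0 :+ :- :1)) := :1) refl a
        , solve 1 (λ a → :0 :* (:0 :+ :- :1) :+ :1 :* (a :+ :- :0) :+ a :* (:1 :* (:0 :+ :- :1)) := :0) refl a

  θ+θ⁻¹ : θ E.+ θ⁻¹ E.≈ embed a
  θ+θ⁻¹ = solve 1 (λ a → :0 :+ (a :+ :- :0) := a) refl a , solve 0 (:1 :+ (:0 :+ :- :1) := :0) refl

module _ {c ℓ} (T : CommutativeRing c ℓ) where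
  open CommutativeRing T
  open Algebra.Properties.CommutativeSemiring.Exp commutativeSemiring

  -- a and b are the roots of t² - x y t + 2 x - 4.
  record Roots (x y a b : Carrier) : Set ℓ where
    field
      sum     : a + b ≈ x * y
      product : a * b + (1# + 1# + (1# + 1#)) ≈ x + x

  record Identity (d : ℕ) (x y p : Carrier) : Set ℓ where
    constructor identity
    field
      leftSum≈rightSum : leftSum T d x y p ≈ rightSum T d x y p

open Identity public

module Lift {c ℓ} (T : CommutativeRing c ℓ) (r s : CommutativeRing.Carrier T) where
  open CommutativeRing T
  open QuadraticExtension T r s
  open Algebra.Properties.CommutativeSemiring.Exp commutativeSemiring
  private
    module E  = CommutativeRing extension
    module ^ᴱ = Algebra.Properties.CommutativeSemiring.Exp E.commutativeSemiring

  lift-roots : ∀ {x y a b} → Roots T x y a b → Roots extension (embed x) (embed y) (embed a) (embed b)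
  lift-roots roots = record
    { sum     = E.trans (E.sym (embed-+ _ _)) (E.trans (embed-cong sum) (embed-* _ _))
    ; product = E.trans (E.+-cong (E.sym (embed-* _ _)) (E.sym 4≈))
        (E.trans (E.sym (embed-+ _ _)) (E.trans (embed-cong product) (embed-+ _ _)))
    }
    where
    open Roots roots
    4≈ : embed (1# + 1# + (1# + 1#)) E.≈ E.1# E.+ E.1# E.+ (E.1# E.+ E.1#)
    4≈ = E.trans (embed-+ _ _) (E.+-cong (embed-+ _ _) (embed-+ _ _))

  lift-inverse : ∀ {u v} → u * v ≈ 1# → embed u E.* embed v E.≈ E.1#
  lift-inverse uv≈1 = E.trans (E.sym (embed-* _ _)) (embed-cong uv≈1)

  lift-sum : ∀ {u v a} → u + v ≈ a → embed u E.+ embed v E.≈ embed a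
  lift-sum u+v≈a = E.trans (E.sym (embed-+ _ _)) (embed-cong u+v≈a)

  lift-nilpotent : ∀ p n → p ^ n ≈ 0# → embed p ^ᴱ.^ n E.≈ E.0#
  lift-nilpotent p n pⁿ≈0 = E.trans (E.sym (embed-^ p n)) (embed-cong pⁿ≈0)

module _ {c ℓ} (T : CommutativeRing c ℓ) (d : ℕ) (x y p : CommutativeRing.Carrier T)
         (pᵈ⁺¹≈0 : PowerVanishes T p (suc d)) where
  open CommutativeRing T
  open Algebra.Properties.CommutativeSemiring.Exp commutativeSemiring

  identity-with-units : ∀ {a b} → Roots T x y a b → ∀ ζ ζ⁻¹ ξ ξ⁻¹ →
    ζ * ζ⁻¹ ≈ 1# → ζ + ζ⁻¹ ≈ a → ξ * ξ⁻¹ ≈ 1# → ξ + ξ⁻¹ ≈ b → Identity T d x y p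
  identity-with-units roots ζ ζ⁻¹ ξ ξ⁻¹ ζζ⁻¹≈1 ζ+ζ⁻¹≈a ξξ⁻¹≈1 ξ+ξ⁻¹≈b = identity
    (leftSum≈rightSum-with-units T d x y p pᵈ⁺¹≈0 ζ ζ⁻¹ ξ ξ⁻¹ ζζ⁻¹≈1 ξξ⁻¹≈1
      (trans (+-cong ζ+ζ⁻¹≈a ξ+ξ⁻¹≈b) (Roots.sum roots))
      (trans (+-congʳ (*-cong ζ+ζ⁻¹≈a ξ+ξ⁻¹≈b)) (Roots.product roots)))

module _ {c ℓ} (T : CommutativeRing c ℓ) (d : ℕ) (x y p : CommutativeRing.Carrier T)
         (pᵈ⁺¹≈0 : PowerVanishes T p (suc d)) where
  open CommutativeRing T
  open Algebra.Properties.CommutativeSemiring.Exp commutativeSemiring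

  identity-with-unit : ∀ {a b} → Roots T x y a b → ∀ ζ ζ⁻¹ →
    ζ * ζ⁻¹ ≈ 1# → ζ + ζ⁻¹ ≈ a → Identity T d x y p
  identity-with-unit {a} {b} roots ζ ζ⁻¹ ζζ⁻¹≈1 ζ+ζ⁻¹≈a = identity (Descent.descend T (- 1#) b d x y p
    (leftSum≈rightSum (identity-with-units extension d (embed x) (embed y) (embed p) (lift-nilpotent p (suc d) pᵈ⁺¹≈0)
      (lift-roots roots) (embed ζ) (embed ζ⁻¹) θ θ⁻¹
      (lift-inverse ζζ⁻¹≈1) (lift-sum ζ+ζ⁻¹≈a) θ*θ⁻¹ θ+θ⁻¹)))
    where
    open ReciprocalRoots T b
    open Lift T (- 1#) b

module _ {c ℓ} (T : CommutativeRing c ℓ) (d : ℕ) (x y p : CommutativeRing.Carrier T)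
         (pᵈ⁺¹≈0 : PowerVanishes T p (suc d)) where
  open CommutativeRing T
  open Algebra.Properties.CommutativeSemiring.Exp commutativeSemiring

  identity-with-roots : ∀ {a b} → Roots T x y a b → Identity T d x y p
  identity-with-roots {a} {b} roots = identity (Descent.descend T (- 1#) a d x y p
    (leftSum≈rightSum (identity-with-unit extension d (embed x) (embed y) (embed p) (lift-nilpotent p (suc d) pᵈ⁺¹≈0)
      (lift-roots roots) θ θ⁻¹ θ*θ⁻¹ θ+θ⁻¹)))
    where
    open ReciprocalRoots T a
    open Lift T (- 1#) a

module _ {c ℓ} (T : CommutativeRing c ℓ) (d : ℕ) (x y p : CommutativeRing.Carrier T)
         (pᵈ⁺¹≈0 : PowerVanishes T p (suc d)) where
  open CommutativeRing T
  open Algebra.Properties.CommutativeSemiring.Exp commutativeSemiring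

  private
    -- With r = 4 - 2x, the product of θ and xy - θ is -r = 2x - 4.
    r : Carrier
    r = 1# + 1# + (1# + 1#) - (x + x)

    open RingSolver T
    open QuadraticExtension T r (x * y)
    module E = CommutativeRing extension

    roots : Roots extension (embed x) (embed y) θ (embed (x * y) E.- θ)
    roots = record
      { sum     = E.trans
          ( solve 1 (λ u → :0 :+ (u :+ :- :0) := u) refl (x * y)
          , solve 0 (:1 :+ (:0 :+ :- :1) := :0) refl) (embed-* x y)
      ; product = E.trans
          ( solve 2 (λ u v → :0 :* (v :+ :- :0) :+ (:1 :+ :1 :+ (:1 :+ :1) :- u) :* (:1 :* (:0 :+ :- :1))
              :+ (:1 :+ :1 :+ (:1 :+ :1)) := u) refl (x + x) (x * y)
          , solve 1 (λ v → :0 :* (:0 :+ :- :1) :+ :1 :* (v :+ :- :0) :+ v :* (:1 :* (:0 :+ :- :1))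
              :+ (:0 :+ :0 :+ (:0 :+ :0)) := :0) refl (x * y)) (embed-+ x x)
      }

  -- A tower of three quadratic extensions: the first contains a and b, the second ζ, the third ξ.
  -- The identity proved at the top descends through each of them in turn.
  even-part-identity : Identity T d x y p
  even-part-identity = identity (Descent.descend T r (x * y) d x y p
    (leftSum≈rightSum (identity-with-roots extension d (embed x) (embed y) (embed p)
      (Lift.lift-nilpotent T r (x * y) p (suc d) pᵈ⁺¹≈0) roots)))

-- Coding PDO partitions by vectors of blocks

open import Defs
open import Data.Bool.Base using (true; false; if_then_else_)
import Data.Fin.Base as Fin
open import Data.Integer.Base using (0ℤ; 1ℤ)
open import Data.List.Base using (length; deduplicate; replicate; concatMap)
import Data.List.Membership.DecPropositional as DecMembership
open import Data.List.Membership.Propositional.Properties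
  using (∈-downFrom⁺; ∈-deduplicate⁻; ∈-++⁺ʳ; ∈-++⁻)
import Data.List.Properties as List
open import Data.List.Relation.Binary.Permutation.Propositional.Properties using (↭-length)
import Data.List.Relation.Unary.All.Properties as All
open import Data.List.Relation.Unary.Linked as Linked using (Linked; []; [-]; _∷_)
import Data.Maybe.Properties as Maybe
open import Data.Nat using (_+_; _*_; _≟_; _≥_)
open import Data.Nat.Divisibility using (_∤_; ∣m+n∣m⇒∣n; m∣m*n)
open import Data.Nat.ListAction using (sum)
open import Data.Nat.ListAction.Properties using (sum-++)
open import Data.Product.Base using (∃₂)
open import Data.Sum.Base using (_⊎_; inj₁; inj₂)
import Data.Vec.Properties as Vec
open import Relation.Binary.PropositionalEquality using (refl; sym; trans; cong; cong₂; subst)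
open import Relation.Nullary.Decidable using (¬?; dec-true; dec-false)

length-filter-cong∈ : ∀ {a p q} {A : Set a} {P : Pred A p} {Q : Pred A q}
  (P? : Decidable P) (Q? : Decidable Q) xs →
  (∀ {x} → x ∈ xs → P x → Q x) → (∀ {x} → x ∈ xs → Q x → P x) →
  length (filter P? xs) ≡ length (filter Q? xs)
length-filter-cong∈ P? Q? []       P⇒Q Q⇒P = refl
length-filter-cong∈ P? Q? (x ∷ xs) P⇒Q Q⇒P
  with P? x | Q? x | length-filter-cong∈ P? Q? xs (P⇒Q ∘ there) (Q⇒P ∘ there)
... | yes _ | yes _ | eq = cong suc eq
... | no _  | no _  | eq = eq
... | yes p | no ¬q | _  = contradiction (P⇒Q (here refl) p) ¬q
... | no ¬p | yes q | _  = contradiction (Q⇒P (here refl) q) ¬p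

expand : ℕ → Block → MarkedParts
expand s nothing        = []
expand s (just (d , e)) = replicate d (s , false) ++ (s , true) ∷ replicate e (s , false)

-- The entry at distance n from the end describes the part size 2n + 1, so that larger sizes come
-- first, as `IsPDO` demands.
decode : ∀ {n} → Vec Block n → MarkedParts
decode []              = []
decode {suc n} (b ∷ v) = expand (oddNumber n) b ++ decode v

sizes-replicate : ∀ n s b → sizes (replicate n (s , b)) ≡ replicate n s
sizes-replicate n s b = List.map-replicate proj₁ n (s , b)

sizes-expand : ∀ s b → sizes (expand s b) ≡ replicate (occurrences b) s
sizes-expand s nothing              = refl
sizes-expand s (just (zero  , e))   = cong (s ∷_) (sizes-replicate e s false)
sizes-expand s (just (suc d , e))   = cong (s ∷_) (sizes-expand s (just (d , e)))

sizes-expand-++ : ∀ s b l → sizes (expand s b ++ l) ≡ replicate (occurrences b) s ++ sizes l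
sizes-expand-++ s b l = trans (List.map-++ proj₁ (expand s b) l) (cong (_++ sizes l) (sizes-expand s b))

all-sizes-expand : ∀ {p} {P : Pred ℕ p} s b → P s → All P (sizes (expand s b))
all-sizes-expand s b Ps = subst (All _) (sym (sizes-expand s b)) (All.replicate⁺ (occurrences b) Ps)

all-sizes-++ : ∀ {p} {P : Pred ℕ p} l l′ → All P (sizes l) → All P (sizes l′) → All P (sizes (l ++ l′))
all-sizes-++ l l′ ps ps′ = subst (All _) (sym (List.map-++ proj₁ l l′)) (All.++⁺ ps ps′)

oddNumber-< : ∀ n → oddNumber n < oddNumber (suc n)
oddNumber-< n = s≤s (ℕ.*-monoʳ-< 2 (ℕ.n<1+n n))

decode-< : ∀ {n} (v : Vec Block n) → All (_< oddNumber n) (sizes (decode v))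
decode-< []              = []
decode-< {suc n} (b ∷ v) = all-sizes-++ (expand _ b) (decode v)
  (all-sizes-expand _ b (oddNumber-< n))
  (All.map (λ s< → ℕ.<-trans s< (oddNumber-< n)) (decode-< v))

oddNumber-odd : ∀ n → 2 ∤ oddNumber n
oddNumber-odd n 2∣ = contradiction (∣m+n∣m⇒∣n {2} {2 ℕ.* n} (subst (2 ∣_) (ℕ.+-comm 1 (2 ℕ.* n)) 2∣) (m∣m*n n))
  λ { (divides zero ()) ; (divides (suc _) ()) }

decode-odd : ∀ {n} (v : Vec Block n) → All (2 ∤_) (sizes (decode v))
decode-odd []              = []
decode-odd {suc n} (b ∷ v) = all-sizes-++ (expand _ b) (decode v)
  (all-sizes-expand _ b (oddNumber-odd n)) (decode-odd v)

linked-∷ : ∀ {s xs} → All (_≤ s) xs → Linked _≥_ xs → Linked _≥_ (s ∷ xs)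
linked-∷ []        []  = [-]
linked-∷ (x≤s ∷ _) lxs = x≤s ∷ lxs

linked-replicate-++ : ∀ n {s xs} → All (_≤ s) xs → Linked _≥_ xs → Linked _≥_ (replicate n s ++ xs)
linked-replicate-++ zero    xs≤s lxs = lxs
linked-replicate-++ (suc n) xs≤s lxs =
  linked-∷ (All.++⁺ (All.replicate⁺ n ℕ.≤-refl) xs≤s) (linked-replicate-++ n xs≤s lxs)

decode-decreasing : ∀ {n} (v : Vec Block n) → Linked _≥_ (sizes (decode v))
decode-decreasing []      = []
decode-decreasing (b ∷ v) = subst (Linked _≥_) (sym (sizes-expand-++ _ b (decode v)))
  (linked-replicate-++ (occurrences b) (All.map ℕ.<⇒≤ (decode-< v)) (decode-decreasing v))

designations-++ : ∀ s l l′ → designations s (l ++ l′) ≡ designations s l ℕ.+ designations s l′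
designations-++ s l l′ = trans (cong length (List.filter-++ ((s , true) ≟ᵉ_) l l′))
  (List.length-++ (filter ((s , true) ≟ᵉ_) l))

designations-absent : ∀ s l → All (s ≢_) (sizes l) → designations s l ≡ 0
designations-absent s l s∉l = cong length (List.filter-none ((s , true) ≟ᵉ_)
  (All.map (λ s≢ → λ { refl → s≢ refl }) (All.map⁻ s∉l)))

designations-true : ∀ s l → designations s ((s , true) ∷ l) ≡ suc (designations s l)
designations-true s l = cong length (List.filter-accept ((s , true) ≟ᵉ_) refl)

designations-false : ∀ s l → designations s ((s , false) ∷ l) ≡ designations s l
designations-false s l = cong length (List.filter-reject ((s , true) ≟ᵉ_) λ ())

designations-replicate : ∀ s n → designations s (replicate n (s , false)) ≡ 0
designations-replicate s zero    = refl
designations-replicate s (suc n) = trans (designations-false s _) (designations-replicate s n)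

designations-expand : ∀ s d e → designations s (expand s (just (d , e))) ≡ 1
designations-expand s zero    e = trans (designations-true s _) (cong suc (designations-replicate s e))
designations-expand s (suc d) e = trans (designations-false s _) (designations-expand s d e)

private
  <⇒≢-all : ∀ {s xs} → All (_< s) xs → All (s ≢_) xs
  <⇒≢-all = All.map (λ x<s s≡x → ℕ.<⇒≢ x<s (sym s≡x))

  ∈⇒≢ : ∀ {s x xs} → All (_< s) xs → x ∈ xs → x ≢ s
  ∈⇒≢ xs<s x∈ = ℕ.<⇒≢ (All.lookup xs<s x∈)

designations-++-absent : ∀ {s} b {l} → All (_< s) (sizes l) → ∀ {x} → x ∈ sizes l →
  designations x (expand s b ++ l) ≡ designations x l
designations-++-absent {s} b {l} l<s {x} x∈ = trans (designations-++ x (expand s b) l)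
  (cong (ℕ._+ designations x l) (designations-absent x (expand s b) (all-sizes-expand {P = x ≢_} s b (∈⇒≢ l<s x∈))))

decode-designated : ∀ {n} (v : Vec Block n) → All (λ s → designations s (decode v) ≡ 1) (sizes (decode v))
decode-designated []      = []
decode-designated (b ∷ v) = all-sizes-++ (expand _ b) (decode v) (head b)
  (All.tabulate λ x∈ → trans (designations-++-absent b (decode-< v) x∈) (All.lookup (decode-designated v) x∈))
  where
  head : ∀ b → All (λ s → designations s (expand _ b ++ decode v) ≡ 1) (sizes (expand _ b))
  head nothing          = []
  head b@(just (d , e)) = all-sizes-expand _ b (trans (designations-++ _ (expand _ b) (decode v))
    (cong₂ ℕ._+_ (designations-expand _ d e) (designations-absent _ (decode v) (<⇒≢-all (decode-< v)))))

decode-isPDO : ∀ {n} (v : Vec Block n) → IsPDO (decode v)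
decode-isPDO v = isPDO (decode-decreasing v) (decode-odd v) (decode-designated v)

sum-replicate : ∀ n s → sum (replicate n s) ≡ s ℕ.* n
sum-replicate zero    s = sym (ℕ.*-zeroʳ s)
sum-replicate (suc n) s = trans (cong (s ℕ.+_) (sum-replicate n s)) (sym (ℕ.*-suc s n))

weight-decode : ∀ {n} (v : Vec Block n) → weight (decode v) ≡ total blockWeight v
weight-decode []              = refl
weight-decode {suc n} (b ∷ v) = begin
  sum (sizes (expand (oddNumber n) b ++ decode v))
    ≡⟨ cong sum (sizes-expand-++ (oddNumber n) b (decode v)) ⟩
  sum (replicate (occurrences b) (oddNumber n) ++ sizes (decode v))
    ≡⟨ sum-++ (replicate (occurrences b) (oddNumber n)) (sizes (decode v)) ⟩
  sum (replicate (occurrences b) (oddNumber n)) ℕ.+ weight (decode v)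
    ≡⟨ cong₂ ℕ._+_ (sum-replicate (occurrences b) (oddNumber n)) (weight-decode v) ⟩
  blockWeight n b ℕ.+ total blockWeight v ∎
  where open ≡.≡-Reasoning

deduplicate-replicate-++ : ∀ m {s xs} → All (s ≢_) xs →
  deduplicate ℕ._≟_ (replicate (suc m) s ++ xs) ≡ s ∷ deduplicate ℕ._≟_ xs
deduplicate-replicate-++ zero    {s} s∉xs =
  cong (s ∷_) (List.filter-all (¬? ∘ (s ℕ.≟_)) (All.deduplicate⁺ ℕ._≟_ s∉xs))
deduplicate-replicate-++ (suc m) {s} {xs} s∉xs = cong (s ∷_) (begin
  filter (¬? ∘ (s ℕ.≟_)) (deduplicate ℕ._≟_ (replicate (suc m) s ++ xs))
    ≡⟨ cong (filter (¬? ∘ (s ℕ.≟_))) (deduplicate-replicate-++ m s∉xs) ⟩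
  filter (¬? ∘ (s ℕ.≟_)) (s ∷ deduplicate ℕ._≟_ xs)
    ≡⟨ List.filter-reject (¬? ∘ (s ℕ.≟_)) (λ s≢s → s≢s refl) ⟩
  filter (¬? ∘ (s ℕ.≟_)) (deduplicate ℕ._≟_ xs)
    ≡⟨ List.filter-all (¬? ∘ (s ℕ.≟_)) (All.deduplicate⁺ ℕ._≟_ s∉xs) ⟩
  deduplicate ℕ._≟_ xs ∎)
  where open ≡.≡-Reasoning

differentSizes-expand-++ : ∀ {s} x {l} → All (_< s) (sizes l) →
  differentSizes (expand s (just x) ++ l) ≡ s ∷ differentSizes l
differentSizes-expand-++ {s} x@(d , e) {l} l<s = trans
  (cong (deduplicate ℕ._≟_) (sizes-expand-++ s (just x) l))
  (deduplicate-replicate-++ (d ℕ.+ e) (<⇒≢-all l<s))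

∈-differentSizes⁻ : ∀ l {x} → x ∈ differentSizes l → x ∈ sizes l
∈-differentSizes⁻ l = ∈-deduplicate⁻ ℕ._≟_ (sizes l)

ℓd-decode : ∀ {n} (v : Vec Block n) → ℓd (decode v) ≡ total (λ _ → occurs) v
ℓd-decode []            = refl
ℓd-decode (nothing ∷ v) = ℓd-decode v
ℓd-decode (just x ∷ v)  = trans (cong length (differentSizes-expand-++ x (decode-< v))) (cong suc (ℓd-decode v))

filter-replicate-≟ : ∀ s n → length (filter (s ℕ.≟_) (replicate n s)) ≡ n
filter-replicate-≟ s zero    = refl
filter-replicate-≟ s (suc n) = trans (cong length (List.filter-accept (s ℕ.≟_) refl)) (cong suc (filter-replicate-≟ s n))

multiplicity-expand-++ : ∀ x s b l → multiplicity x (expand s b ++ l) ≡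
  length (filter (x ℕ.≟_) (replicate (occurrences b) s)) ℕ.+ multiplicity x l
multiplicity-expand-++ x s b l = trans (cong (length ∘ filter (x ℕ.≟_)) (sizes-expand-++ s b l))
  (trans (cong length (List.filter-++ (x ℕ.≟_) (replicate (occurrences b) s) (sizes l)))
    (List.length-++ (filter (x ℕ.≟_) (replicate (occurrences b) s))))

multiplicity-head : ∀ {s} b {l} → All (_< s) (sizes l) → multiplicity s (expand s b ++ l) ≡ occurrences b
multiplicity-head {s} b {l} l<s = trans (multiplicity-expand-++ s s b l)
  (trans (cong₂ ℕ._+_ (filter-replicate-≟ s (occurrences b)) (cong length (List.filter-none (s ℕ.≟_) (<⇒≢-all l<s))))
    (ℕ.+-identityʳ _))

multiplicity-tail : ∀ {s} b {l} → All (_< s) (sizes l) → ∀ {x} → x ∈ sizes l →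
  multiplicity x (expand s b ++ l) ≡ multiplicity x l
multiplicity-tail {s} b {l} l<s {x} x∈ = trans (multiplicity-expand-++ x s b l)
  (cong (λ l′ → length l′ ℕ.+ multiplicity x l)
    (List.filter-none (x ℕ.≟_) (All.replicate⁺ (occurrences b) (∈⇒≢ l<s x∈))))

parity-even : ∀ {m} → 2 ∣ m → parity m ≡ 0
parity-even (divides zero    refl) = refl
parity-even (divides (suc k) refl) = parity-even (divides k refl)

parity-odd : ∀ {m} → 2 ∤ m → parity m ≡ 1
parity-odd 2∤m with odd⇒oddNumber _ 2∤m
... | k , refl = parity-oddNumber k
  where
  parity-oddNumber : ∀ k → parity (oddNumber k) ≡ 1
  parity-oddNumber zero    = refl
  parity-oddNumber (suc k) = trans (cong (parity ∘ suc) (ℕ.*-suc 2 k)) (parity-oddNumber k)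

-- All sizes in the tail lie below that of the head block, so the multiplicity of each size is
-- determined by its own block.
ℓdᵒ-decode : ∀ {n} (v : Vec Block n) → ℓdᵒ (decode v) ≡ total (λ _ b → parity (occurrences b)) v
ℓdᵒ-decode []                    = refl
ℓdᵒ-decode (nothing ∷ v)         = ℓdᵒ-decode v
ℓdᵒ-decode {suc n} (b@(just x) ∷ v) = begin
  length (filter odd? (differentSizes (expand s b ++ decode v)))
    ≡⟨ cong (length ∘ filter odd?) (differentSizes-expand-++ x (decode-< v)) ⟩
  length (filter odd? (s ∷ differentSizes (decode v)))
    ≡⟨ head ⟩
  parity (occurrences b) ℕ.+ length (filter odd? (differentSizes (decode v)))
    ≡⟨ cong (parity (occurrences b) ℕ.+_) (trans
         (length-filter-cong∈ odd? (λ s → ¬? (2 ∣? multiplicity s (decode v))) (differentSizes (decode v))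
           (λ x∈ → subst (2 ∤_) (tail x∈)) (λ x∈ → subst (2 ∤_) (sym (tail x∈))))
         (ℓdᵒ-decode v)) ⟩
  parity (occurrences b) ℕ.+ total (λ _ b → parity (occurrences b)) v ∎
  where
  open ≡.≡-Reasoning
  s = oddNumber n
  odd? : Decidable (λ s → 2 ∤ multiplicity s (expand (oddNumber n) b ++ decode v))
  odd? = λ s → ¬? (2 ∣? multiplicity s (expand (oddNumber n) b ++ decode v))
  tail : ∀ {x} → x ∈ differentSizes (decode v) → multiplicity x (expand s b ++ decode v) ≡ multiplicity x (decode v)
  tail x∈ = multiplicity-tail b (decode-< v) (∈-differentSizes⁻ (decode v) x∈)
  head : length (filter odd? (s ∷ differentSizes (decode v))) ≡
         parity (occurrences b) ℕ.+ length (filter odd? (differentSizes (decode v)))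
  head with 2 ∣? occurrences b
  ... | yes 2∣m = trans (cong length (List.filter-reject odd? (λ 2∤m → 2∤m (subst (2 ∣_) (sym (multiplicity-head b (decode-< v))) 2∣m))))
                    (cong (ℕ._+ length (filter odd? (differentSizes (decode v)))) (sym (parity-even 2∣m)))
  ... | no 2∤m = trans (cong length (List.filter-accept odd? (subst (2 ∤_) (sym (multiplicity-head b (decode-< v))) 2∤m)))
                    (cong (ℕ._+ length (filter odd? (differentSizes (decode v)))) (sym (parity-odd 2∤m)))

decode₂ : ∀ {n} → Vec (Block × Block) n → MarkedParts × MarkedParts
decode₂ v = decode (Vec.map proj₁ v) , decode (Vec.map proj₂ v)

private
  module ∈ℕ = DecMembership ℕ._≟_

∈-sizes-expand-++ : ∀ {s} b {l x} → x ≢ s → x ∈ sizes (expand s b ++ l) → x ∈ sizes l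
∈-sizes-expand-++ {s} b {l} {x} x≢s x∈
  with ∈-++⁻ (sizes (expand s b)) (subst (x ∈_) (List.map-++ proj₁ (expand s b) l) x∈)
... | inj₁ x∈b = contradiction (All.lookup (all-sizes-expand {P = _≡ s} s b refl) x∈b) x≢s
... | inj₂ x∈l = x∈l

∈-sizes-++⁺ʳ : ∀ l {l′ x} → x ∈ sizes l′ → x ∈ sizes (l ++ l′)
∈-sizes-++⁺ʳ l {l′} {x} x∈ = subst (x ∈_) (sym (List.map-++ proj₁ l l′)) (∈-++⁺ʳ (sizes l) x∈)

∈-sizes-expand-just : ∀ s x l → s ∈ sizes (expand s (just x) ++ l)
∈-sizes-expand-just s x l = subst (s ∈_) (sym (sizes-expand-++ s (just x) l)) (here refl)

ℓr-decode : ∀ {n} (v : Vec (Block × Block) n) →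
  ℓr (proj₁ (decode₂ v)) (proj₂ (decode₂ v)) ≡ total (λ _ (b , b′) → occurs b ℕ.* occurs b′) v
ℓr-decode []                     = refl
ℓr-decode {suc n} ((b , b′) ∷ v) = trans (head b b′) (cong (occurs b ℕ.* occurs b′ ℕ.+_) (trans
    (length-filter-cong∈ (∈ℕ._∈? sizes m′) (∈ℕ._∈? sizes l′) (differentSizes l)
      (λ x∈ → ∈-sizes-expand-++ b′ (∈⇒≢ l<s (∈-differentSizes⁻ l x∈)))
      (λ _ → ∈-sizes-++⁺ʳ (expand s b′)))
    (ℓr-decode v)))
  where
  s  = oddNumber n
  l  = proj₁ (decode₂ v)
  l′ = proj₂ (decode₂ v)
  m′ = expand s b′ ++ l′
  l<s : All (_< s) (sizes l)
  l<s = decode-< (Vec.map proj₁ v)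
  l′<s : All (_< s) (sizes l′)
  l′<s = decode-< (Vec.map proj₂ v)
  head : ∀ b b′ → ℓr (expand s b ++ l) (expand s b′ ++ l′) ≡
    occurs b ℕ.* occurs b′ ℕ.+ length (filter (∈ℕ._∈? sizes (expand s b′ ++ l′)) (differentSizes l))
  head nothing  b′       = refl
  head (just x) nothing  = trans (cong (length ∘ filter (∈ℕ._∈? sizes l′)) (differentSizes-expand-++ x l<s))
    (cong length (List.filter-reject (∈ℕ._∈? sizes l′) λ s∈ → ∈⇒≢ l′<s s∈ refl))
  head (just x) (just y) = trans
    (cong (length ∘ filter (∈ℕ._∈? sizes (expand s (just y) ++ l′))) (differentSizes-expand-++ x l<s))
    (cong length (List.filter-accept (∈ℕ._∈? sizes (expand s (just y) ++ l′)) (∈-sizes-expand-just s y l′)))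

expand-injective : ∀ s b b′ → expand s b ≡ expand s b′ → b ≡ b′
expand-injective s nothing              nothing               eq = refl
expand-injective s nothing              (just (zero , _))     ()
expand-injective s nothing              (just (suc _ , _))    ()
expand-injective s (just (zero , _))    nothing               ()
expand-injective s (just (suc _ , _))   nothing               ()
expand-injective s (just (zero , e))    (just (zero , e′))    eq = cong (λ e → just (zero , e))
  (trans (sym (List.length-replicate e)) (trans (cong length (List.∷-injectiveʳ eq)) (List.length-replicate e′)))
expand-injective s (just (zero , e))    (just (suc d′ , e′))  ()
expand-injective s (just (suc d , e))   (just (zero , e′))    ()
expand-injective s (just (suc d , e))   (just (suc d′ , e′))  eq
  with refl ← expand-injective s (just (d , e)) (just (d′ , e′)) (List.∷-injectiveʳ eq) = refl

filter-expand-++ : ∀ {s} b {l} → All (_< s) (sizes l) →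
  filter (λ x → proj₁ x ℕ.≟ s) (expand s b ++ l) ≡ expand s b
filter-expand-++ {s} b {l} l<s = trans (List.filter-++ _ (expand s b) l) (trans (cong₂ _++_
  (List.filter-all _ (All.map⁻ (all-sizes-expand s b refl)))
  (List.filter-none _ (All.map⁻ (All.map ℕ.<⇒≢ l<s)))) (List.++-identityʳ _))

filter-¬-expand-++ : ∀ {s} b {l} → All (_< s) (sizes l) →
  filter (λ x → ¬? (proj₁ x ℕ.≟ s)) (expand s b ++ l) ≡ l
filter-¬-expand-++ {s} b {l} l<s = trans (List.filter-++ _ (expand s b) l) (cong₂ _++_
  (List.filter-none _ (All.map⁻ (all-sizes-expand s b (λ s≢s → s≢s refl))))
  (List.filter-all _ (All.map⁻ (All.map ℕ.<⇒≢ l<s))))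

-- Head blocks can differ in length, so the lists are separated by size and not by position: the
-- entries of size `s` form the head block, all others the tail.
decode-injective : ∀ {n} (v v′ : Vec Block n) → decode v ≡ decode v′ → v ≡ v′
decode-injective []              []        eq = refl
decode-injective {suc n} (b ∷ v) (b′ ∷ v′) eq = cong₂ _∷_
  (expand-injective s b b′ (trans (sym (filter-expand-++ b (decode-< v)))
    (trans (cong (filter (λ x → proj₁ x ℕ.≟ s)) eq) (filter-expand-++ b′ (decode-< v′)))))
  (decode-injective v v′ (trans (sym (filter-¬-expand-++ b (decode-< v)))
    (trans (cong (filter (λ x → ¬? (proj₁ x ℕ.≟ s))) eq) (filter-¬-expand-++ b′ (decode-< v′)))))
  where
  s = oddNumber n

decode₂-injective : ∀ {n} (v v′ : Vec (Block × Block) n) → decode₂ v ≡ decode₂ v′ → v ≡ v′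
decode₂-injective v v′ eq = unzipped v v′
  (decode-injective (Vec.map proj₁ v) (Vec.map proj₁ v′) (cong proj₁ eq))
  (decode-injective (Vec.map proj₂ v) (Vec.map proj₂ v′) (cong proj₂ eq))
  where
  unzipped : ∀ {n} (v v′ : Vec (Block × Block) n) →
    Vec.map proj₁ v ≡ Vec.map proj₁ v′ → Vec.map proj₂ v ≡ Vec.map proj₂ v′ → v ≡ v′
  unzipped []      []        _   _   = refl
  unzipped (x ∷ v) (x′ ∷ v′) eq₁ eq₂ = cong₂ _∷_
    (cong₂ _,_ (Vec.∷-injectiveˡ eq₁) (Vec.∷-injectiveˡ eq₂))
    (unzipped v v′ (Vec.∷-injectiveʳ eq₁) (Vec.∷-injectiveʳ eq₂))

undesignated : ∀ s bs → designations s (map (s ,_) bs) ≡ 0 → map (s ,_) bs ≡ replicate (length bs) (s , false)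
undesignated s []           _  = refl
undesignated s (true ∷ bs)  eq = contradiction (trans (sym (designations-true s (map (s ,_) bs))) eq) λ ()
undesignated s (false ∷ bs) eq = cong (_ ∷_) (undesignated s bs (trans (sym (designations-false s (map (s ,_) bs))) eq))

-- The position of the designated occurrence is the first count, and after it there is no further
-- designated one.
expand-surjective : ∀ s bs → designations s (map (s ,_) bs) ≡ 1 → ∃[ x ] map (s ,_) bs ≡ expand s (just x)
expand-surjective s []           ()
expand-surjective s (true ∷ bs)  eq = (0 , length bs) , cong (_ ∷_)
  (undesignated s bs (ℕ.suc-injective (trans (sym (designations-true s (map (s ,_) bs))) eq)))
expand-surjective s (false ∷ bs) eq =
  let (d , e) , eq′ = expand-surjective s bs (trans (sym (designations-false s (map (s ,_) bs))) eq)
  in (suc d , e) , cong (_ ∷_) eq′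

-- In a decreasing list bounded by `s`, the entries of size `s` form a prefix. It may be empty,
-- which becomes the block `nothing`.
splitLargest : ∀ s l → Linked _≥_ (sizes l) → All (_≤ s) (sizes l) →
  ∃₂ λ bs l′ → l ≡ map (s ,_) bs ++ l′ × Linked _≥_ (sizes l′) × All (_< s) (sizes l′)
splitLargest s []            _         _            = [] , [] , refl , [] , []
splitLargest s ((a , b) ∷ l) decreasing (a≤s ∷ l≤s) with a ℕ.≟ s
... | yes refl = let bs , l′ , l≡ , decreasing′ , l′<s = splitLargest s l (Linked.tail decreasing) l≤s
                 in b ∷ bs , l′ , cong (_ ∷_) l≡ , decreasing′ , l′<s
... | no a≢s   = [] , (a , b) ∷ l , refl , decreasing , below decreasing (ℕ.≤∧≢⇒< a≤s a≢s)
  where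
  below : ∀ {a xs} → Linked _≥_ (a ∷ xs) → a < s → All (_< s) (a ∷ xs)
  below [-]         a<s = a<s ∷ []
  below (a≥x ∷ lxs) a<s = a<s ∷ below lxs (ℕ.≤-<-trans a≥x a<s)

decode-surjective : ∀ n l → IsPDO l → All (_< oddNumber n) (sizes l) → ∃[ v ] l ≡ decode {n} v
decode-surjective zero    []            _   _              = [] , refl
-- A size below 1 is 0, which is even.
decode-surjective zero    ((a , _) ∷ _) pdo (s≤s z≤n ∷ _)  = contradiction (2 ∣0) (All.head (IsPDO.odd pdo))
decode-surjective (suc n) l pdo@(isPDO decreasing odd designated) l<
  with splitLargest (oddNumber n) l decreasing (All.zipWith (λ (2∤a , a<) → ≤s 2∤a a<) (odd , l<))
  where
  -- Below 2n + 3 and odd means at most 2n + 1, since 2n + 2 is even.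
  ≤s : ∀ {a} → 2 ∤ a → a < oddNumber (suc n) → a ≤ oddNumber n
  ≤s {a} 2∤a a< with odd⇒oddNumber a 2∤a
  ... | k , refl = s≤s (ℕ.*-monoʳ-≤ 2 (ℕ.s≤s⁻¹ (ℕ.*-cancelˡ-< 2 k (suc n) (ℕ.s≤s⁻¹ a<))))
... | bs , l′ , refl , decreasing′ , l′<s =
  let b , b≡ = block bs designated
      v , v≡ = decode-surjective n l′ (isPDO decreasing′ odd′ designated′) l′<s
  in b ∷ v , cong₂ _++_ b≡ v≡
  where
  s = oddNumber n
  sizes-++ : sizes (map (s ,_) bs ++ l′) ≡ sizes (map (s ,_) bs) ++ sizes l′
  sizes-++ = List.map-++ proj₁ (map (s ,_) bs) l′
  odd′ : All (2 ∤_) (sizes l′)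
  odd′ = All.++⁻ʳ (sizes (map (s ,_) bs)) (subst (All _) sizes-++ odd)
  bs≡s : ∀ bs → All (_≡ s) (sizes (map (s ,_) bs))
  bs≡s []       = []
  bs≡s (b ∷ bs) = refl ∷ bs≡s bs
  designated′ : All (λ x → designations x l′ ≡ 1) (sizes l′)
  designated′ = All.tabulate λ {x} x∈ → trans
    (sym (trans (designations-++ x (map (s ,_) bs) l′) (cong (ℕ._+ designations x l′)
      (designations-absent x (map (s ,_) bs) (All.map (λ { refl → ∈⇒≢ l′<s x∈ }) (bs≡s bs))))))
    (All.lookup designated (∈-sizes-++⁺ʳ (map (s ,_) bs) x∈))
  block : ∀ bs → All (λ x → designations x (map (s ,_) bs ++ l′) ≡ 1) (sizes (map (s ,_) bs ++ l′)) →
    ∃[ b ] map (s ,_) bs ≡ expand s b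
  block []           _           = nothing , refl
  block bs@(_ ∷ _) (eq ∷ _) = let x , x≡ = expand-surjective s bs count in just x , x≡
    where
    count : designations s (map (s ,_) bs) ≡ 1
    count = trans (sym (trans (designations-++ s (map (s ,_) bs) l′)
      (trans (cong (designations s (map (s ,_) bs) ℕ.+_) (designations-absent s l′ (<⇒≢-all l′<s)))
        (ℕ.+-identityʳ _)))) eq

∈-vectors : ∀ {a} {A : Set a} (as : List A) {n} (v : Vec A n) → (∀ i → Vec.lookup v i ∈ as) → v ∈ vectors as n
∈-vectors as []      _  = here refl
∈-vectors as (a ∷ v) ∈as = ∈-map⁺ (λ (a , v) → a ∷ v)
  (∈-cartesianProduct⁺ (∈as Fin.zero) (∈-vectors as v (∈as ∘ Fin.suc)))

vectors-unique : ∀ {a} {A : Set a} {as : List A} n → Unique as → Unique (vectors as n)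
vectors-unique zero    as! = [] ∷ []
vectors-unique (suc n) as! = Unique.map⁺ (λ eq → cong₂ _,_ (Vec.∷-injectiveˡ eq) (Vec.∷-injectiveʳ eq))
  (Unique.cartesianProduct⁺ as! (vectors-unique n as!))

blocks-unique : ∀ t → Unique (blocks t)
blocks-unique t = All.map⁺ (All.tabulate (λ _ ())) ∷
  Unique.map⁺ Maybe.just-injective (Unique.cartesianProduct⁺ (Unique.downFrom⁺ t) (Unique.downFrom⁺ t))

∈-blocks : ∀ {t} b → occurrences b ≤ t → b ∈ blocks t
∈-blocks nothing        _     = here refl
∈-blocks (just (d , e)) d+e<t = there (∈-map⁺ just (∈-cartesianProduct⁺
  (∈-downFrom⁺ (ℕ.≤-<-trans (ℕ.m≤m+n d e) d+e<t)) (∈-downFrom⁺ (ℕ.≤-<-trans (ℕ.m≤n+m e d) d+e<t))))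

-- Every part is at least 1, so the weight bounds each multiplicity.
lookup-≤-total : ∀ {n} (v : Vec Block n) i → occurrences (Vec.lookup v i) ≤ total blockWeight v
lookup-≤-total {suc n} (b ∷ v) Fin.zero    = ℕ.≤-trans (ℕ.m≤n*m (occurrences b) (oddNumber n)) (ℕ.m≤m+n _ _)
lookup-≤-total {suc n} (b ∷ v) (Fin.suc i) = ℕ.≤-trans (lookup-≤-total v i) (ℕ.m≤n+m _ _)

sizes-≤-weight : ∀ l → All (_≤ weight l) (sizes l)
sizes-≤-weight []            = []
sizes-≤-weight ((a , _) ∷ l) = ℕ.m≤m+n a _ ∷ All.map (λ x≤ → ℕ.≤-trans x≤ (ℕ.m≤n+m _ a)) (sizes-≤-weight l)

∈-decode : ∀ {n t l} → IsPDO l → weight l < oddNumber n → weight l ≤ t →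
  ∃[ v ] l ≡ decode v × v ∈ vectors (blocks t) n
∈-decode {n} {t} {l} pdo w<n w≤t with decode-surjective n l pdo (All.map (λ a≤w → ℕ.≤-<-trans a≤w w<n) (sizes-≤-weight l))
... | v , refl = v , refl , ∈-vectors (blocks t) v (λ i → ∈-blocks (Vec.lookup v i)
  (ℕ.≤-trans (lookup-≤-total v i) (ℕ.≤-trans (ℕ.≤-reflexive (sym (weight-decode v))) w≤t)))

∈-decode₂ : ∀ {n t m l} → IsPDO m → IsPDO l → weight m ℕ.+ weight l < oddNumber n → weight m ℕ.+ weight l ≤ t →
  ∃[ v ] (m , l) ≡ decode₂ v × v ∈ vectors (cartesianProduct (blocks t) (blocks t)) n
∈-decode₂ {n} {t} {m} {l} pdo pdo′ w<n w≤t
  with decode-surjective n m pdo (All.map (λ a≤ → ℕ.≤-<-trans (ℕ.≤-trans a≤ (ℕ.m≤m+n _ _)) w<n) (sizes-≤-weight m))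
     | decode-surjective n l pdo′ (All.map (λ a≤ → ℕ.≤-<-trans (ℕ.≤-trans a≤ (ℕ.m≤n+m _ _)) w<n) (sizes-≤-weight l))
... | v , refl | v′ , refl = Vec.zip v v′
  , sym (cong₂ _,_ (cong decode (Vec.map-proj₁-zip v v′)) (cong decode (Vec.map-proj₂-zip v v′)))
  , ∈-vectors _ (Vec.zip v v′) λ i → subst (_∈ _) (sym (Vec.lookup-zip i v v′)) (∈-cartesianProduct⁺
      (∈-blocks (Vec.lookup v i) (bound v i (ℕ.≤-trans (ℕ.m≤m+n _ _) w≤t)))
      (∈-blocks (Vec.lookup v′ i) (bound v′ i (ℕ.≤-trans (ℕ.m≤n+m _ (weight (decode v))) w≤t))))
  where
  bound : ∀ (v : Vec Block n) i → weight (decode v) ≤ t → occurrences (Vec.lookup v i) ≤ t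
  bound v i w≤t = ℕ.≤-trans (lookup-≤-total v i) (ℕ.≤-trans (ℕ.≤-reflexive (sym (weight-decode v))) w≤t)

-- Counting partitions by their codes

total-proj : ∀ (s : ℕ → Block → ℕ) {n} (v : Vec (Block × Block) n) →
  total s (Vec.map proj₁ v) + total s (Vec.map proj₂ v) ≡ total (λ i (b , b′) → s i b + s i b′) v
total-proj s []                   = refl
total-proj s {suc n} ((b , b′) ∷ v) = trans (interchange (s n b) _ (s n b′) _)
  (cong (_+_ (s n b + s n b′)) (total-proj s v))
  where
  interchange : ∀ a b c d → (a + b) + (c + d) ≡ (a + c) + (b + d)
  interchange = solve-∀

total-cong : ∀ {a} {A : Set a} {s s′ : ℕ → A → ℕ} → (∀ n a → s n a ≡ s′ n a) →
  ∀ {n} (v : Vec A n) → total s v ≡ total s′ v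
total-cong s≡ []              = refl
total-cong s≡ {suc n} (a ∷ v) = cong₂ _+_ (s≡ n a) (total-cong s≡ v)

total-*ˡ : ∀ {a} {A : Set a} m (s : ℕ → A → ℕ) {n} (v : Vec A n) → m * total s v ≡ total (λ i a → m * s i a) v
total-*ˡ m s []              = ℕ.*-zeroʳ m
total-*ˡ m s {suc n} (a ∷ v) = trans (ℕ.*-distribˡ-+ m (s n a) (total s v)) (cong (_+_ (m * s n a)) (total-*ˡ m s v))

-- The code list may well contain codes of other weights; `R` selects the right ones. The images of
-- these and the enumerated objects with `Q` are duplicate-free lists with the same members, hence
-- permutations of each other.
number-via-codes : ∀ {a p q r v} {A : Set a} {P : Pred A p} {Q : Pred A q} {V : Set v} {R : Pred V r}
  (e : Enumeration P) (Q? : Decidable Q) (cs : List V) (R? : Decidable R) (f : V → A) →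
  Unique cs → (∀ {v v′} → f v ≡ f v′ → v ≡ v′) →
  (∀ {v} → R v → P (f v) × Q (f v)) →
  (∀ {a} → P a → Q a → ∃[ v ] a ≡ f v × v ∈ cs × R v) →
  number e Q? ≡ length (filter R? cs)
number-via-codes e Q? cs R? f cs! f-injective R⇒ R⇐ =
  trans (↭-length filter↭) (List.length-map f (filter R? cs))
  where
  to : ∀ {a} → a ∈ filter Q? (elements e) → a ∈ map f (filter R? cs)
  to a∈ with ∈-filter⁻ Q? {xs = elements e} a∈
  ... | a∈e , Qa with R⇐ (sound e a∈e) Qa
  ...   | v , refl , v∈ , Rv = ∈-map⁺ f (∈-filter⁺ R? v∈ Rv)
  from : ∀ {a} → a ∈ map f (filter R? cs) → a ∈ filter Q? (elements e)
  from a∈ with ∈-map⁻ f {xs = filter R? cs} a∈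
  ... | v , v∈ , refl = let Pa , Qa = R⇒ (proj₂ (∈-filter⁻ R? {xs = cs} v∈))
                        in ∈-filter⁺ Q? (complete e Pa) Qa
  filter↭ : filter Q? (elements e) ↭ map f (filter R? cs)
  filter↭ = unique∧sameMembers⇒↭ (Unique.filter⁺ Q? (unique e))
    (Unique.map⁺ f-injective (Unique.filter⁺ R? cs!)) to from

module _ (d k j : ℕ) where

  private
    2d<N : 2 * d < oddNumber (numberOfFactors d)
    2d<N = s≤s (ℕ.≤-trans (ℕ.n≤1+n (2 * d)) (ℕ.m≤n*m (suc (2 * d)) 2))
    2d≤t : 2 * d ≤ blockBound d
    2d≤t = ℕ.*-monoʳ-≤ 2 (ℕ.n≤1+n d)

  HasLeftStatistics : Vec Block (numberOfFactors d) → Set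
  HasLeftStatistics v =
    total blockWeight v ≡ 2 * d × total (λ _ → occurs) v ≡ k × total (λ _ → parity ∘ occurrences) v ≡ j

  hasLeftStatistics? : Decidable HasLeftStatistics
  hasLeftStatistics? v =
    total blockWeight v ≟ 2 * d ×-dec total (λ _ → occurs) v ≟ k ×-dec total (λ _ → parity ∘ occurrences) v ≟ j

  HasRightStatistics : Vec (Block × Block) (numberOfFactors d) → Set
  HasRightStatistics v =
    total pairWeight v ≡ d × total (λ _ → pairOccurs) v ≡ k × total (λ _ → pairOverlap) v ≡ j

  hasRightStatistics? : Decidable HasRightStatistics
  hasRightStatistics? v =
    total pairWeight v ≟ d ×-dec total (λ _ → pairOccurs) v ≟ k ×-dec total (λ _ → pairOverlap) v ≟ j

  number-pdos : number (pdosOfWeight (2 * d)) (λ l → (ℓd l ≟ k) ×-dec (ℓdᵒ l ≟ j)) ≡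
                length (filter hasLeftStatistics? (codes d))
  number-pdos = number-via-codes (pdosOfWeight (2 * d)) (λ l → (ℓd l ≟ k) ×-dec (ℓdᵒ l ≟ j)) (codes d)
    hasLeftStatistics? decode (vectors-unique _ (blocks-unique (blockBound d))) (decode-injective _ _)
    (λ {v} (w≡ , k≡ , j≡) → (decode-isPDO v , trans (weight-decode v) w≡)
      , trans (ℓd-decode v) k≡ , trans (ℓdᵒ-decode v) j≡)
    surjective
    where
    surjective : ∀ {l} → PDOOfWeight (2 * d) l → ℓd l ≡ k × ℓdᵒ l ≡ j →
      ∃[ v ] l ≡ decode v × v ∈ codes d × HasLeftStatistics v
    surjective {l} (pdo , w≡) (k≡ , j≡)
      with ∈-decode {numberOfFactors d} {blockBound d} pdo
             (subst (_< oddNumber (numberOfFactors d)) (sym w≡) 2d<N) (subst (_≤ blockBound d) (sym w≡) 2d≤t)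
    ... | v , refl , v∈ = v , refl , v∈ , trans (sym (weight-decode v)) w≡
                        , trans (sym (ℓd-decode v)) k≡ , trans (sym (ℓdᵒ-decode v)) j≡

  private
    weight-decode₂ : ∀ (v : Vec (Block × Block) (numberOfFactors d)) →
      weight (proj₁ (decode₂ v)) + weight (proj₂ (decode₂ v)) ≡ total pairWeight v
    weight-decode₂ v = trans (cong₂ _+_ (weight-decode (Vec.map proj₁ v)) (weight-decode (Vec.map proj₂ v)))
      (trans (total-proj blockWeight v)
        (total-cong (λ n (b , b′) → sym (ℕ.*-distribˡ-+ (oddNumber n) (occurrences b) (occurrences b′))) v))

    ℓd-decode₂ : ∀ (v : Vec (Block × Block) (numberOfFactors d)) →
      ℓd (proj₁ (decode₂ v)) + ℓd (proj₂ (decode₂ v)) ≡ total (λ _ → pairOccurs) v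
    ℓd-decode₂ v = trans (cong₂ _+_ (ℓd-decode (Vec.map proj₁ v)) (ℓd-decode (Vec.map proj₂ v)))
      (total-proj (λ _ → occurs) v)

    2*ℓr-decode : ∀ (v : Vec (Block × Block) (numberOfFactors d)) →
      2 * ℓr (proj₁ (decode₂ v)) (proj₂ (decode₂ v)) ≡ total (λ _ → pairOverlap) v
    2*ℓr-decode v = trans (cong (2 *_) (ℓr-decode v)) (total-*ˡ 2 (λ _ (b , b′) → occurs b * occurs b′) v)

  number-pairs : number (pairsOfWeight d) (λ (m , l) → (ℓd m + ℓd l ≟ k) ×-dec (2 * ℓr m l ≟ j)) ≡
                 length (filter hasRightStatistics? (pairCodes d))
  number-pairs = number-via-codes (pairsOfWeight d) (λ (m , l) → (ℓd m + ℓd l ≟ k) ×-dec (2 * ℓr m l ≟ j)) (pairCodes d)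
    hasRightStatistics? decode₂
    (vectors-unique _ (Unique.cartesianProduct⁺ (blocks-unique (blockBound d)) (blocks-unique (blockBound d))))
    (decode₂-injective _ _)
    (λ {v} (w≡ , k≡ , j≡) →
      (decode-isPDO (Vec.map proj₁ v) , decode-isPDO (Vec.map proj₂ v) , trans (weight-decode₂ v) w≡)
      , trans (ℓd-decode₂ v) k≡ , trans (2*ℓr-decode v) j≡)
    surjective
    where
    d≤2d : d ≤ 2 * d
    d≤2d = ℕ.m≤n*m d 2
    surjective : ∀ {u} → PairOfWeight d u → (let (m , l) = u in ℓd m + ℓd l ≡ k × 2 * ℓr m l ≡ j) →
      ∃[ v ] u ≡ decode₂ v × v ∈ pairCodes d × HasRightStatistics v
    surjective {m , l} (pdo , pdo′ , w≡) (k≡ , j≡)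
      with ∈-decode₂ {numberOfFactors d} {blockBound d} pdo pdo′
             (subst (_< oddNumber (numberOfFactors d)) (sym w≡) (ℕ.≤-<-trans d≤2d 2d<N))
             (subst (_≤ blockBound d) (sym w≡) (ℕ.≤-trans d≤2d 2d≤t))
    ... | v , refl , v∈ = v , refl , v∈ , trans (sym (weight-decode₂ v)) w≡
                        , trans (sym (ℓd-decode₂ v)) k≡ , trans (sym (2*ℓr-decode v)) j≡

-- Extraction of coefficients

open Sums ℤ.+-*-commutativeRing using () renaming (∑[_] to ∑ᶻ[_])

∑-indicator : ∀ {a p} {A : Set a} {P : Pred A p} (P? : Decidable P) (f : A → ℤ) as →
  (∀ a → P a → f a ≡ 1ℤ) → (∀ a → ¬ P a → f a ≡ 0ℤ) → ∑ᶻ[ as ] f ≡ ℤ.+ length (filter P? as)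
∑-indicator P? f []       f≡1 f≡0 = refl
∑-indicator P? f (a ∷ as) f≡1 f≡0 with P? a
... | yes Pa = cong₂ ℤ._+_ (f≡1 a Pa) (∑-indicator P? f as f≡1 f≡0)
... | no ¬Pa = trans (cong₂ ℤ._+_ (f≡0 a ¬Pa) (∑-indicator P? f as f≡1 f≡0)) (ℤ.+-identityˡ _)

-- The coefficient of x^k y^j p^d is read off in ℤ[x]/(x^(k+1))[y]/(y^(j+1))[p]/(p^(d+1)).
module Coefficients (d k j : ℕ) where

  private
    module Pˣ = TruncatedPowerSeries ℤ.+-*-commutativeRing k
    module Rˣ = CommutativeRing Pˣ.truncated
    module Pʸ = TruncatedPowerSeries Pˣ.truncated j
    module Rʸ = CommutativeRing Pʸ.truncated
    module Pᵖ = TruncatedPowerSeries Pʸ.truncated d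
    module Rᵖ = CommutativeRing Pᵖ.truncated
    module ^ˣ = Algebra.Properties.Semiring.Exp Rˣ.semiring
    module ^ʸ = Algebra.Properties.Semiring.Exp Rʸ.semiring
    module ^ᵖ = Algebra.Properties.Semiring.Exp Rᵖ.semiring
    module ∑ᵖ = Sums Pᵖ.truncated

    x y p : Rᵖ.Carrier
    x = Pᵖ.constant (Pʸ.constant Pˣ.X)
    y = Pᵖ.constant Pʸ.X
    p = Pᵖ.X

    coefficientOf : Rᵖ.Carrier → ℤ
    coefficientOf u = u d j k

    coefficientOf-cong : ∀ {u v} → u Rᵖ.≈ v → coefficientOf u ≡ coefficientOf v
    coefficientOf-cong u≈v = u≈v ℕ.≤-refl ℕ.≤-refl ℕ.≤-refl

    coefficientOf-∑ : ∀ {a} {A : Set a} (as : List A) f →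
      coefficientOf (∑ᵖ.∑[ as ] f) ≡ ∑ᶻ[ as ] (coefficientOf ∘ f)
    coefficientOf-∑ []       f = refl
    coefficientOf-∑ (a ∷ as) f = cong (ℤ._+_ (coefficientOf (f a))) (coefficientOf-∑ as f)

    x^≈ : ∀ n → x ^ᵖ.^ n Rᵖ.≈ Pᵖ.constant (Pʸ.constant (Pˣ.X ^ˣ.^ n))
    x^≈ n = Rᵖ.sym (Rᵖ.trans (Pᵖ.constant-cong (Pʸ.constant-^ Pˣ.X n)) (Pᵖ.constant-^ (Pʸ.constant Pˣ.X) n))

    y^≈ : ∀ n → y ^ᵖ.^ n Rᵖ.≈ Pᵖ.constant (Pʸ.X ^ʸ.^ n)
    y^≈ n = Rᵖ.sym (Pᵖ.constant-^ Pʸ.X n)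

    -- Powers of x and y are constants with respect to p, so degree d in p is read off from `u`
    -- alone.
    coefficientOf-product : ∀ k′ j′ u →
      coefficientOf (x ^ᵖ.^ k′ Rᵖ.* y ^ᵖ.^ j′ Rᵖ.* u) ≡
      (Pʸ.constant (Pˣ.X ^ˣ.^ k′) Rʸ.* Pʸ.X ^ʸ.^ j′ Rʸ.* u d) j k
    coefficientOf-product k′ j′ u = trans
      (coefficientOf-cong {x ^ᵖ.^ k′ Rᵖ.* y ^ᵖ.^ j′ Rᵖ.* u} {Pᵖ.constant c Rᵖ.* u}
        (Rᵖ.*-congʳ {u} (Rᵖ.trans (Rᵖ.*-cong (x^≈ k′) (y^≈ j′)) (Rᵖ.sym (Pᵖ.constant-homo-* _ _)))))
      (Pᵖ.constant-* c u d ℕ.≤-refl ℕ.≤-refl)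
      where
      c = Pʸ.constant (Pˣ.X ^ˣ.^ k′) Rʸ.* Pʸ.X ^ʸ.^ j′

    coefficient-xy : ∀ k′ j′ → (Pʸ.constant (Pˣ.X ^ˣ.^ k′) Rʸ.* Pʸ.X ^ʸ.^ j′) j k ≡
      (Pˣ.X ^ˣ.^ k′ Rˣ.* (Pʸ.X ^ʸ.^ j′) j) k
    coefficient-xy k′ j′ = Pʸ.constant-* (Pˣ.X ^ˣ.^ k′) (Pʸ.X ^ʸ.^ j′) j ℕ.≤-refl

    coefficient-1 : ∀ {k′ j′ u} → u d Rʸ.≈ Rʸ.1# → k′ ≡ k → j′ ≡ j →
      coefficientOf (x ^ᵖ.^ k′ Rᵖ.* y ^ᵖ.^ j′ Rᵖ.* u) ≡ 1ℤ
    coefficient-1 {k′} {j′} {u} u≈1 refl refl = trans (coefficientOf-product k′ j′ u) (trans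
      (Rʸ.trans (Rʸ.*-congˡ {Pʸ.constant (Pˣ.X ^ˣ.^ k′) Rʸ.* Pʸ.X ^ʸ.^ j′} u≈1) (Rʸ.*-identityʳ _) ℕ.≤-refl ℕ.≤-refl)
      (trans (coefficient-xy k′ j′)
        (trans (Rˣ.trans (Rˣ.*-congˡ {Pˣ.X ^ˣ.^ k′} (Pʸ.X^n[n] j′)) (Rˣ.*-identityʳ _) ℕ.≤-refl) (Pˣ.X^n[n] k′))))

    coefficient-0ᵖ : ∀ {u} k′ j′ → u d Rʸ.≈ Rʸ.0# → coefficientOf (x ^ᵖ.^ k′ Rᵖ.* y ^ᵖ.^ j′ Rᵖ.* u) ≡ 0ℤ
    coefficient-0ᵖ {u} k′ j′ u≈0 = trans (coefficientOf-product k′ j′ u)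
      (Rʸ.trans (Rʸ.*-congˡ {Pʸ.constant (Pˣ.X ^ˣ.^ k′) Rʸ.* Pʸ.X ^ʸ.^ j′} u≈0) (Rʸ.zeroʳ _) ℕ.≤-refl ℕ.≤-refl)

    coefficient-0 : ∀ {k′ j′ u} → u d Rʸ.≈ Rʸ.1# → k′ ≢ k ⊎ j′ ≢ j →
      coefficientOf (x ^ᵖ.^ k′ Rᵖ.* y ^ᵖ.^ j′ Rᵖ.* u) ≡ 0ℤ
    coefficient-0 {k′} {j′} {u} u≈1 fails = trans (coefficientOf-product k′ j′ u) (trans
      (Rʸ.trans (Rʸ.*-congˡ {Pʸ.constant (Pˣ.X ^ˣ.^ k′) Rʸ.* Pʸ.X ^ʸ.^ j′} u≈1) (Rʸ.*-identityʳ _) ℕ.≤-refl ℕ.≤-refl)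
      (trans (coefficient-xy k′ j′) (vanishes fails)))
      where
      vanishes : k′ ≢ k ⊎ j′ ≢ j → (Pˣ.X ^ˣ.^ k′ Rˣ.* (Pʸ.X ^ʸ.^ j′) j) k ≡ 0ℤ
      vanishes (inj₂ j′≢j) =
        Rˣ.trans (Rˣ.*-congˡ {Pˣ.X ^ˣ.^ k′} (Pʸ.X^n[m] (j′≢j ∘ sym))) (Rˣ.zeroʳ _) ℕ.≤-refl
      vanishes (inj₁ k′≢k) with j′ ≟ j
      ... | yes refl = trans (Rˣ.trans (Rˣ.*-congˡ {Pˣ.X ^ˣ.^ k′} (Pʸ.X^n[n] j′)) (Rˣ.*-identityʳ _) ℕ.≤-refl)
                         (Pˣ.X^n[m] (k′≢k ∘ sym))
      ... | no j′≢j  = vanishes (inj₂ j′≢j)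

    coefficient-0′ : ∀ {w w′ k′ j′ u} → (w ≡ w′ → u d Rʸ.≈ Rʸ.1#) → (w ≢ w′ → u d Rʸ.≈ Rʸ.0#) →
      ¬ (w ≡ w′ × k′ ≡ k × j′ ≡ j) → coefficientOf (x ^ᵖ.^ k′ Rᵖ.* y ^ᵖ.^ j′ Rᵖ.* u) ≡ 0ℤ
    coefficient-0′ {w} {w′} {k′} {j′} {u} u≈1 u≈0 fails = byCases (w ≟ w′) (k′ ≟ k)
      where
      byCases : Dec (w ≡ w′) → Dec (k′ ≡ k) → coefficientOf (x ^ᵖ.^ k′ Rᵖ.* y ^ᵖ.^ j′ Rᵖ.* u) ≡ 0ℤ
      byCases (no w≢)  _        = coefficient-0ᵖ {u} k′ j′ (u≈0 w≢)
      byCases (yes w≡) (no k′≢) = coefficient-0 {k′} {j′} {u} (u≈1 w≡) (inj₁ k′≢)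
      byCases (yes w≡) (yes k≡) = coefficient-0 {k′} {j′} {u} (u≈1 w≡) (inj₂ λ j≡ → fails (w≡ , k≡ , j≡))

    halfPower-even : ∀ n → halfPower Pᵖ.truncated p (n * 2) ≡ p ^ᵖ.^ n
    halfPower-even zero    = refl
    halfPower-even (suc n) = cong (p Rᵖ.*_) (halfPower-even n)

    halfPower-odd : ∀ n i → halfPower Pᵖ.truncated p (suc (n * 2)) i Rʸ.≈ Rʸ.0#
    halfPower-odd zero    i       = Rʸ.refl
    halfPower-odd (suc n) i       = Pᵖ.X*-zero (halfPower-odd n) i

    -- The exponent of p is half the weight, so degree d belongs to weight 2d.
    halfPower[d]≈1 : ∀ {w} → w ≡ 2 * d → halfPower Pᵖ.truncated p w d Rʸ.≈ Rʸ.1#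
    halfPower[d]≈1 refl = Rʸ.trans
      (Rʸ.reflexive (cong (λ u → u d) (trans (cong (halfPower Pᵖ.truncated p) (ℕ.*-comm 2 d)) (halfPower-even d))))
      (Pᵖ.X^n[n] d)

    halfPower[d]≈0 : ∀ {w} → w ≢ 2 * d → halfPower Pᵖ.truncated p w d Rʸ.≈ Rʸ.0#
    halfPower[d]≈0 {w} w≢2d = byCases (2 ∣? w)
      where
      even : ∀ n → w ≡ n * 2 → halfPower Pᵖ.truncated p w d Rʸ.≈ Rʸ.0#
      even n refl = Rʸ.trans (Rʸ.reflexive (cong (λ u → u d) (halfPower-even n)))
        (Pᵖ.X^n[m] {d} {n} λ d≡n → w≢2d (trans (ℕ.*-comm n 2) (cong (2 *_) (sym d≡n))))
      odd : ∀ n → w ≡ oddNumber n → halfPower Pᵖ.truncated p w d Rʸ.≈ Rʸ.0#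
      odd n refl = Rʸ.trans
        (Rʸ.reflexive (cong (λ m → halfPower Pᵖ.truncated p (suc m) d) (ℕ.*-comm 2 n)))
        (halfPower-odd n d)
      byCases : Dec (2 ∣ w) → halfPower Pᵖ.truncated p w d Rʸ.≈ Rʸ.0#
      byCases (yes (divides n w≡)) = even n w≡
      byCases (no 2∤w) = let n , w≡ = odd⇒oddNumber w 2∤w in odd n w≡

    power[d]≈1 : ∀ {w} → w ≡ d → (p ^ᵖ.^ w) d Rʸ.≈ Rʸ.1#
    power[d]≈1 refl = Pᵖ.X^n[n] d

    power[d]≈0 : ∀ {w} → w ≢ d → (p ^ᵖ.^ w) d Rʸ.≈ Rʸ.0#
    power[d]≈0 w≢d = Pᵖ.X^n[m] (w≢d ∘ sym)

  -- Each code contributes a single monomial, or 0 if its weight on the left is odd, so the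
  -- coefficient of x^k y^j p^d on either side counts codes. It survives the truncations because
  -- each degree equals its bound.
  number-codes : length (filter (hasLeftStatistics? d k j) (codes d)) ≡
                 length (filter (hasRightStatistics? d k j) (pairCodes d))
  number-codes = ℤ.+-injective (trans (sym left) (trans
    (coefficientOf-cong (leftSum≈rightSum (even-part-identity Pᵖ.truncated d x y p Pᵖ.X-nilpotent))) right))
    where
    left : coefficientOf (leftSum Pᵖ.truncated d x y p) ≡ ℤ.+ length (filter (hasLeftStatistics? d k j) (codes d))
    left = trans (coefficientOf-∑ (codes d) _) (∑-indicator (hasLeftStatistics? d k j) _ (codes d)
      (λ v (w≡ , k≡ , j≡) → coefficient-1 {u = halfPower Pᵖ.truncated p (total blockWeight v)} (halfPower[d]≈1 w≡) k≡ j≡)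
      (λ v → coefficient-0′ {u = halfPower Pᵖ.truncated p (total blockWeight v)} halfPower[d]≈1 halfPower[d]≈0))
    right : coefficientOf (rightSum Pᵖ.truncated d x y p) ≡ ℤ.+ length (filter (hasRightStatistics? d k j) (pairCodes d))
    right = trans (coefficientOf-∑ (pairCodes d) _) (∑-indicator (hasRightStatistics? d k j) _ (pairCodes d)
      (λ v (w≡ , k≡ , j≡) → coefficient-1 {u = p ^ᵖ.^ total pairWeight v} (power[d]≈1 w≡) k≡ j≡)
      (λ v → coefficient-0′ {u = p ^ᵖ.^ total pairWeight v} power[d]≈1 power[d]≈0))

coefficient-∑ : ∀ {a} {A : Set a} (f g : A → ℕ) k j us →
  coefficient k j (concatMap (λ u → x^ f u y^ g u) us) ≡
  ℤ.+ length (filter (λ u → (f u ≟ k) ×-dec (g u ≟ j)) us)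
coefficient-∑ f g k j []       = refl
-- `coefficient` tests `k ≟ f u`, the filter tests `f u ≟ k`; deciding the case once settles both.
coefficient-∑ f g k j (u ∷ us) = byCases (Q? u)
  where
  Q? : Decidable (λ u → f u ≡ k × g u ≡ j)
  Q? u = (f u ≟ k) ×-dec (g u ≟ j)
  byCases : Dec (f u ≡ k × g u ≡ j) →
    coefficient k j (concatMap (λ u → x^ f u y^ g u) (u ∷ us)) ≡ ℤ.+ length (filter Q? (u ∷ us))
  byCases (yes holds@(f≡ , g≡)) = trans
    (cong₂ ℤ._+_ (cong (if_then 1ℤ else 0ℤ) (dec-true (k ≟ f u ×-dec j ≟ g u) (sym f≡ , sym g≡)))
      (coefficient-∑ f g k j us))
    (cong (ℤ.+_ ∘ length) (sym (List.filter-accept Q? holds)))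
  byCases (no fails) = trans
    (cong₂ ℤ._+_ (cong (if_then 1ℤ else 0ℤ)
      (dec-false (k ≟ f u ×-dec j ≟ g u) (λ (k≡ , j≡) → fails (sym k≡ , sym j≡))))
      (coefficient-∑ f g k j us))
    (trans (ℤ.+-identityˡ _) (cong (ℤ.+_ ∘ length) (sym (List.filter-reject Q? fails))))

number-pdos≡number-pairs : ∀ n k j →
  number (pdosOfWeight (2 * n)) (λ l → (ℓd l ≟ k) ×-dec (ℓdᵒ l ≟ j)) ≡
  number (pairsOfWeight n) (λ (m , l) → (ℓd m + ℓd l ≟ k) ×-dec (2 * ℓr m l ≟ j))
number-pdos≡number-pairs n k j =
  trans (number-pdos n k j) (trans (Coefficients.number-codes n k j) (sym (number-pairs n k j)))

theorem3p4 : (∀ (n k j : ℕ) → j ≤ k →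
    number (pdosOfWeight (2 * n)) (λ l → (ℓd l ≟ k) ×-dec (ℓdᵒ l ≟ j))
    ≡ number (pairsOfWeight n) (λ (m , l) → (ℓd m + ℓd l ≟ k) ×-dec (2 * ℓr m l ≟ j)))
    × (∀ (n : ℕ) → [q^ (2 * n) ] P₁ ≈ [q^ n ] P₂)
theorem3p4 = (λ n k j _ → number-pdos≡number-pairs n k j) , λ n k j → trans
  (coefficient-∑ ℓd ℓdᵒ k j (elements (pdosOfWeight (2 * n))))
  (trans (cong ℤ.+_ (number-pdos≡number-pairs n k j))
    (sym (coefficient-∑ (λ (m , l) → ℓd m + ℓd l) (λ (m , l) → 2 * ℓr m l) k j (elements (pairsOfWeight n)))))
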